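{- The algorithm LetrecUnify is sound and complete. That is, for every input $LRLX$-unification problem $(\Gamma,\nabla)$: every unifier computed by LetrecUnify is a unifier of the input problem (soundness); and for every ground unifier $\mu$ (i.e. every ground solution) of the input problem there is a run of the nondeterministic algorithm that produces a unifier $(\sigma,\nabla',FIX)$ that has the ground unifier as an instance, i.e. such that there is a ground substitution $\rho$ with $X\mu\sim X\sigma\rho$ for all $X\in Var(\Gamma,\nabla)$ (completeness).
   Context: **Ground language $LRL$.** Let $\mathbb{A}$ be an infinite set of atoms and $\mathcal{F}$ a set of function symbols $f$ with arity $ar(f)$. Expressions of $LRL$: $e ::= a \mid \lambda a.e \mid (f~e_1\ldots e_{ar(f)}) \mid (\mathtt{letrec}~a_1.e_1;\ldots;a_n.e_n~\mathtt{in}~e)$, with pairwise distinct binding atoms $a_1,\ldots,a_n$ in a letrec; environments $a_1.e_1;\ldots;a_n.e_n$ are multisets of bindings. The scope of $a$ in $\lambda a.e$ is $e$; the scope of each $a_i$ in the letrec is all of $e_1,\ldots,e_n,e$. $FA(e)$ is the set of free atoms; $a\#e$ means $a\notin FA(e)$. Permutations $\pi$ are finite permutations of $\mathbb{A}$, represented as lists of swappings $(a~b)$; $dom(\pi)=\{a\mid \pi(a)\ne a\}$; $\pi\cdot e$ applies $\pi$ to all atoms of $e$, including binders. $\alpha$-equivalence $\sim$: $a\sim a$; congruence for function symbols and for $\lambda a$; $\lambda a.e\sim\lambda b.e'$ if $a\#e'$ and $e\sim(a~b)\cdot e'$; and $(\mathtt{letrec}~a_1.s_1;\ldots;a_n.s_n~\mathtt{in}~r)\sim(\mathtt{letrec}~b_1.t_1;\ldots;b_n.t_n~\mathtt{in}~r')$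 if (after possibly reordering bindings) there is a permutation $\pi$ with $dom(\pi)\subseteq\{a_i\}\cup\{b_i\}$, $\pi(b_i)=a_i$, $a_i\#(\mathtt{letrec}~b_1.t_1;\ldots;b_n.t_n~\mathtt{in}~r')$, $s_i\sim\pi\cdot t_i$ for all $i$, and $r\sim\pi\cdot r'$. **$LRLX$ and unification problems.** $LRLX$ extends $LRL$ by variables $X$ and suspensions $\pi\cdot X$ ($X$ is identified with $Id\cdot X$; for non-variables $e$, $\pi\cdot e$ means that $\pi$ is shifted down to the suspensions, with $\pi_1\cdot(\pi_2\cdot e)=(\pi_1\circ\pi_2)\cdot e$). An $LRLX$-unification problem is a pair $(\Gamma,\nabla)$ of a set $\Gamma$ of equations $s\doteq t$ and a set $\nabla$ of freshness constraints $a\#X$. A (ground) solution is a substitution $\rho$ mapping the variables of $(\Gamma,\nabla)$ to ground expressions with $s\rho\sim t\rho$ for all equations and $a\#(X\rho)$ for all constraints. **Unifiers.** A triple $(\sigma,\nabla',FIX)$, where $\sigma$ is a substitution represented by a sequence of single assignments (a DAG-compression), $\nabla'$ a set of freshness constraints, and $FIX$ a set of fixpoint equations $\pi'\cdot X\doteq\pi\cdot X$ with $X\notin dom(\sigma)$, is a unifier of $(\Gamma,\nabla)$ if (i) there is a ground substitution $\rho$ solving $(\nabla'\sigma,FIX)$, i.e. $a\#X\sigma\rho$ holds for every $a\#X$ in $\nabla'$ and $\pi'\cdot(X\rho)\sim\pi\cdot(X\rho)$ for every $\pi'\cdot X\doteq\pi\cdot X$ in $FIX$; and (ii) for every ground substitution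 $\rho$ that instantiates all variables in $Var(\Gamma,\nabla)$ and solves $(\nabla'\sigma,FIX)$, $\sigma\rho$ is a solution of $(\Gamma,\nabla)$. **Algorithm LetrecUnify.** It operates on states $(\Gamma,\nabla,\theta)$; initially $\theta=\emptyset$ and $\Gamma$ is flattened, i.e. arguments of function symbols, bodies of abstractions, and right-hand sides of bindings and in-expressions of letrecs are replaced by fresh variables $X$ with added equations $X\doteq t$. $\doteq$ is symmetric. Freshness constraints are always simplified: $a\#b$ ($a\neq b$), $a\#\lambda a.s$, and $a\#(\mathtt{letrec}~a_1.s_1;\ldots;a_n.s_n~\mathtt{in}~r)$ with $a\in\{a_1,\ldots,a_n\}$ are deleted; $a\#(f~s_1\ldots s_n)$ becomes all $a\#s_i$; $a\#\lambda b.s$ ($a\ne b$) becomes $a\#s$; $a\#(\mathtt{letrec}~a_1.s_1;\ldots;a_n.s_n~\mathtt{in}~r)$ with $a\notin\{a_1,\ldots,a_n\}$ becomes $a\#s_1,\ldots,a\#s_n,a\#r$; $a\#(\pi\cdot X)$ becomes $\pi^{ -1}(a)\#X$; $a\#a$ yields failure. Components not mentioned in a rule are unchanged. Rules: (1) Delete $e\doteq e$. (2) $\pi_1\cdot X\doteq\pi_2\cdot Y$ with $X\ne Y$: delete it, replace $X$ by $\pi_1^{ -1}\pi_2\cdot Y$ in $\Gamma,\nabla$, add $X\mapsto\pi_1^{ -1}\pi_2\cdot Y$ to $\theta$. (3) $(f~s_1\ldots s_n)\doteq(f~s_1'\ldots s_n')$: replace by $s_i\doteq s_i'$, $i=1,\ldots,n$.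 (4) $\lambda a.s\doteq\lambda a.t$: replace by $s\doteq t$. (5) $\lambda a.s\doteq\lambda b.t$, $a\ne b$: replace by $s\doteq(a~b)\cdot t$, add $a\#t$ to $\nabla$. (6) $(\mathtt{letrec}~a_1.s_1;\ldots;a_n.s_n~\mathtt{in}~r)\doteq(\mathtt{letrec}~b_1.t_1;\ldots;b_n.t_n~\mathtt{in}~r')$: choose (don't-know nondeterministically) a permutation $\rho$ of $\{1,\ldots,n\}$; replace by $s_i\doteq\pi\cdot t_{\rho(i)}$ ($i=1,\ldots,n$) and $r\doteq\pi\cdot r'$, and add $a_i\#(\mathtt{letrec}~b_1.t_1;\ldots;b_n.t_n~\mathtt{in}~r')$ for all $i$, where $\pi$ is any (don't-care) permutation extending $\{b_{\rho(i)}\mapsto a_i\}$ with $dom(\pi)\subseteq\{a_1,\ldots,a_n,b_1,\ldots,b_n\}$. (MMS) If $\pi_1\cdot X\doteq e_1$, $\pi_2\cdot X\doteq e_2$ are in $\Gamma$ and $e_1,e_2$ are not suspensions: delete the second, add the equations and freshness constraints resulting from decomposing $\pi_1^{ -1}\cdot e_1\doteq\pi_2^{ -1}\cdot e_2$ using (3)–(6). (FPS) From $\Gamma\,\dot\cup\,\{\pi_1\cdot X\doteq\pi_1'\cdot X,\ldots,\pi_n\cdot X\doteq\pi_n'\cdot X,\ \pi\cdot X\doteq e\}$ go to $\Gamma\cup\{\pi_i\pi^{ -1}\cdot e\doteq\pi_i'\pi^{ -1}\cdot e\mid i=1,\ldots,n\}$ and add $X\mapsto\pi^{ -1}\cdot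 e$ to $\theta$, provided $X\notin Var(\Gamma,e)$, $e$ is not a suspension, and (Cycle) is not applicable. (ElimFP) If $\pi_1\cdot X\doteq\pi_1'\cdot X,\ldots,\pi_n\cdot X\doteq\pi_n'\cdot X,\pi\cdot X\doteq\pi'\cdot X$ are in $\Gamma$ and $\pi^{ -1}\pi'$ lies in the group generated by $\pi_1^{ -1}\pi_1',\ldots,\pi_n^{ -1}\pi_n'$: delete $\pi\cdot X\doteq\pi'\cdot X$. (Output) If $\Gamma$ consists only of fixpoint equations, output $(\theta,\nabla,\Gamma)$. Failure rules (the run stops with failure): (Clash) $s\doteq t$ with $s,t$ not suspensions and different top symbols (the top symbol of an atom is the atom, of $(f\ldots)$ is $f$, of an abstraction is $\lambda$, of a letrec is $(\mathtt{letrec},n)$ with $n$ the number of bindings); (Cycle) $\Gamma$ contains $\pi_1\cdot X_1\doteq s_1,\ldots,\pi_n\cdot X_n\doteq s_n$, with no $s_i$ a suspension, $X_{i+1}$ occurring in $s_i$ for $i<n$, and $X_1$ occurring in $s_n$; (FailF) $a\#a\in\nabla$; (FailFS) $a\#X\in\nabla$ and $a$ occurs free in $X\theta$. Priorities: (1)–(6) and (ElimFP) highest; then (MMS) and (FPS); (Output) lowest. Only the choice of $\rho$ in (6) is don't-know nondeterministic; all other choices are don't-care. -}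

module Defs where

open import Data.Bool using (if_then_else_)
open import Data.Empty using (⊥)
open import Data.Fin.Permutation using (Permutation′; _⟨$⟩ʳ_)
open import Data.List as List using (List; []; _∷_; _++_; [_]; concatMap; reverse)
open import Data.List.Membership.Propositional using (_∈_; _∉_)
open import Data.List.Relation.Binary.Permutation.Propositional using (_↭_)
open import Data.List.Relation.Unary.All using (All)
open import Data.List.Relation.Unary.Any using (Any)
open import Data.List.Relation.Unary.Unique.Propositional as ListUnique using ()
open import Data.Maybe using (Maybe; just; nothing)
open import Data.Nat using (ℕ)
open import Data.Product using (∃; ∃₂; _×_; _,_; proj₁; proj₂; uncurry)
open import Data.Sum using (_⊎_)
open import Data.Vec as Vec using (Vec; []; _∷_; lookup; toList)
open import Data.Vec.Membership.Propositional as VecMem using ()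
import Data.Vec.Membership.DecPropositional as VecDec
open import Data.Vec.Relation.Unary.Unique.Propositional using (Unique)
open import Data.Vec.Relation.Unary.Unique.Propositional.Properties using (map⁺)
open import Function using (_∘_)
open import Relation.Binary.Construct.Closure.ReflexiveTransitive using (Star)
open import Relation.Binary.Construct.Closure.Transitive using (TransClosure)
open import Relation.Binary.Definitions using (DecidableEquality)
open import Relation.Binary.PropositionalEquality
  using (_≡_; _≢_; refl; sym; trans; cong)
open import Relation.Nullary using (¬_; yes; no; does; contradiction)

-- The fields `fresh…` express that the sets of atoms and of variables are
-- infinite: no finite list exhausts them.
record Language : Set₁ where
  field
    Atom      : Set
    _≟ᴬ_      : DecidableEquality Atom
    freshAtom : (as : List Atom) → ∃ λ a → a ∉ as
    Fun       : Set
    _≟ᶠ_      : DecidableEquality Fun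
    ar        : Fun → ℕ
    Var       : Set
    _≟ⱽ_      : DecidableEquality Var
    freshVar  : (Xs : List Var) → ∃ λ X → X ∉ Xs

module LRLX (L : Language) where
  open Language L public

  -- The head of the list is the swapping applied last, so that
  -- concatenation is composition.
  Perm : Set
  Perm = List (Atom × Atom)

  swap : Atom → Atom → Atom → Atom
  swap a b c = if does (c ≟ᴬ a) then b else (if does (c ≟ᴬ b) then a else c)

  infixr 20 _$_
  _$_ : Perm → Atom → Atom
  []            $ c = c
  ((a , b) ∷ π) $ c = swap a b (π $ c)

  infixr 22 _⊙_
  _⊙_ : Perm → Perm → Perm
  _⊙_ = _++_

  infix 25 _⁻¹
  _⁻¹ : Perm → Perm
  _⁻¹ = reverse

  infix 4 _≈ₚ_
  _≈ₚ_ : Perm → Perm → Set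
  π ≈ₚ π′ = ∀ a → π $ a ≡ π′ $ a

  data ⟨_⟩ (G : List Perm) : Perm → Set where
    gen  : ∀ {π} → π ∈ G → ⟨ G ⟩ π
    ε    : ⟨ G ⟩ []
    mul  : ∀ {π π′} → ⟨ G ⟩ π → ⟨ G ⟩ π′ → ⟨ G ⟩ (π ⊙ π′)
    inv  : ∀ {π} → ⟨ G ⟩ π → ⟨ G ⟩ (π ⁻¹)
    resp : ∀ {π π′} → π ≈ₚ π′ → ⟨ G ⟩ π → ⟨ G ⟩ π′

  swap-involutive : ∀ a b c → swap a b (swap a b c) ≡ c
  swap-involutive a b c with c ≟ᴬ a
  ... | yes refl with b ≟ᴬ c
  ...   | yes b≡c = b≡c
  ...   | no  _ with b ≟ᴬ b
  ...     | yes _   = refl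
  ...     | no  b≢b = contradiction refl b≢b
  swap-involutive a b c | no c≢a with c ≟ᴬ b
  ... | yes refl with a ≟ᴬ a
  ...   | yes _   = refl
  ...   | no  a≢a = contradiction refl a≢a
  swap-involutive a b c | no c≢a | no c≢b with c ≟ᴬ a
  ... | yes c≡a = contradiction c≡a c≢a
  ... | no  _ with c ≟ᴬ b
  ...   | yes c≡b = contradiction c≡b c≢b
  ...   | no  _   = refl

  $-injective : ∀ π {c d} → π $ c ≡ π $ d → c ≡ d
  $-injective []            eq = eq
  $-injective ((a , b) ∷ π) {c} {d} eq = $-injective π
    (trans (sym (swap-involutive a b (π $ c)))
      (trans (cong (swap a b) eq) (swap-involutive a b (π $ d))))

  -- `susp π X` is the suspension π·X.  The environment of a letrec is the
  -- vector of its binding atoms together with the vector of the right-hand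
  -- sides; that it is a multiset is accounted for in `_∼_`, `_≋_` and the
  -- decomposition rule for letrec.
  data Expr (V : Set) : Set where
    atom   : Atom → Expr V
    lam    : Atom → Expr V → Expr V
    fun    : (f : Fun) → Vec (Expr V) (ar f) → Expr V
    letrec : ∀ {n} (as : Vec Atom n) .(distinct : Unique as) →
             Vec (Expr V) n → Expr V → Expr V
    susp   : Perm → V → Expr V

  Ground : Set
  Ground = Expr ⊥

  Term : Set
  Term = Expr Var

  var : ∀ {V : Set} → V → Expr V
  var X = susp [] X

  infixr 20 _·_ _·*_
  mutual
    _·_ : ∀ {V : Set} → Perm → Expr V → Expr V
    π · atom a           = atom (π $ a)
    π · lam a e          = lam (π $ a) (π · e)
    π · fun f es         = fun f (π ·* es)
    π · letrec as u es e =
      letrec (Vec.map (π $_) as) (map⁺ ($-injective π) u) (π ·* es) (π · e)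
    π · susp π′ X        = susp (π ⊙ π′) X

    _·*_ : ∀ {V : Set} {n} → Perm → Vec (Expr V) n → Vec (Expr V) n
    π ·* []       = []
    π ·* (e ∷ es) = (π · e) ∷ (π ·* es)

  infixl 21 _⟪_⟫ _⟪_⟫*
  mutual
    _⟪_⟫ : ∀ {V W : Set} → Expr V → (V → Expr W) → Expr W
    atom a           ⟪ τ ⟫ = atom a
    lam a e          ⟪ τ ⟫ = lam a (e ⟪ τ ⟫)
    fun f es         ⟪ τ ⟫ = fun f (es ⟪ τ ⟫*)
    letrec as u es e ⟪ τ ⟫ = letrec as u (es ⟪ τ ⟫*) (e ⟪ τ ⟫)
    susp π X         ⟪ τ ⟫ = π · τ X

    _⟪_⟫* : ∀ {V W : Set} {n} → Vec (Expr V) n → (V → Expr W) → Vec (Expr W) n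
    []       ⟪ τ ⟫* = []
    (e ∷ es) ⟪ τ ⟫* = (e ⟪ τ ⟫) ∷ (es ⟪ τ ⟫*)

  -- Free atoms.  The atoms mentioned in the permutation of a suspension are
  -- not free occurrences.
  data _∈FA_ {V : Set} (a : Atom) : Expr V → Set where
    atom   : a ∈FA atom a
    lam    : ∀ {b e} → a ≢ b → a ∈FA e → a ∈FA lam b e
    fun    : ∀ {f es} i → a ∈FA lookup es i → a ∈FA fun f es
    rhs    : ∀ {n} {as : Vec Atom n} .{u : Unique as} {es e} →
             a VecMem.∉ as → ∀ i → a ∈FA lookup es i → a ∈FA letrec as u es e
    inExpr : ∀ {n} {as : Vec Atom n} .{u : Unique as} {es e} →
             a VecMem.∉ as → a ∈FA e → a ∈FA letrec as u es e

  infix 4 _∈FA_ _#_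
  _#_ : ∀ {V : Set} → Atom → Expr V → Set
  a # e = ¬ (a ∈FA e)

  data _∈Var_ {V : Set} (X : V) : Expr V → Set where
    lam    : ∀ {b e} → X ∈Var e → X ∈Var lam b e
    fun    : ∀ {f es} i → X ∈Var lookup es i → X ∈Var fun f es
    rhs    : ∀ {n} {as : Vec Atom n} .{u : Unique as} {es e} →
             ∀ i → X ∈Var lookup es i → X ∈Var letrec as u es e
    inExpr : ∀ {n} {as : Vec Atom n} .{u : Unique as} {es e} →
             X ∈Var e → X ∈Var letrec as u es e
    susp   : ∀ {π} → X ∈Var susp π X

  infix 4 _∈Var_

  -- π maps the i-th right-hand binder, after reordering by ρ, to the i-th
  -- left-hand one, and moves nothing but binders.
  record Matches {n} (π : Perm) (as bs : Vec Atom n) (ρ : Permutation′ n) : Set where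
    field
      dom   : ∀ c → π $ c ≢ c → (c VecMem.∈ as) ⊎ (c VecMem.∈ bs)
      binds : ∀ i → π $ lookup bs (ρ ⟨$⟩ʳ i) ≡ lookup as i

  infix 4 _∼_
  data _∼_ : Ground → Ground → Set where
    atom   : ∀ {a} → atom a ∼ atom a
    fun    : ∀ {f es es′} → (∀ i → lookup es i ∼ lookup es′ i) →
             fun f es ∼ fun f es′
    lam    : ∀ {a e e′} → e ∼ e′ → lam a e ∼ lam a e′
    lam≠   : ∀ {a b e e′} → a # e′ → e ∼ ((a , b) ∷ []) · e′ → lam a e ∼ lam b e′
    letrec : ∀ {n} {as bs : Vec Atom n} .{u : Unique as} .{v : Unique bs} {ss ts r r′}
             (ρ : Permutation′ n) (π : Perm) → Matches π as bs ρ →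
             (∀ i → lookup as i # letrec bs v ts r′) →
             (∀ i → lookup ss i ∼ π · lookup ts (ρ ⟨$⟩ʳ i)) →
             r ∼ π · r′ →
             letrec as u ss r ∼ letrec bs v ts r′

  -- Identity of expressions: environments are multisets, and permutations
  -- are compared as functions, not as lists of swappings.
  infix 4 _≋_
  data _≋_ {V : Set} : Expr V → Expr V → Set where
    atom   : ∀ {a} → atom a ≋ atom a
    fun    : ∀ {f es es′} → (∀ i → lookup es i ≋ lookup es′ i) →
             fun f es ≋ fun f es′
    lam    : ∀ {a e e′} → e ≋ e′ → lam a e ≋ lam a e′
    letrec : ∀ {n} {as bs : Vec Atom n} .{u : Unique as} .{v : Unique bs} {ss ts r r′}
             (ρ : Permutation′ n) →
             (∀ i → lookup as i ≡ lookup bs (ρ ⟨$⟩ʳ i)) →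
             (∀ i → lookup ss i ≋ lookup ts (ρ ⟨$⟩ʳ i)) →
             r ≋ r′ →
             letrec as u ss r ≋ letrec bs v ts r′
    susp   : ∀ {π π′ X} → π ≈ₚ π′ → susp π X ≋ susp π′ X

  infix 5 _≐_
  record Eqn : Set where
    constructor _≐_
    field
      leftSide rightSide : Term

  record Problem : Set where
    field
      Γ : List Eqn
      ∇ : List (Atom × Var)

  data _∈VarEqn_ (X : Var) : Eqn → Set where
    left  : ∀ {s t} → X ∈Var s → X ∈VarEqn (s ≐ t)
    right : ∀ {s t} → X ∈Var t → X ∈VarEqn (s ≐ t)

  _∈VarEqns_ : Var → List Eqn → Set
  X ∈VarEqns Γ = Any (X ∈VarEqn_) Γ

  _∈VarProblem_ : Var → Problem → Set
  X ∈VarProblem P = X ∈VarEqns Problem.Γ P ⊎ X ∈ List.map proj₂ (Problem.∇ P)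

  -- Only the values on the variables of the problem at hand matter.
  GroundSubst : Set
  GroundSubst = Var → Ground

  record Solves (μ : GroundSubst) (P : Problem) : Set where
    open Problem P
    field
      equations : ∀ {s t} → (s ≐ t) ∈ Γ → s ⟪ μ ⟫ ∼ t ⟪ μ ⟫
      freshness : ∀ {a X} → (a , X) ∈ ∇ → a # μ X

  infix 6 _↦_
  _↦_ : Var → Term → Var → Term
  (X ↦ t) Y = if does (Y ≟ⱽ X) then t else var Y

  -- A sequence of single assignments, to be applied from left to right.
  Subst : Set
  Subst = List (Var × Term)

  infixl 21 _[_]ˢ
  _[_]ˢ : Term → Subst → Term
  e [ [] ]ˢ          = e
  e [ (X , t) ∷ σ ]ˢ = e ⟪ X ↦ t ⟫ [ σ ]ˢ

  -- `σ ⨾ ρ` is σρ: first σ, then ρ.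
  infixr 9 _⨾_
  _⨾_ : Subst → GroundSubst → GroundSubst
  (σ ⨾ ρ) X = (var X [ σ ]ˢ) ⟪ ρ ⟫

  -- The fixpoint equation leftPerm·fixVar ≐ rightPerm·fixVar.
  record FixEqn : Set where
    constructor fix
    field
      leftPerm rightPerm : Perm
      fixVar             : Var

  fixEqn : FixEqn → Eqn
  fixEqn (fix π π′ X) = susp π X ≐ susp π′ X

  record Triple : Set where
    field
      σ   : Subst
      ∇′  : List (Atom × Var)
      FIX : List FixEqn

  record SolvesTriple (ρ : GroundSubst) (U : Triple) : Set where
    open Triple U
    field
      freshness : ∀ {a X} → (a , X) ∈ ∇′ → a # (σ ⨾ ρ) X
      fixpoints : ∀ {π π′ X} → fix π π′ X ∈ FIX → π · ρ X ∼ π′ · ρ X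

  record IsUnifier (P : Problem) (U : Triple) : Set where
    open Triple U
    field
      fix∉dom     : ∀ {π π′ X} → fix π π′ X ∈ FIX → X ∉ List.map proj₁ σ
      satisfiable : ∃ λ ρ → SolvesTriple ρ U
      solution    : ∀ ρ → SolvesTriple ρ U → Solves (σ ⨾ ρ) P

  -- `e ⇝ e′ ∣ Δ`: e′ is e with its immediate subexpressions replaced by
  -- variables, and Δ lists the equations X ≐ t for all the variables
  -- introduced, with t itself flattened.
  infix 4 _⇝_∣_ _⇝*_∣_
  mutual
    data _⇝_∣_ : Term → Term → List (Var × Term) → Set where
      atom   : ∀ {a} → atom a ⇝ atom a ∣ []
      susp   : ∀ {π X} → susp π X ⇝ susp π X ∣ []
      lam    : ∀ {a e e′ X Δ} → e ⇝ e′ ∣ Δ →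
               lam a e ⇝ lam a (var X) ∣ (X , e′) ∷ Δ
      fun    : ∀ {f es Xs Δ} → es ⇝* Xs ∣ Δ →
               fun f es ⇝ fun f (Vec.map var Xs) ∣ Δ
      letrec : ∀ {n} {as : Vec Atom n} .{u : Unique as} {es r X Xs Δ} →
               (r ∷ es) ⇝* (X ∷ Xs) ∣ Δ →
               letrec as u es r ⇝ letrec as u (Vec.map var Xs) (var X) ∣ Δ

    data _⇝*_∣_ : ∀ {n} → Vec Term n → Vec Var n → List (Var × Term) → Set where
      []  : [] ⇝* [] ∣ []
      _∷_ : ∀ {n} {e e′ X Δ Δ′} {es : Vec Term n} {Xs} →
            e ⇝ e′ ∣ Δ → es ⇝* Xs ∣ Δ′ →
            (e ∷ es) ⇝* (X ∷ Xs) ∣ ((X , e′) ∷ Δ ++ Δ′)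

  data FlatEqns : List Eqn → List Eqn → List (Var × Term) → Set where
    []  : FlatEqns [] [] []
    _∷_ : ∀ {s s′ t t′ Δ Δ′ Δ″ Γ Γ′} →
          (s ⇝ s′ ∣ Δ) × (t ⇝ t′ ∣ Δ′) → FlatEqns Γ Γ′ Δ″ →
          FlatEqns ((s ≐ t) ∷ Γ) ((s′ ≐ t′) ∷ Γ′) (Δ ++ Δ′ ++ Δ″)

  record Flattening (P : Problem) (Γ₀ : List Eqn) : Set where
    field
      {body}     : List Eqn
      {added}    : List (Var × Term)
      flattens   : FlatEqns (Problem.Γ P) body added
      pairwise≢  : ListUnique.Unique (List.map proj₁ added)
      freshNames : ∀ {X} → X ∈ List.map proj₁ added → ¬ (X ∈VarProblem P)
      result     : Γ₀ ≡ body ++ List.map (λ (X , t) → var X ≐ t) added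

  -- `a #self` is the constraint a # a.
  data Freshness : Set where
    _#ⱽ_  : Atom → Var → Freshness
    _#self : Atom → Freshness

  infix 6 _#ⱽ_

  mutual
    simplify : Atom → Term → List Freshness
    simplify a (atom b)           = if does (a ≟ᴬ b) then [ a #self ] else []
    simplify a (lam b e)          = if does (a ≟ᴬ b) then [] else simplify a e
    simplify a (fun f es)         = simplify* a es
    simplify a (letrec bs _ es e) =
      if does (VecDec._∈?_ _≟ᴬ_ a bs) then [] else simplify* a es ++ simplify a e
    simplify a (susp π X)         = [ (π ⁻¹ $ a) #ⱽ X ]

    simplify* : ∀ {n} → Atom → Vec Term n → List Freshness
    simplify* a []       = []
    simplify* a (e ∷ es) = simplify a e ++ simplify* a es

  record State : Set where
    constructor ⟨_,_,_⟩ₛ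
    field
      Γ : List Eqn
      ∇ : List Freshness
      θ : Subst

  replaceEqns : Var → Term → List Eqn → List Eqn
  replaceEqns X t = List.map λ (l ≐ r) → l ⟪ X ↦ t ⟫ ≐ r ⟪ X ↦ t ⟫

  replaceFreshness : Var → Term → List Freshness → List Freshness
  replaceFreshness X t = concatMap λ where
    (a #ⱽ Y)  → simplify a ((X ↦ t) Y)
    (a #self) → [ a #self ]

  NonSusp : Term → Set
  NonSusp e = ∀ π X → e ≢ susp π X

  -- Removing s ≐ t, in either orientation, from Γ leaves Γ₀.
  infix 4 _∋_∣_
  _∋_∣_ : List Eqn → Eqn → List Eqn → Set
  Γ ∋ s ≐ t ∣ Γ₀ = (Γ ↭ (s ≐ t) ∷ Γ₀) ⊎ (Γ ↭ (t ≐ s) ∷ Γ₀)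

  infix 4 _∈ˢʸᵐ_
  _∈ˢʸᵐ_ : Eqn → List Eqn → Set
  s ≐ t ∈ˢʸᵐ Γ = ((s ≐ t) ∈ Γ) ⊎ ((t ≐ s) ∈ Γ)

  -- Decomposition of one equation: the resulting equations and freshness
  -- constraints.
  data Decompose : Eqn → List Eqn → List Freshness → Set where
    fun    : ∀ {f ss ts} →
             Decompose (fun f ss ≐ fun f ts)
                       (List.tabulate λ i → lookup ss i ≐ lookup ts i) []
    lam    : ∀ {a s t} → Decompose (lam a s ≐ lam a t) [ s ≐ t ] []
    lam≠   : ∀ {a b s t} → a ≢ b →
             Decompose (lam a s ≐ lam b t) [ s ≐ ((a , b) ∷ []) · t ] (simplify a t)
    letrec : ∀ {n} {as bs : Vec Atom n} .{u : Unique as} .{v : Unique bs} {ss ts r r′}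
             (ρ : Permutation′ n) (π : Perm) → Matches π as bs ρ →
             Decompose (letrec as u ss r ≐ letrec bs v ts r′)
                       ((r ≐ π · r′) ∷
                        List.tabulate λ i → lookup ss i ≐ π · lookup ts (ρ ⟨$⟩ʳ i))
                       (concatMap (λ a → simplify a (letrec bs v ts r′)) (toList as))

  -- An equation to which no decomposition rule applies (two atoms, or a
  -- clash) is left as it is, to be deleted or to cause failure later.
  data Decompose? : Eqn → List Eqn → List Freshness → Set where
    decomposed  : ∀ {q Δ N} → Decompose q Δ N → Decompose? q Δ N
    irreducible : ∀ {q} → ¬ (∃₂ λ Δ N → Decompose q Δ N) → Decompose? q [ q ] []

  -- `Γ ⊢ X ⊳ Y`: Y occurs in a non-suspension s with π·X ≐ s in Γ.
  _⊢_⊳_ : List Eqn → Var → Var → Set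
  Γ ⊢ X ⊳ Y = ∃₂ λ π s → (susp π X ≐ s ∈ˢʸᵐ Γ) × NonSusp s × (Y ∈Var s)

  Cycle : List Eqn → Set
  Cycle Γ = ∃ λ X → TransClosure (Γ ⊢_⊳_) X X

  data Top : Set where
    atom   : Atom → Top
    lam    : Top
    fun    : Fun → Top
    letrec : ℕ → Top

  top : Term → Maybe Top
  top (atom a)               = just (atom a)
  top (lam _ _)              = just lam
  top (fun f _)              = just (fun f)
  top (letrec {n = n} _ _ _ _) = just (letrec n)
  top (susp _ _)             = nothing

  data Fails : State → Set where
    clash  : ∀ {Γ ∇ θ s t k l} → (s ≐ t) ∈ Γ →
             top s ≡ just k → top t ≡ just l → k ≢ l → Fails ⟨ Γ , ∇ , θ ⟩ₛ
    cycle  : ∀ {Γ ∇ θ} → Cycle Γ → Fails ⟨ Γ , ∇ , θ ⟩ₛ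
    failF  : ∀ {Γ ∇ θ a} → (a #self) ∈ ∇ → Fails ⟨ Γ , ∇ , θ ⟩ₛ
    failFS : ∀ {Γ ∇ θ a X} → (a #ⱽ X) ∈ ∇ → a ∈FA (var X [ θ ]ˢ) →
             Fails ⟨ Γ , ∇ , θ ⟩ₛ

  infix 3 _⟶¹_ _⟶²_ _⟶_

  data _⟶¹_ : State → State → Set where
    delete : ∀ {Γ Γ₀ ∇ θ e e′} → Γ ∋ e ≐ e′ ∣ Γ₀ → e ≋ e′ →
             ⟨ Γ , ∇ , θ ⟩ₛ ⟶¹ ⟨ Γ₀ , ∇ , θ ⟩ₛ
    replace : ∀ {Γ Γ₀ ∇ θ π₁ π₂ X Y} → Γ ∋ susp π₁ X ≐ susp π₂ Y ∣ Γ₀ → X ≢ Y →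
              let t = susp (π₁ ⁻¹ ⊙ π₂) Y in
              ⟨ Γ , ∇ , θ ⟩ₛ ⟶¹
              ⟨ replaceEqns X t Γ₀ , replaceFreshness X t ∇ , θ ++ [ X , t ] ⟩ₛ
    decompose : ∀ {Γ Γ₀ ∇ θ s t Δ N} → Γ ∋ s ≐ t ∣ Γ₀ → Decompose (s ≐ t) Δ N →
                ⟨ Γ , ∇ , θ ⟩ₛ ⟶¹ ⟨ Δ ++ Γ₀ , N ++ ∇ , θ ⟩ₛ
    elimFP : ∀ {Γ Γ₀ ∇ θ π π′ X} (ps : List (Perm × Perm)) →
             Γ ↭ (susp π X ≐ susp π′ X) ∷ Γ₀ →
             All (λ (πᵢ , πᵢ′) → (susp πᵢ X ≐ susp πᵢ′ X) ∈ Γ₀) ps →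
             ⟨ List.map (λ (πᵢ , πᵢ′) → πᵢ ⁻¹ ⊙ πᵢ′) ps ⟩ (π ⁻¹ ⊙ π′) →
             ⟨ Γ , ∇ , θ ⟩ₛ ⟶¹ ⟨ Γ₀ , ∇ , θ ⟩ₛ

  data _⟶²_ : State → State → Set where
    mms : ∀ {Γ Γ₁ Γ₀ ∇ θ π₁ π₂ X e₁ e₂ Δ N} →
          Γ ∋ susp π₁ X ≐ e₁ ∣ Γ₁ → Γ₁ ∋ susp π₂ X ≐ e₂ ∣ Γ₀ →
          NonSusp e₁ → NonSusp e₂ →
          Decompose? (π₁ ⁻¹ · e₁ ≐ π₂ ⁻¹ · e₂) Δ N →
          ⟨ Γ , ∇ , θ ⟩ₛ ⟶² ⟨ (susp π₁ X ≐ e₁) ∷ Δ ++ Γ₀ , N ++ ∇ , θ ⟩ₛ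
    fps : ∀ {Γ Γ₀ ∇ θ π X e} (ps : List (Perm × Perm)) →
          Γ ∋ susp π X ≐ e ∣
            (List.map (λ (πᵢ , πᵢ′) → susp πᵢ X ≐ susp πᵢ′ X) ps ++ Γ₀) →
          ¬ (X ∈VarEqns Γ₀) → ¬ (X ∈Var e) → NonSusp e → ¬ Cycle Γ →
          ⟨ Γ , ∇ , θ ⟩ₛ ⟶²
          ⟨ List.map (λ (πᵢ , πᵢ′) → (πᵢ ⊙ π ⁻¹) · e ≐ (πᵢ′ ⊙ π ⁻¹) · e) ps ++ Γ₀
          , ∇ , θ ++ [ X , π ⁻¹ · e ] ⟩ₛ

  -- The equations of a state form a set, here a list up to order; `merge`
  -- identifies repetitions.
  data _⟶_ : State → State → Set where
    high  : ∀ {S S′} → S ⟶¹ S′ → S ⟶ S′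
    low   : ∀ {S S′} → ¬ (∃ λ S″ → S ⟶¹ S″) → S ⟶² S′ → S ⟶ S′
    merge : ∀ {Γ Γ₁ Γ₀ ∇ θ s s′ t t′} → Γ ↭ (s ≐ t) ∷ Γ₁ → Γ₁ ∋ s′ ≐ t′ ∣ Γ₀ →
            s ≋ s′ → t ≋ t′ → ⟨ Γ , ∇ , θ ⟩ₛ ⟶ ⟨ Γ₁ , ∇ , θ ⟩ₛ

  record Outputs (S : State) (U : Triple) : Set where
    open State S
    open Triple U
    field
      Γ-fixpoints : Γ ≡ List.map fixEqn FIX
      ∇-variables : ∇ ≡ List.map (uncurry _#ⱽ_) ∇′
      θ-output    : θ ≡ σ
      no-failure  : ¬ Fails S
      no-high     : ¬ (∃ λ S′ → S ⟶¹ S′)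
      no-low      : ¬ (∃ λ S′ → S ⟶² S′)

  -- `P ⇓ U`: some run of the algorithm on P outputs U.
  infix 4 _⇓_
  _⇓_ : Problem → Triple → Set
  P ⇓ U = ∃₂ λ Γ₀ S →
    Flattening P Γ₀ ×
    Star _⟶_ ⟨ Γ₀ , List.map (uncurry _#ⱽ_) (Problem.∇ P) , [] ⟩ₛ S ×
    Outputs S U

module Submission where

-- Both directions compare all the states of a run with one and the same ground
-- substitution τ, the bindings X ↦ t computed so far being read as equations
-- X ≐ t.  Every rule reflects satisfaction by τ.  For soundness take τ = σρ:
-- it satisfies the bindings because they are triangular, and the constraints
-- left over by assumption.  For completeness extend μ to the variables
-- introduced by flattening.  As long as a state satisfied by τ is not final,
-- some rule leads to another one: the letrec rule is guided by the permutation
-- found in the derivation of α-equivalence, and (FPS) or (MMS) is applied to a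
-- variable X for which τ X is deepest, so that X occurs in no other right-hand
-- side.  Every step either makes a variable disappear or decreases the weight
-- of the equations.  Irredundancy of fixpoint equations is decided by listing
-- the elements of the permutation group generated by the others.

open import Defs
open import Data.Empty using (⊥)
open import Data.Fin using (Fin; zero; suc)
import Data.Fin.Permutation as FinP
open import Data.Fin.Permutation using (Permutation′; _⟨$⟩ʳ_; _⟨$⟩ˡ_; _∘ₚ_)
import Data.Fin.Properties as Fin
open import Data.List as List using (List; []; _∷_; _++_; [_]; concatMap; filter; length)
import Data.List.Membership.DecPropositional as DecMembership
open import Data.List.Membership.Propositional using (_∈_; _∉_; find; lose)
import Data.List.Membership.Propositional.Properties as ∈
import Data.List.Properties as List
open import Data.List.Relation.Binary.Permutation.Propositional using (_↭_; ↭-sym; ↭-trans; ↭-refl)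
import Data.List.Relation.Binary.Permutation.Propositional.Properties as ↭
open import Data.List.Relation.Binary.Permutation.Propositional.Properties using (All-resp-↭; drop-∷; ∈-resp-↭)
open import Data.List.Relation.Unary.All as All using (All; []; _∷_)
import Data.List.Relation.Unary.All.Properties as All
open import Data.List.Relation.Unary.AllPairs using ([]; _∷_)
open import Data.List.Relation.Unary.Any as Any using (Any; here; there)
import Data.List.Relation.Unary.Any.Properties as Any
import Data.List.Relation.Unary.Unique.Propositional as ListUnique
open import Data.Maybe using (Maybe; just; nothing)
open import Data.Nat as ℕ using (ℕ; _+_; _⊔_; _⊓_; _≤_; _<_; z≤n; s≤s; s≤s⁻¹)
open import Data.Nat.Induction using (<-wellFounded)
open import Data.Nat.ListAction using (sum)
open import Data.Nat.ListAction.Properties using (sum-++; sum-↭)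
import Data.Nat.Properties as ℕ
open import Data.Product as Product using (∃; ∃₂; _×_; _,_; proj₁; proj₂; uncurry)
open import Data.Sum using (_⊎_; inj₁; inj₂)
open import Data.Vec as Vec using (Vec; []; _∷_; lookup; toList)
import Data.Vec.Membership.DecPropositional as VecDec
import Data.Vec.Membership.Propositional as VecMem
import Data.Vec.Membership.Propositional.Properties as VecMem
import Data.Vec.Properties as Vec
import Data.Vec.Relation.Unary.Any as VecAny
import Data.Vec.Relation.Unary.Any.Properties as VecAny
open import Data.Vec.Relation.Unary.Unique.Propositional using (Unique)
open import Data.Vec.Relation.Unary.Unique.Propositional.Properties using (map⁺; lookup-injective)
open import Function using (_∘_; id)
open import Induction.WellFounded using (Acc; acc)
open import Relation.Binary.Construct.Closure.ReflexiveTransitive using (Star; ε; _◅_)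
open import Relation.Binary.Construct.Closure.Transitive using (TransClosure; _∷_) renaming ([_] to [_]⁺)
open import Relation.Binary.PropositionalEquality hiding ([_]; resp)
open import Relation.Nullary using (¬_; Dec; yes; no; contradiction)
open import Relation.Nullary.Decidable using (recompute; ¬?)

-- The obstacle in the theory of α-equivalence is letrec: the renaming in its rule may move only the
-- binders of the two letrecs compared, so the composite of two such renamings need not be one.
-- `agree` removes it: up to `∼` only the action of a permutation on free atoms counts, so any
-- admissible renaming can stand in for the composite.
--
-- A single weight would not decrease: (FPS) copies e into every fixpoint equation for X, which may
-- make the equations heavier, and only the disappearance of X pays for this.
--
-- The low-priority rules require a proof that no high-priority rule applies. Without excluded
-- middle every applicability question must therefore be decided, and for (ElimFP) this is
-- membership in a finitely generated permutation group.
--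
-- That an output has any solution at all is due to (FailFS): instantiating all variables by one
-- closed expression solves every fixpoint equation and adds no free atoms to Xσ.

module _ (L : Language) where
  open LRLX L

  private variable
    V W : Set

  -- Permutations and substitutions

  swapˡ : ∀ a b → swap a b a ≡ b
  swapˡ a b with a ≟ᴬ a
  ... | yes _  = refl
  ... | no a≢a = contradiction refl a≢a

  swapʳ : ∀ a b → swap a b b ≡ a
  swapʳ a b with b ≟ᴬ a
  ... | yes refl = refl
  ... | no _ with b ≟ᴬ b
  ...   | yes _   = refl
  ...   | no  b≢b = contradiction refl b≢b

  swap-minimal : ∀ {a b c} → c ≢ a → c ≢ b → swap a b c ≡ c
  swap-minimal {a} {b} {c} c≢a c≢b with c ≟ᴬ a
  ... | yes c≡a = contradiction c≡a c≢a
  ... | no _ with c ≟ᴬ b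
  ...   | yes c≡b = contradiction c≡b c≢b
  ...   | no  _   = refl

  swap-same : ∀ a c → swap a a c ≡ c
  swap-same a c with c ≟ᴬ a
  ... | yes refl = refl
  ... | no c≢a with c ≟ᴬ a
  ...   | yes c≡a = contradiction c≡a c≢a
  ...   | no _    = refl

  ⊙-$ : ∀ π π′ c → (π ⊙ π′) $ c ≡ π $ π′ $ c
  ⊙-$ []            π′ c = refl
  ⊙-$ ((a , b) ∷ π) π′ c = cong (swap a b) (⊙-$ π π′ c)

  ⁻¹-$ : ∀ π c → π ⁻¹ $ π $ c ≡ c
  ⁻¹-$ []            c = refl
  ⁻¹-$ ((a , b) ∷ π) c = begin
    ((a , b) ∷ π) ⁻¹ $ swap a b (π $ c)         ≡⟨ cong (_$ swap a b (π $ c)) (List.unfold-reverse (a , b) π) ⟩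
    (π ⁻¹ ⊙ [ a , b ]) $ swap a b (π $ c)       ≡⟨ ⊙-$ (π ⁻¹) [ a , b ] _ ⟩
    π ⁻¹ $ swap a b (swap a b (π $ c))          ≡⟨ cong (π ⁻¹ $_) (swap-involutive a b (π $ c)) ⟩
    π ⁻¹ $ π $ c                                ≡⟨ ⁻¹-$ π c ⟩
    c                                           ∎
    where open ≡-Reasoning

  $-⁻¹ : ∀ π c → π $ π ⁻¹ $ c ≡ c
  $-⁻¹ π c = subst (λ π′ → π′ $ π ⁻¹ $ c ≡ c) (List.reverse-involutive π) (⁻¹-$ (π ⁻¹) c)

  ≈ₚ-⊙ : ∀ {π₁ π₁′ π₂ π₂′} → π₁ ≈ₚ π₁′ → π₂ ≈ₚ π₂′ → π₁ ⊙ π₂ ≈ₚ π₁′ ⊙ π₂′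
  ≈ₚ-⊙ {π₁} {π₁′} {π₂} {π₂′} e₁ e₂ c =
    trans (⊙-$ π₁ π₂ c) (trans (e₁ (π₂ $ c)) (trans (cong (π₁′ $_) (e₂ c)) (sym (⊙-$ π₁′ π₂′ c))))

  ⁻¹-⊙ : ∀ π → π ⁻¹ ⊙ π ≈ₚ []
  ⁻¹-⊙ π c = trans (⊙-$ (π ⁻¹) π c) (⁻¹-$ π c)

  ⊙-⁻¹ : ∀ π → π ⊙ π ⁻¹ ≈ₚ []
  ⊙-⁻¹ π c = trans (⊙-$ π (π ⁻¹) c) ($-⁻¹ π c)

  $-swap : ∀ π a b c → π $ swap a b c ≡ swap (π $ a) (π $ b) (π $ c)
  $-swap π a b c with c ≟ᴬ a
  ... | yes refl = sym (swapˡ (π $ a) (π $ b))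
  ... | no c≢a with c ≟ᴬ b
  ...   | yes refl = sym (swapʳ (π $ a) (π $ b))
  ...   | no c≢b   = sym (swap-minimal (c≢a ∘ $-injective π) (c≢b ∘ $-injective π))

  $-shift : ∀ π {a b} → π $ a ≡ b → a ≡ π ⁻¹ $ b
  $-shift π {a} refl = sym (⁻¹-$ π a)

  -- Arguments sit in vectors, so recursion on expressions is mutual with recursion on vectors.
  -- Doing this once leaves induction hypotheses that are pointwise in the index, the form in which
  -- `_∼_`, `_∈FA_` and `_∈Var_` speak of vectors.
  elim : (P : Expr V → Set) →
         (∀ a → P (atom a)) →
         (∀ a e → P e → P (lam a e)) →
         (∀ f es → (∀ i → P (lookup es i)) → P (fun f es)) →
         (∀ {n} as .(u : Unique as) (es : Vec _ n) e →
            (∀ i → P (lookup es i)) → P e → P (letrec as u es e)) →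
         (∀ π X → P (susp π X)) →
         ∀ e → P e
  elim {V} P patom plam pfun pletrec psusp = go
    where
    mutual
      go : ∀ e → P e
      go (atom a)           = patom a
      go (lam a e)          = plam a e (go e)
      go (fun f es)         = pfun f es (go* es)
      go (letrec as u es e) = pletrec as u es e (go* es) (go e)
      go (susp π X)         = psusp π X

      go* : ∀ {n} (es : Vec (Expr V) n) i → P (lookup es i)
      go* (e ∷ es) zero    = go e
      go* (e ∷ es) (suc i) = go* es i

  lookup-·* : ∀ π {n} (es : Vec (Expr V) n) i → lookup (π ·* es) i ≡ π · lookup es i
  lookup-·* π (e ∷ es) zero    = refl
  lookup-·* π (e ∷ es) (suc i) = lookup-·* π es i

  lookup-⟪⟫* : ∀ (τ : V → Expr W) {n} (es : Vec (Expr V) n) i →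
               lookup (es ⟪ τ ⟫*) i ≡ lookup es i ⟪ τ ⟫
  lookup-⟪⟫* τ (e ∷ es) zero    = refl
  lookup-⟪⟫* τ (e ∷ es) (suc i) = lookup-⟪⟫* τ es i

  lookup-ext : ∀ {A : Set} {n} {xs ys : Vec A n} → (∀ i → lookup xs i ≡ lookup ys i) → xs ≡ ys
  lookup-ext {xs = []}     {[]}     h = refl
  lookup-ext {xs = x ∷ xs} {y ∷ ys} h = cong₂ _∷_ (h zero) (lookup-ext (h ∘ suc))

  letrec-cong : ∀ {n} {as as′ : Vec Atom n} .{u : Unique as} .{u′ : Unique as′}
                {es es′ : Vec (Expr V) n} {e e′} → as ≡ as′ → es ≡ es′ → e ≡ e′ →
                letrec as u es e ≡ letrec as′ u′ es′ e′
  letrec-cong refl refl refl = refl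

  ⊙-· : ∀ π π′ (e : Expr V) → (π ⊙ π′) · e ≡ π · π′ · e
  ⊙-· {V} π π′ = elim _
    (λ a → cong atom (⊙-$ π π′ a))
    (λ a e ih → cong₂ lam (⊙-$ π π′ a) ih)
    (λ f es ih → cong (fun f) (each es ih))
    (λ as u es e ihs ih → letrec-cong
      (trans (Vec.map-cong (⊙-$ π π′) as) (Vec.map-∘ (π $_) (π′ $_) as)) (each es ihs) ih)
    (λ π″ X → cong (λ ϖ → susp ϖ X) (List.++-assoc π π′ π″))
    where
    each : ∀ {n} (es : Vec (Expr V) n) → (∀ i → (π ⊙ π′) · lookup es i ≡ π · π′ · lookup es i) →
           (π ⊙ π′) ·* es ≡ π ·* π′ ·* es
    each es ih = lookup-ext λ i → begin
      lookup ((π ⊙ π′) ·* es) i   ≡⟨ lookup-·* (π ⊙ π′) es i ⟩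
      (π ⊙ π′) · lookup es i      ≡⟨ ih i ⟩
      π · π′ · lookup es i        ≡⟨ cong (π ·_) (lookup-·* π′ es i) ⟨
      π · lookup (π′ ·* es) i     ≡⟨ lookup-·* π (π′ ·* es) i ⟨
      lookup (π ·* π′ ·* es) i    ∎
      where open ≡-Reasoning

  []-· : (e : Expr V) → [] · e ≡ e
  []-· = elim _ (λ _ → refl) (λ a e → cong (lam a))
    (λ f es ih → cong (fun f) (lookup-ext λ i → trans (lookup-·* [] es i) (ih i)))
    (λ as u es e ihs ih → letrec-cong (Vec.map-id as)
      (lookup-ext λ i → trans (lookup-·* [] es i) (ihs i)) ih)
    (λ _ _ → refl)

  -- Ground expressions contain no permutations, so the action only depends
  -- on the permutation as a function.
  ·-cong : ∀ {π π′} → π ≈ₚ π′ → (e : Ground) → π · e ≡ π′ · e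
  ·-cong {π} {π′} eq = elim _ (λ a → cong atom (eq a)) (λ a e → cong₂ lam (eq a))
    (λ f es ih → cong (fun f) (each es ih))
    (λ as u es e ihs ih → letrec-cong (Vec.map-cong eq as) (each es ihs) ih)
    (λ _ ())
    where
    each : ∀ {n} (es : Vec Ground n) → (∀ i → π · lookup es i ≡ π′ · lookup es i) →
           π ·* es ≡ π′ ·* es
    each es ih = lookup-ext λ i →
      trans (lookup-·* π es i) (trans (ih i) (sym (lookup-·* π′ es i)))

  ⁻¹-· : ∀ π (e : Ground) → π ⁻¹ · π · e ≡ e
  ⁻¹-· π e = trans (sym (⊙-· (π ⁻¹) π e)) (trans (·-cong (⁻¹-⊙ π) e) ([]-· e))

  ·-⁻¹ : ∀ π (e : Ground) → π · π ⁻¹ · e ≡ e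
  ·-⁻¹ π e = trans (sym (⊙-· π (π ⁻¹) e)) (trans (·-cong (⊙-⁻¹ π) e) ([]-· e))

  ·-⟪⟫ : ∀ π (τ : V → Expr W) (e : Expr V) → (π · e) ⟪ τ ⟫ ≡ π · e ⟪ τ ⟫
  ·-⟪⟫ {V} π τ = elim _ (λ _ → refl) (λ a e → cong (lam (π $ a)))
    (λ f es ih → cong (fun f) (each es ih))
    (λ as u es e ihs ih → letrec-cong refl (each es ihs) ih)
    (λ π′ X → ⊙-· π π′ (τ X))
    where
    each : ∀ {n} (es : Vec (Expr V) n) → (∀ i → (π · lookup es i) ⟪ τ ⟫ ≡ π · lookup es i ⟪ τ ⟫) →
           (π ·* es) ⟪ τ ⟫* ≡ π ·* (es ⟪ τ ⟫*)
    each es ih = lookup-ext λ i → begin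
      lookup ((π ·* es) ⟪ τ ⟫*) i   ≡⟨ lookup-⟪⟫* τ (π ·* es) i ⟩
      lookup (π ·* es) i ⟪ τ ⟫      ≡⟨ cong (_⟪ τ ⟫) (lookup-·* π es i) ⟩
      (π · lookup es i) ⟪ τ ⟫       ≡⟨ ih i ⟩
      π · lookup es i ⟪ τ ⟫         ≡⟨ cong (π ·_) (lookup-⟪⟫* τ es i) ⟨
      π · lookup (es ⟪ τ ⟫*) i      ≡⟨ lookup-·* π (es ⟪ τ ⟫*) i ⟨
      lookup (π ·* (es ⟪ τ ⟫*)) i   ∎
      where open ≡-Reasoning

  ⟪⟫-⟪⟫ : ∀ {U : Set} (τ : V → Expr W) (τ′ : W → Expr U) (e : Expr V) →
          e ⟪ τ ⟫ ⟪ τ′ ⟫ ≡ e ⟪ (λ X → τ X ⟪ τ′ ⟫) ⟫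
  ⟪⟫-⟪⟫ {V} τ τ′ = elim _ (λ _ → refl) (λ a e → cong (lam a))
    (λ f es ih → cong (fun f) (each es ih))
    (λ as u es e ihs ih → letrec-cong refl (each es ihs) ih)
    (λ π X → ·-⟪⟫ π τ′ (τ X))
    where
    τ″ = λ X → τ X ⟪ τ′ ⟫
    each : ∀ {n} (es : Vec (Expr V) n) →
           (∀ i → lookup es i ⟪ τ ⟫ ⟪ τ′ ⟫ ≡ lookup es i ⟪ τ″ ⟫) →
           es ⟪ τ ⟫* ⟪ τ′ ⟫* ≡ es ⟪ τ″ ⟫*
    each es ih = lookup-ext λ i → begin
      lookup (es ⟪ τ ⟫* ⟪ τ′ ⟫*) i   ≡⟨ lookup-⟪⟫* τ′ (es ⟪ τ ⟫*) i ⟩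
      lookup (es ⟪ τ ⟫*) i ⟪ τ′ ⟫    ≡⟨ cong (_⟪ τ′ ⟫) (lookup-⟪⟫* τ es i) ⟩
      lookup es i ⟪ τ ⟫ ⟪ τ′ ⟫       ≡⟨ ih i ⟩
      lookup es i ⟪ τ″ ⟫             ≡⟨ lookup-⟪⟫* τ″ es i ⟨
      lookup (es ⟪ τ″ ⟫*) i          ∎
      where open ≡-Reasoning

  ⟪⟫-cong : ∀ {τ τ′ : V → Expr W} (e : Expr V) → (∀ X → X ∈Var e → τ X ≡ τ′ X) →
            e ⟪ τ ⟫ ≡ e ⟪ τ′ ⟫
  ⟪⟫-cong {V} {W} {τ} {τ′} = elim _ (λ _ _ → refl)
    (λ a e ih h → cong (lam a) (ih λ X x → h X (lam x)))
    (λ f es ih h → cong (fun f) (each es ih λ i X x → h X (fun i x)))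
    (λ as u es e ihs ih h →
      letrec-cong refl (each es ihs λ i X x → h X (rhs i x)) (ih λ X x → h X (inExpr x)))
    (λ π X h → cong (π ·_) (h X susp))
    where
    each : ∀ {n} (es : Vec (Expr V) n) →
           (∀ i → (∀ X → X ∈Var lookup es i → τ X ≡ τ′ X) → lookup es i ⟪ τ ⟫ ≡ lookup es i ⟪ τ′ ⟫) →
           (∀ i X → X ∈Var lookup es i → τ X ≡ τ′ X) → es ⟪ τ ⟫* ≡ es ⟪ τ′ ⟫*
    each es ih h = lookup-ext λ i →
      trans (lookup-⟪⟫* τ es i) (trans (ih i (h i)) (sym (lookup-⟪⟫* τ′ es i)))

  _∈ᵛ?_ = VecDec._∈?_ _≟ᴬ_

  -- Distinctness of binders is an irrelevant argument and cannot be inspected; since equality of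
  -- indices is decidable, the conclusion can be recomputed.
  binder-injective : ∀ {n} {as : Vec Atom n} .(u : Unique as) {i j} →
                     lookup as i ≡ lookup as j → i ≡ j
  binder-injective u {i} {j} eq = recompute (i Fin.≟ j) (lookup-injective u i j eq)

  ∈-index : ∀ {A : Set} {n} {x : A} {xs : Vec A n} → x VecMem.∈ xs → ∃ λ i → x ≡ lookup xs i
  ∈-index x∈xs = VecAny.index x∈xs , VecAny.lookup-index x∈xs

  ∈-map-$⁻ : ∀ π {n} {as : Vec Atom n} {a} → π $ a VecMem.∈ Vec.map (π $_) as → a VecMem.∈ as
  ∈-map-$⁻ π {as = as} a∈ with ∈-index a∈
  ... | i , eq = subst (VecMem._∈ as) (sym ($-injective π (trans eq (Vec.lookup-map i (π $_) as))))
                   (VecMem.∈-lookup i as)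

  -- Swapping the image of g 0 with f 0 does not disturb f 1, f 2, …, since
  -- f is injective and these are the images of g 1, g 2, ….
  extend-injection : ∀ {n} (f g : Fin n → Atom) →
                     (∀ {i j} → f i ≡ f j → i ≡ j) → (∀ {i j} → g i ≡ g j → i ≡ j) →
                     ∃ λ π → (∀ i → π $ g i ≡ f i) ×
                             (∀ c → (∀ i → f i ≢ c) → (∀ i → g i ≢ c) → π $ c ≡ c)
  extend-injection {ℕ.zero} f g f-inj g-inj = [] , (λ ()) , λ _ _ _ → refl
  extend-injection {ℕ.suc n} f g f-inj g-inj
    with π , maps , fixes ← extend-injection (f ∘ suc) (g ∘ suc)
           (Fin.suc-injective ∘ f-inj) (Fin.suc-injective ∘ g-inj)
    = (π $ g zero , f zero) ∷ π , maps′ , fixes′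
    where
    maps′ : ∀ i → swap (π $ g zero) (f zero) (π $ g i) ≡ f i
    maps′ zero    = swapˡ _ _
    maps′ (suc i) = trans (swap-minimal
      (λ eq → Fin.0≢1+n (sym (g-inj ($-injective π eq))))
      (λ eq → Fin.0≢1+n (sym (f-inj (trans (sym (maps i)) eq))))) (maps i)
    fixes′ : ∀ c → (∀ i → f i ≢ c) → (∀ i → g i ≢ c) → swap (π $ g zero) (f zero) (π $ c) ≡ c
    fixes′ c f≢c g≢c = trans (swap-minimal
      (λ eq → g≢c zero (sym ($-injective π eq)))
      (λ eq → f≢c zero (trans (sym eq) πc≡c))) πc≡c
      where πc≡c = fixes c (f≢c ∘ suc) (g≢c ∘ suc)

  -- Supplies a renaming where no derivation provides a suitable one, as in `agree` and `∼-trans`.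
  -- The condition on the domain is the contrapositive of what `extend-injection` guarantees: an
  -- atom in neither vector is fixed.
  matching : ∀ {n} (as bs : Vec Atom n) .(u : Unique as) .(v : Unique bs) (ρ : Permutation′ n) →
             ∃ λ π → Matches π as bs ρ
  matching as bs u v ρ
    with π , maps , fixes ← extend-injection (lookup as) (λ i → lookup bs (ρ ⟨$⟩ʳ i))
           (binder-injective u)
           (λ {i} {j} eq → trans (sym (FinP.inverseˡ ρ))
              (trans (cong (ρ ⟨$⟩ˡ_) (binder-injective v eq)) (FinP.inverseˡ ρ)))
    = π , record { dom = dom ; binds = maps }
    where
    dom : ∀ c → π $ c ≢ c → (c VecMem.∈ as) ⊎ (c VecMem.∈ bs)
    dom c πc≢c with c ∈ᵛ? as | c ∈ᵛ? bs
    ... | yes c∈as | _        = inj₁ c∈as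
    ... | no  _    | yes c∈bs = inj₂ c∈bs
    ... | no  c∉as | no  c∉bs = contradiction
      (fixes c (λ { i refl → c∉as (VecMem.∈-lookup i as) })
               (λ { i refl → c∉bs (VecMem.∈-lookup (ρ ⟨$⟩ʳ i) bs) })) πc≢c

  Matches-fixes : ∀ {n π} {as bs : Vec Atom n} {ρ} → Matches π as bs ρ →
                  ∀ {c} → c VecMem.∉ as → c VecMem.∉ bs → π $ c ≡ c
  Matches-fixes {π = π} m {c} c∉as c∉bs with (π $ c) ≟ᴬ c
  ... | yes πc≡c = πc≡c
  ... | no  πc≢c with Matches.dom m c πc≢c
  ...   | inj₁ c∈as = contradiction c∈as c∉as
  ...   | inj₂ c∈bs = contradiction c∈bs c∉bs

  -- α-equivalence

  FA-· : ∀ π {e : Ground} {a} → a ∈FA e → π $ a ∈FA π · e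
  FA-· π atom          = atom
  FA-· π (lam a≢b a∈e) = lam (a≢b ∘ $-injective π) (FA-· π a∈e)
  FA-· π (fun {es = es} i a∈e) = fun i (subst (_ ∈FA_) (sym (lookup-·* π es i)) (FA-· π a∈e))
  FA-· π (rhs {es = es} a∉as i a∈e) =
    rhs (a∉as ∘ ∈-map-$⁻ π) i (subst (_ ∈FA_) (sym (lookup-·* π es i)) (FA-· π a∈e))
  FA-· π (inExpr a∉as a∈e) = inExpr (a∉as ∘ ∈-map-$⁻ π) (FA-· π a∈e)

  FA-·⁻ : ∀ π {e : Ground} {a} → a ∈FA π · e → π ⁻¹ $ a ∈FA e
  FA-·⁻ π {e} a∈πe = subst (_ ∈FA_) (⁻¹-· π e) (FA-· (π ⁻¹) a∈πe)

  FA-·-cancel : ∀ π {e : Ground} {a} → π $ a ∈FA π · e → a ∈FA e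
  FA-·-cancel π {e} {a} p = subst (_∈FA e) (⁻¹-$ π a) (FA-·⁻ π p)

  FA-·-preimage : ∀ π {e : Ground} {a} → a ∈FA π · e → ∃ λ b → a ≡ π $ b × b ∈FA e
  FA-·-preimage π {a = a} p = π ⁻¹ $ a , sym ($-⁻¹ π a) , FA-·⁻ π p

  #-binder : ∀ {V : Set} {n} {as : Vec Atom n} .{u : Unique as} {es : Vec (Expr V) n} {e} i →
             lookup as i # letrec as u es e
  #-binder {as = as} i (rhs a∉as _ _)  = a∉as (VecMem.∈-lookup i as)
  #-binder {as = as} i (inExpr a∉as _) = a∉as (VecMem.∈-lookup i as)

  [aa]-· : ∀ a (e : Ground) → [ a , a ] · e ≡ e
  [aa]-· a e = trans (·-cong (swap-same a) e) ([]-· e)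

  -- A common form of `lam` and `lam≠`: if the binders coincide, the swapping acts as the identity
  -- and the freshness condition is automatic. Together with `lam-elim` it spares later arguments
  -- the comparison of binders.
  lam-intro : ∀ {a b e e′} → a # lam b e′ → e ∼ [ a , b ] · e′ → lam a e ∼ lam b e′
  lam-intro {a} {b} {e} {e′} a# e∼ with a ≟ᴬ b
  ... | yes refl = lam (subst (e ∼_) ([aa]-· a e′) e∼)
  ... | no  a≢b  = lam≠ (a# ∘ lam a≢b) e∼

  lam-elim : ∀ {a b e e′} → lam a e ∼ lam b e′ → a # lam b e′ × e ∼ [ a , b ] · e′
  lam-elim {a} {e = e} {e′} (lam e∼e′) =
    (λ { (lam a≢a _) → a≢a refl }) , subst (e ∼_) (sym ([aa]-· a e′)) e∼e′
  lam-elim (lam≠ a# e∼) = (λ { (lam _ a∈e′) → a# a∈e′ }) , e∼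

  -- Under a binder π and π′ may diverge. The renaming demanded by the rule, composed with π′,
  -- agrees with π on the free atoms of the body, binders included. Hence both permutations vary in
  -- the induction.
  agree : ∀ (e : Ground) {π π′} → (∀ c → c ∈FA e → π $ c ≡ π′ $ c) → π · e ∼ π′ · e
  agree = elim _
    (λ a {π} h → subst (λ b → atom (π $ a) ∼ atom b) (h a atom) atom)
    agree-lam
    (λ f es ih {π} {π′} h → fun λ i →
      subst₂ _∼_ (sym (lookup-·* π es i)) (sym (lookup-·* π′ es i)) (ih i λ c → h c ∘ fun i))
    agree-letrec
    (λ _ ())
    where
    Agree : Ground → Set
    Agree e = ∀ {π π′} → (∀ c → c ∈FA e → π $ c ≡ π′ $ c) → π · e ∼ π′ · e

    agree-lam : ∀ a e → Agree e → Agree (lam a e)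
    agree-lam a e ih {π} {π′} h = lam-intro fresh
      (subst (π · e ∼_) (⊙-· [ π $ a , π′ $ a ] π′ e) (ih same))
      where
      fresh : π $ a # lam (π′ $ a) (π′ · e)
      -- A free occurrence of `π $ a` comes from some d free in e with `π′ $ d` equal to it. If d
      -- differs from a, then π and π′ agree at d, and injectivity of π yields `d ≡ a` after all.
      fresh (lam πa≢π′a πa∈π′e) with d , eq , d∈e ← FA-·-preimage π′ πa∈π′e with d ≟ᴬ a
      ... | yes refl = πa≢π′a eq
      ... | no  d≢a  = d≢a ($-injective π (trans (h d (lam d≢a d∈e)) (sym eq)))
      same : ∀ c → c ∈FA e → π $ c ≡ swap (π $ a) (π′ $ a) (π′ $ c)
      same c c∈e with c ≟ᴬ a
      ... | yes refl = sym (swapʳ (π $ a) (π′ $ a))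
      ... | no  c≢a  = trans πc≡π′c (sym (swap-minimal
              (λ eq → c≢a ($-injective π (trans πc≡π′c eq))) (c≢a ∘ $-injective π′)))
        where πc≡π′c = h c (lam c≢a c∈e)

    agree-letrec : ∀ {n} as .(u : Unique as) (es : Vec _ n) e →
                   (∀ i → Agree (lookup es i)) → Agree e → Agree (letrec as u es e)
    agree-letrec as u es e ihs ih {π} {π′} h
      with τ , m ← matching (Vec.map (π $_) as) (Vec.map (π′ $_) as)
                     (map⁺ ($-injective π) u) (map⁺ ($-injective π′) u) FinP.id
      = letrec FinP.id τ m fresh
          (λ i → subst₂ _∼_ (sym (lookup-·* π es i))
                   (trans (⊙-· τ π′ (lookup es i)) (cong (τ ·_) (sym (lookup-·* π′ es i))))
                   (ihs i (same λ c∉as → rhs c∉as i)))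
          (subst (π · e ∼_) (⊙-· τ π′ e) (ih (same inExpr)))
      where
      fresh : ∀ i → lookup (Vec.map (π $_) as) i # π′ · letrec as u es e
      -- The preimage d is free in the letrec, so π and π′ agree on it; injectivity makes it a
      -- binder of that letrec, a contradiction.
      fresh i p with d , eq , d∈ ← FA-·-preimage π′ p =
        #-binder i (subst (_∈FA _) (sym as≡d) d∈)
        where
        as≡d : lookup as i ≡ d
        as≡d = $-injective π (trans (sym (Vec.lookup-map i (π $_) as)) (trans eq (sym (h d d∈))))
      same : ∀ {e′} → (∀ {c} → c VecMem.∉ as → c ∈FA e′ → c ∈FA letrec as u es e) →
             ∀ c → c ∈FA e′ → π $ c ≡ (τ ⊙ π′) $ c
      same bound c c∈e′ with c ∈ᵛ? as
      ... | yes c∈as with i , refl ← ∈-index c∈as = begin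
        π $ lookup as i                       ≡⟨ Vec.lookup-map i (π $_) as ⟨
        lookup (Vec.map (π $_) as) i          ≡⟨ Matches.binds m i ⟨
        τ $ lookup (Vec.map (π′ $_) as) i     ≡⟨ cong (τ $_) (Vec.lookup-map i (π′ $_) as) ⟩
        τ $ π′ $ lookup as i                  ≡⟨ ⊙-$ τ π′ _ ⟨
        (τ ⊙ π′) $ lookup as i                ∎
        where open ≡-Reasoning
      ... | no c∉as = trans πc≡π′c (sym (trans (⊙-$ τ π′ c)
              (Matches-fixes m (c∉as ∘ ∈-map-$⁻ π ∘ subst (VecMem._∈ _) (sym πc≡π′c))
                               (c∉as ∘ ∈-map-$⁻ π′))))
        where πc≡π′c = h c (bound c∉as c∈e′)

  ∼-refl : ∀ {e} → e ∼ e
  ∼-refl {e} = subst₂ _∼_ ([]-· e) ([]-· e) (agree e {[]} {[]} λ _ _ → refl)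

  ∼-reflexive : ∀ {e e′} → e ≡ e′ → e ∼ e′
  ∼-reflexive refl = ∼-refl

  -- Renamings are transported by conjugation: the swapping of a and b becomes that of their images,
  -- and the letrec renaming ϖ becomes `π ⊙ ϖ ⊙ π ⁻¹`.
  ·-∼ : ∀ π {e e′} → e ∼ e′ → π · e ∼ π · e′
  ·-∼ π atom = atom
  ·-∼ π (fun {es = es} {es′} h) = fun λ i →
    subst₂ _∼_ (sym (lookup-·* π es i)) (sym (lookup-·* π es′ i)) (·-∼ π (h i))
  ·-∼ π (lam e∼e′) = lam (·-∼ π e∼e′)
  ·-∼ π (lam≠ {a} {b} {e} {e′} a# e∼) = lam-intro
    (λ { (lam _ πa∈) → a# (FA-·-cancel π πa∈) })
    (subst (π · e ∼_) shift (·-∼ π e∼))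
    where
    shift : π · [ a , b ] · e′ ≡ [ π $ a , π $ b ] · π · e′
    shift = trans (sym (⊙-· π [ a , b ] e′))
      (trans (·-cong (λ c → trans (⊙-$ π [ a , b ] c) ($-swap π a b c)) e′)
             (⊙-· [ π $ a , π $ b ] π e′))
  ·-∼ π (letrec {as = as} {bs} {u} {v} {ss} {ts} {r} {r′} ρ ϖ m fresh ss∼ r∼) =
    letrec ρ τ
      (record { dom = dom ; binds = binds })
      (λ i p → fresh i (FA-·-cancel π (subst (_∈FA π · letrec bs v ts r′)
                 (Vec.lookup-map i (π $_) as) p)))
      (λ i → subst₂ _∼_ (sym (lookup-·* π ss i))
         (trans (shift (lookup ts (ρ ⟨$⟩ʳ i))) (cong (τ ·_) (sym (lookup-·* π ts (ρ ⟨$⟩ʳ i)))))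
         (·-∼ π (ss∼ i)))
      (subst (π · r ∼_) (shift r′) (·-∼ π r∼))
    where
    open ≡-Reasoning
    τ = π ⊙ ϖ ⊙ π ⁻¹
    τ-$ : ∀ c → τ $ c ≡ π $ ϖ $ π ⁻¹ $ c
    τ-$ c = trans (⊙-$ π (ϖ ⊙ π ⁻¹) c) (cong (π $_) (⊙-$ ϖ (π ⁻¹) c))
    shift : ∀ (e : Ground) → π · ϖ · e ≡ τ · π · e
    shift e = begin
      π · ϖ · e        ≡⟨ ⊙-· π ϖ e ⟨
      (π ⊙ ϖ) · e      ≡⟨ ·-cong (λ c → trans (⊙-$ π ϖ c) (sym (trans (⊙-$ τ π c)
                            (trans (τ-$ (π $ c)) (cong (λ d → π $ ϖ $ d) (⁻¹-$ π c)))))) e ⟩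
      (τ ⊙ π) · e      ≡⟨ ⊙-· τ π e ⟩
      τ · π · e        ∎
    pull : ∀ {n} {cs : Vec Atom n} c → π ⁻¹ $ c VecMem.∈ cs → c VecMem.∈ Vec.map (π $_) cs
    pull c p = subst (VecMem._∈ _) ($-⁻¹ π c) (VecMem.∈-map⁺ (π $_) p)
    dom : ∀ c → τ $ c ≢ c → c VecMem.∈ Vec.map (π $_) as ⊎ c VecMem.∈ Vec.map (π $_) bs
    dom c τc≢c with Matches.dom m (π ⁻¹ $ c) (λ eq →
                      τc≢c (trans (τ-$ c) (trans (cong (π $_) eq) ($-⁻¹ π c))))
    ... | inj₁ p = inj₁ (pull c p)
    ... | inj₂ p = inj₂ (pull c p)
    binds : ∀ i → τ $ lookup (Vec.map (π $_) bs) (ρ ⟨$⟩ʳ i) ≡ lookup (Vec.map (π $_) as) i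
    binds i = begin
      τ $ lookup (Vec.map (π $_) bs) (ρ ⟨$⟩ʳ i) ≡⟨ cong (τ $_) (Vec.lookup-map (ρ ⟨$⟩ʳ i) (π $_) bs) ⟩
      τ $ π $ lookup bs (ρ ⟨$⟩ʳ i)              ≡⟨ τ-$ _ ⟩
      π $ ϖ $ π ⁻¹ $ π $ lookup bs (ρ ⟨$⟩ʳ i)   ≡⟨ cong (λ d → π $ ϖ $ d) (⁻¹-$ π _) ⟩
      π $ ϖ $ lookup bs (ρ ⟨$⟩ʳ i)              ≡⟨ cong (π $_) (Matches.binds m i) ⟩
      π $ lookup as i                           ≡⟨ Vec.lookup-map i (π $_) as ⟨
      lookup (Vec.map (π $_) as) i              ∎

  -- Precedes symmetry, whose freshness conditions rest on it. For letrec, c is the image under π of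
  -- an atom d free on the right: d is not a right binder, or c would be a left one, and not a left
  -- binder by freshness. So π fixes d.
  FA-resp : ∀ {e e′ c} → e ∼ e′ → c ∈FA e → c ∈FA e′
  FA-resp atom atom = atom
  FA-resp (fun h) (fun i p) = fun i (FA-resp (h i) p)
  FA-resp (lam e∼) (lam c≢a p) = lam c≢a (FA-resp e∼ p)
  FA-resp {c = c} (lam≠ {a} {b} {e′ = e′} a# e∼) (lam c≢a p) with c ≟ᴬ b
  ... | yes refl = contradiction
    (subst (_∈FA e′) (swapʳ a c) (FA-·⁻ [ a , c ] (FA-resp e∼ p))) a#
  ... | no c≢b = lam c≢b
    (subst (_∈FA e′) (swap-minimal c≢a c≢b) (FA-·⁻ [ a , b ] (FA-resp e∼ p)))
  FA-resp {c = c} (letrec {n} {as} {bs} {u} {v} {ts = ts} {r′ = r′} ρ π m fresh ss∼ r∼) p = go p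
    where
    back : ∀ {e} → (∀ {d} → d VecMem.∉ bs → d ∈FA e → d ∈FA letrec bs v ts r′) →
           c VecMem.∉ as → c ∈FA π · e → c ∈FA letrec bs v ts r′
    back bound c∉as c∈πe with FA-·-preimage π c∈πe
    ... | d , refl , d∈e with d ∈ᵛ? bs
    ...   | yes d∈bs with j , refl ← ∈-index d∈bs =
      contradiction (subst (VecMem._∈ as) (sym (trans (cong (λ k → π $ lookup bs k)
        (sym (FinP.inverseʳ ρ))) (Matches.binds m (ρ ⟨$⟩ˡ j)))) (VecMem.∈-lookup (ρ ⟨$⟩ˡ j) as)) c∉as
    ...   | no d∉bs = subst (_∈FA _) (sym (Matches-fixes m d∉as d∉bs)) d∈
      where
      d∈ = bound d∉bs d∈e
      d∉as : d VecMem.∉ as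
      d∉as d∈as with i , refl ← ∈-index d∈as = fresh i d∈
    go : c ∈FA letrec as u _ _ → c ∈FA letrec bs v ts r′
    go (rhs c∉as i c∈)  = back (λ d∉ → rhs d∉ (ρ ⟨$⟩ʳ i)) c∉as (FA-resp (ss∼ i) c∈)
    go (inExpr c∉as c∈) = back inExpr c∉as (FA-resp r∼ c∈)

  swap-sym : ∀ a b c → swap a b c ≡ swap b a c
  swap-sym a b c with c ≟ᴬ a | c ≟ᴬ b
  ... | yes refl | yes refl = refl
  ... | yes refl | no _     = refl
  ... | no _     | yes refl = refl
  ... | no _     | no _     = refl

  -- The missing freshness conditions come from `FA-resp`: a right binder free on the left would be
  -- free on the right, where it is bound.
  ∼-sym : ∀ {e e′} → e ∼ e′ → e′ ∼ e
  ∼-sym atom       = atom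
  ∼-sym (fun h)    = fun λ i → ∼-sym (h i)
  ∼-sym (lam e∼e′) = lam (∼-sym e∼e′)
  ∼-sym (lam≠ {a} {b} {e} {e′} a# e∼) = lam-intro fresh
    (subst₂ _∼_ (⁻¹-· [ a , b ] e′) (·-cong (swap-sym a b) e) (·-∼ [ a , b ] (∼-sym e∼)))
    where
    fresh : b # lam a e
    fresh (lam b≢a b∈e) = a# (subst (_∈FA e′) (swapʳ a b) (FA-·⁻ [ a , b ] (FA-resp e∼ b∈e)))
  ∼-sym e∼@(letrec {as = as} {bs} {u} {v} {ss} {ts} {r} {r′} ρ π m fresh ss∼ r∼) =
    letrec (FinP.flip ρ) (π ⁻¹)
      (record { dom = dom ; binds = binds })
      (λ j b∈ → #-binder j (FA-resp e∼ b∈))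
      (λ j → unshift (lookup ts j) (subst (λ k → π · lookup ts k ∼ lookup ss (ρ ⟨$⟩ˡ j))
               (FinP.inverseʳ ρ) (∼-sym (ss∼ (ρ ⟨$⟩ˡ j)))))
      (unshift r′ (∼-sym r∼))
    where
    unshift : ∀ e {e′} → π · e ∼ e′ → e ∼ π ⁻¹ · e′
    unshift e h = subst (_∼ _) (⁻¹-· π e) (·-∼ (π ⁻¹) h)
    dom : ∀ c → π ⁻¹ $ c ≢ c → c VecMem.∈ bs ⊎ c VecMem.∈ as
    dom c ≢c with Matches.dom m c (λ eq → ≢c (trans (cong (π ⁻¹ $_) (sym eq)) (⁻¹-$ π c)))
    ... | inj₁ c∈as = inj₂ c∈as
    ... | inj₂ c∈bs = inj₁ c∈bs
    binds : ∀ j → π ⁻¹ $ lookup as (ρ ⟨$⟩ˡ j) ≡ lookup bs j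
    binds j = trans (sym ($-shift π (Matches.binds m (ρ ⟨$⟩ˡ j))))
                    (cong (lookup bs) (FinP.inverseʳ ρ))

  -- Induction on the leftmost expression, not on a derivation: the induction hypothesis is applied
  -- to derivations transported by `·-∼` and to those produced by `agree`, which are not
  -- subderivations.
  ∼-trans : ∀ {e₁ e₂ e₃} → e₁ ∼ e₂ → e₂ ∼ e₃ → e₁ ∼ e₃
  ∼-trans {e₁} = elim Trans
    (λ { a atom atom → atom })
    trans-lam
    (λ { f es ih (fun h) (fun h′) → fun λ i → ih i (h i) (h′ i) })
    trans-letrec
    (λ _ ())
    e₁
    where
    Trans : Ground → Set
    Trans e₁ = ∀ {e₂ e₃} → e₁ ∼ e₂ → e₂ ∼ e₃ → e₁ ∼ e₃

    trans-lam : ∀ a e → Trans e → Trans (lam a e)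
    trans-lam a e ih = go
      where
      compose : ∀ {b c e′ e″} → lam a e ∼ lam b e′ → lam b e′ ∼ lam c e″ → lam a e ∼ lam c e″
      compose {b} {c} {e′} {e″} p q with a# , e∼ ← lam-elim p | b# , e′∼ ← lam-elim q =
        lam-intro a#e₃ (ih (ih e∼ (subst ([ a , b ] · e′ ∼_) (sym (⊙-· [ a , b ] [ b , c ] e″))
                                     (·-∼ [ a , b ] e′∼)))
                           (agree e″ same))
        where
        a#e₃ : a # lam c e″
        a#e₃ = a# ∘ FA-resp (∼-sym q)
        -- False for arbitrary d: it needs that a and b are not free in `lam c e″`.
        same : ∀ d → d ∈FA e″ → swap a b (swap b c d) ≡ swap a c d
        same d d∈ = by-cases (d ≟ᴬ c)
          where
          by-cases : Dec (d ≡ c) → swap a b (swap b c d) ≡ swap a c d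
          by-cases (yes refl) =
            trans (cong (swap a b) (swapʳ b c)) (trans (swapʳ a b) (sym (swapʳ a c)))
          by-cases (no d≢c) = trans (cong (swap a b) (swap-minimal d≢b d≢c))
            (trans (swap-minimal d≢a d≢b) (sym (swap-minimal d≢a d≢c)))
            where
            d≢a : d ≢ a
            d≢a refl = a#e₃ (lam d≢c d∈)
            d≢b : d ≢ b
            d≢b refl = b# (lam d≢c d∈)
      go : Trans (lam a e)
      go p@(lam _)    q@(lam _)    = compose p q
      go p@(lam _)    q@(lam≠ _ _) = compose p q
      go p@(lam≠ _ _) q@(lam _)    = compose p q
      go p@(lam≠ _ _) q@(lam≠ _ _) = compose p q

    trans-letrec : ∀ {n} as .(u : Unique as) (es : Vec _ n) e →
                   (∀ i → Trans (lookup es i)) → Trans e → Trans (letrec as u es e)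
    trans-letrec as u ss r ihs ih p@(letrec {bs = bs} {v = v} {ts = ts} {r′ = r′} ρ π m fresh ss∼ r∼)
                                  q@(letrec {bs = cs} {v = w} {ts = us} {r′ = r″} ρ′ π′ m′ fresh′ ts∼ r′∼)
      -- The composite `π ⊙ π′` may move middle binders that are in neither outer letrec, so a
      -- renaming τ between the outer ones replaces it. On atoms free in the last components both
      -- act alike: binders follow the pairing, and freshness keeps all other free atoms away from
      -- the three vectors.
      with τ , mτ ← matching as cs u w (ρ ∘ₚ ρ′)
      = letrec (ρ ∘ₚ ρ′) τ mτ as#
          (λ i → ihs i (ihs i (ss∼ i) (shift _ (ts∼ (ρ ⟨$⟩ʳ i))))
                       (agree _ (same λ d∉ → rhs d∉ (ρ′ ⟨$⟩ʳ (ρ ⟨$⟩ʳ i)))))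
          (ih (ih r∼ (shift r″ r′∼)) (agree r″ (same inExpr)))
      where
      shift : ∀ e {e′} → e′ ∼ π′ · e → π · e′ ∼ (π ⊙ π′) · e
      shift e {e′} h = subst (π · e′ ∼_) (sym (⊙-· π π′ e)) (·-∼ π h)
      as# : ∀ i → lookup as i # letrec cs w us r″
      as# i = fresh i ∘ FA-resp (∼-sym q)
      outside : ∀ {n} {xs : Vec Atom n} {d} → (∀ i → lookup xs i # letrec cs w us r″) →
                d ∈FA letrec cs w us r″ → d VecMem.∉ xs
      outside xs# d∈ d∈xs with i , refl ← ∈-index d∈xs = xs# i d∈
      same : ∀ {e} → (∀ {d} → d VecMem.∉ cs → d ∈FA e → d ∈FA letrec cs w us r″) →
             ∀ d → d ∈FA e → (π ⊙ π′) $ d ≡ τ $ d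
      same bound d d∈e with d ∈ᵛ? cs
      ... | no d∉cs = begin
        (π ⊙ π′) $ d   ≡⟨ ⊙-$ π π′ d ⟩
        π $ π′ $ d     ≡⟨ cong (π $_) (Matches-fixes m′ d∉bs d∉cs) ⟩
        π $ d          ≡⟨ Matches-fixes m d∉as d∉bs ⟩
        d              ≡⟨ Matches-fixes mτ d∉as d∉cs ⟨
        τ $ d          ∎
        where
        open ≡-Reasoning
        d∈ = bound d∉cs d∈e
        d∉as = outside as# d∈
        d∉bs = outside fresh′ d∈
      ... | yes d∈cs with k , refl ← ∈-index d∈cs = begin
        (π ⊙ π′) $ lookup cs k               ≡⟨ ⊙-$ π π′ _ ⟩
        π $ π′ $ lookup cs k                 ≡⟨ cong (λ k → π $ π′ $ lookup cs k) k≡ ⟨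
        π $ π′ $ lookup cs (ρ′ ⟨$⟩ʳ j)       ≡⟨ cong (π $_) (Matches.binds m′ j) ⟩
        π $ lookup bs j                      ≡⟨ cong (λ j → π $ lookup bs j) (FinP.inverseʳ ρ) ⟨
        π $ lookup bs (ρ ⟨$⟩ʳ i)             ≡⟨ Matches.binds m i ⟩
        lookup as i                          ≡⟨ Matches.binds mτ i ⟨
        τ $ lookup cs (ρ′ ⟨$⟩ʳ (ρ ⟨$⟩ʳ i))   ≡⟨ cong (λ j → τ $ lookup cs (ρ′ ⟨$⟩ʳ j)) (FinP.inverseʳ ρ) ⟩
        τ $ lookup cs (ρ′ ⟨$⟩ʳ j)            ≡⟨ cong (λ k → τ $ lookup cs k) k≡ ⟩
        τ $ lookup cs k                      ∎
        where
        open ≡-Reasoning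
        j = ρ′ ⟨$⟩ˡ k
        i = ρ ⟨$⟩ˡ j
        k≡ : ρ′ ⟨$⟩ʳ j ≡ k
        k≡ = FinP.inverseʳ ρ′

  -- Satisfaction

  ∼-move : ∀ π {e e′} → π · e ∼ e′ → e ∼ π ⁻¹ · e′
  ∼-move π {e} h = subst (_∼ _) (⁻¹-· π e) (·-∼ (π ⁻¹) h)

  ∼-unmove : ∀ π {e e′} → e ∼ π ⁻¹ · e′ → π · e ∼ e′
  ∼-unmove π {e′ = e′} h = subst (_ ∼_) (·-⁻¹ π e′) (·-∼ π h)

  -- If the binders differ only in their order, the identity serves as renaming, and freshness holds
  -- because every left binder is also a right one.
  letrec-∼ : ∀ {n} {as bs : Vec Atom n} .{u : Unique as} .{v : Unique bs} {ss ts r r′}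
             (ρ : Permutation′ n) →
             (∀ i → lookup as i ≡ lookup bs (ρ ⟨$⟩ʳ i)) →
             (∀ i → lookup ss i ∼ lookup ts (ρ ⟨$⟩ʳ i)) → r ∼ r′ →
             letrec as u ss r ∼ letrec bs v ts r′
  letrec-∼ {as = as} {bs} {v = v} {ts = ts} {r} {r′} ρ as≡ ss∼ r∼ = letrec ρ []
    (record { dom = λ c c≢c → contradiction refl c≢c ; binds = λ i → sym (as≡ i) })
    (λ i p → #-binder (ρ ⟨$⟩ʳ i) (subst (_∈FA letrec bs v ts r′) (as≡ i) p))
    (λ i → subst (_ ∼_) (sym ([]-· (lookup ts (ρ ⟨$⟩ʳ i)))) (ss∼ i))
    (subst (r ∼_) (sym ([]-· r′)) r∼)

  ⟪⟫-∼ : ∀ {τ τ′ : V → Ground} → (∀ X → τ X ∼ τ′ X) → ∀ e → e ⟪ τ ⟫ ∼ e ⟪ τ′ ⟫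
  ⟪⟫-∼ {V} {τ} {τ′} h = elim _ (λ _ → atom) (λ _ _ → lam)
    (λ f es ih → fun (each es ih))
    (λ as u es e ihs ih → letrec-∼ FinP.id (λ _ → refl) (each es ihs) ih)
    (λ π X → ·-∼ π (h X))
    where
    each : ∀ {n} (es : Vec (Expr V) n) → (∀ i → lookup es i ⟪ τ ⟫ ∼ lookup es i ⟪ τ′ ⟫) →
           ∀ i → lookup (es ⟪ τ ⟫*) i ∼ lookup (es ⟪ τ′ ⟫*) i
    each es ih i = subst₂ _∼_ (sym (lookup-⟪⟫* τ es i)) (sym (lookup-⟪⟫* τ′ es i)) (ih i)

  ≋⇒∼ : ∀ (τ : V → Ground) {e e′} → e ≋ e′ → e ⟪ τ ⟫ ∼ e′ ⟪ τ ⟫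
  ≋⇒∼ τ atom = atom
  ≋⇒∼ τ (fun {es = es} {es′} h) = fun λ i →
    subst₂ _∼_ (sym (lookup-⟪⟫* τ es i)) (sym (lookup-⟪⟫* τ es′ i)) (≋⇒∼ τ (h i))
  ≋⇒∼ τ (lam e≋) = lam (≋⇒∼ τ e≋)
  ≋⇒∼ τ (letrec {ss = ss} {ts} ρ as≡ ss≋ r≋) = letrec-∼ ρ as≡
    (λ i → subst₂ _∼_ (sym (lookup-⟪⟫* τ ss i)) (sym (lookup-⟪⟫* τ ts (ρ ⟨$⟩ʳ i))) (≋⇒∼ τ (ss≋ i)))
    (≋⇒∼ τ r≋)
  ≋⇒∼ τ (susp {X = X} eq) = ∼-reflexive (·-cong eq (τ X))

  infix 4 _⊨_ _⊨ᶠ_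
  _⊨_ : GroundSubst → Eqn → Set
  τ ⊨ (s ≐ t) = s ⟪ τ ⟫ ∼ t ⟪ τ ⟫

  _⊨ᶠ_ : GroundSubst → Freshness → Set
  τ ⊨ᶠ (a #ⱽ X)  = a # τ X
  τ ⊨ᶠ (a #self) = ⊥

  -- The bindings X ↦ t of the substitution computed so far are read as
  -- equations X ≐ t, so that one and the same τ can be compared with all
  -- the states of a run.
  record Sat (τ : GroundSubst) (S : State) : Set where
    open State S
    field
      eqns  : All (τ ⊨_) Γ
      fresh : All (τ ⊨ᶠ_) ∇
      binds : All (λ (X , t) → τ X ∼ t ⟪ τ ⟫) θ

  Sat-eqns : ∀ {τ Γ Γ′ ∇ θ} → All (τ ⊨_) Γ′ → Sat τ ⟨ Γ , ∇ , θ ⟩ₛ → Sat τ ⟨ Γ′ , ∇ , θ ⟩ₛ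
  Sat-eqns h s = record { eqns = h ; fresh = Sat.fresh s ; binds = Sat.binds s }

  mutual
    simplify-sound : ∀ {τ} a e → All (τ ⊨ᶠ_) (simplify a e) → a # e ⟪ τ ⟫
    simplify-sound a (atom b) h p with a ≟ᴬ b
    simplify-sound a (atom b) (() ∷ _) p | yes _
    simplify-sound a (atom b) h atom     | no a≢b = a≢b refl
    simplify-sound a (lam b e) h (lam a≢b p) with a ≟ᴬ b
    ... | yes a≡b = a≢b a≡b
    ... | no  _   = simplify-sound a e h p
    simplify-sound a (fun f es) h (fun i p) = simplify*-sound a es h i p
    simplify-sound a (letrec bs u es e) h p with a ∈ᵛ? bs
    simplify-sound a (letrec bs u es e) h (rhs a∉bs i p)  | yes a∈bs = a∉bs a∈bs
    simplify-sound a (letrec bs u es e) h (inExpr a∉bs p) | yes a∈bs = a∉bs a∈bs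
    simplify-sound a (letrec bs u es e) h (rhs _ i p)     | no _ =
      simplify*-sound a es (All.++⁻ˡ (simplify* a es) h) i p
    simplify-sound a (letrec bs u es e) h (inExpr _ p)    | no _ =
      simplify-sound a e (All.++⁻ʳ (simplify* a es) h) p
    simplify-sound a (susp π X) (π⁻¹a# ∷ []) p = π⁻¹a# (FA-·⁻ π p)

    simplify*-sound : ∀ {τ n} a (es : Vec Term n) → All (τ ⊨ᶠ_) (simplify* a es) →
                      ∀ i → a # lookup (es ⟪ τ ⟫*) i
    simplify*-sound a (e ∷ es) h zero    = simplify-sound a e (All.++⁻ˡ (simplify a e) h)
    simplify*-sound a (e ∷ es) h (suc i) = simplify*-sound a es (All.++⁻ʳ (simplify a e) h) i

  mutual
    simplify-complete : ∀ {τ} a e → a # e ⟪ τ ⟫ → All (τ ⊨ᶠ_) (simplify a e)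
    simplify-complete a (atom b) a# with a ≟ᴬ b
    ... | yes refl = contradiction atom a#
    ... | no  _    = []
    simplify-complete a (lam b e) a# with a ≟ᴬ b
    ... | yes _   = []
    ... | no  a≢b = simplify-complete a e (a# ∘ lam a≢b)
    simplify-complete a (fun f es) a# = simplify*-complete a es λ i → a# ∘ fun i
    simplify-complete a (letrec bs u es e) a# with a ∈ᵛ? bs
    ... | yes _    = []
    ... | no  a∉bs = All.++⁺ (simplify*-complete a es λ i → a# ∘ rhs a∉bs i)
                             (simplify-complete a e (a# ∘ inExpr a∉bs))
    simplify-complete {τ} a (susp π X) a# =
      (λ p → a# (subst (_∈FA π · τ X) ($-⁻¹ π a) (FA-· π p))) ∷ []

    simplify*-complete : ∀ {τ n} a (es : Vec Term n) → (∀ i → a # lookup (es ⟪ τ ⟫*) i) →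
                         All (τ ⊨ᶠ_) (simplify* a es)
    simplify*-complete a []       a# = []
    simplify*-complete a (e ∷ es) a# =
      All.++⁺ (simplify-complete a e (a# zero)) (simplify*-complete a es (a# ∘ suc))

  ↦-∼ : ∀ {τ X t} → τ X ∼ t ⟪ τ ⟫ → ∀ Y → (X ↦ t) Y ⟪ τ ⟫ ∼ τ Y
  ↦-∼ {τ} {X} X∼t Y with Y ≟ⱽ X
  ... | yes refl = ∼-sym X∼t
  ... | no  _    = ∼-reflexive ([]-· (τ Y))

  -- A τ that satisfies the equation between X and t does not notice the replacement, so rule (2)
  -- can be read in both directions.
  ⟪↦⟫-∼ : ∀ {τ X t} → τ X ∼ t ⟪ τ ⟫ → ∀ e → e ⟪ X ↦ t ⟫ ⟪ τ ⟫ ∼ e ⟪ τ ⟫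
  ⟪↦⟫-∼ {τ} {X} {t} X∼t e =
    ∼-trans (∼-reflexive (⟪⟫-⟪⟫ (X ↦ t) τ e)) (⟪⟫-∼ (↦-∼ X∼t) e)

  replaceEqns-sound : ∀ {τ X t} → τ X ∼ t ⟪ τ ⟫ → ∀ {Γ} →
                      All (τ ⊨_) (replaceEqns X t Γ) → All (τ ⊨_) Γ
  replaceEqns-sound X∼t h = All.map
    (λ {(l ≐ r)} l∼r → ∼-trans (∼-sym (⟪↦⟫-∼ X∼t l)) (∼-trans l∼r (⟪↦⟫-∼ X∼t r))) (All.map⁻ h)

  replaceEqns-complete : ∀ {τ X t} → τ X ∼ t ⟪ τ ⟫ → ∀ {Γ} →
                         All (τ ⊨_) Γ → All (τ ⊨_) (replaceEqns X t Γ)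
  replaceEqns-complete X∼t h = All.map⁺ (All.map
    (λ {(l ≐ r)} l∼r → ∼-trans (⟪↦⟫-∼ X∼t l) (∼-trans l∼r (∼-sym (⟪↦⟫-∼ X∼t r)))) h)

  replaceFreshness-sound : ∀ {τ X t} → τ X ∼ t ⟪ τ ⟫ → ∀ ∇ →
                           All (τ ⊨ᶠ_) (replaceFreshness X t ∇) → All (τ ⊨ᶠ_) ∇
  replaceFreshness-sound X∼t [] h = []
  replaceFreshness-sound {X = X} {t} X∼t ((a #ⱽ Y) ∷ ∇) h =
    simplify-sound a ((X ↦ t) Y) (All.++⁻ˡ (simplify a ((X ↦ t) Y)) h) ∘ FA-resp (∼-sym (↦-∼ X∼t Y))
    ∷ replaceFreshness-sound X∼t ∇ (All.++⁻ʳ (simplify a ((X ↦ t) Y)) h)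
  replaceFreshness-sound X∼t ((a #self) ∷ ∇) (() ∷ _)

  replaceFreshness-complete : ∀ {τ X t} → τ X ∼ t ⟪ τ ⟫ → ∀ {∇} →
                              All (τ ⊨ᶠ_) ∇ → All (τ ⊨ᶠ_) (replaceFreshness X t ∇)
  replaceFreshness-complete X∼t [] = []
  replaceFreshness-complete {X = X} {t} X∼t {(a #ⱽ Y) ∷ ∇} (a# ∷ h) = All.++⁺
    (simplify-complete a ((X ↦ t) Y) (a# ∘ FA-resp (↦-∼ X∼t Y)))
    (replaceFreshness-complete X∼t h)

  decompose-sound : ∀ {τ q Δ N} → Decompose q Δ N → All (τ ⊨_) Δ → All (τ ⊨ᶠ_) N → τ ⊨ q
  decompose-sound {τ} (fun {ss = ss} {ts}) hΔ _ = fun λ i →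
    subst₂ _∼_ (sym (lookup-⟪⟫* τ ss i)) (sym (lookup-⟪⟫* τ ts i)) (All.tabulate⁻ hΔ i)
  decompose-sound lam (s∼t ∷ []) _ = lam s∼t
  decompose-sound {τ} (lam≠ {a} {b} {s} {t} a≢b) (s∼t ∷ []) hN =
    lam≠ (simplify-sound a t hN) (subst (s ⟪ τ ⟫ ∼_) (·-⟪⟫ [ a , b ] τ t) s∼t)
  decompose-sound {τ} (letrec {as = as} {bs} {v = v} {ss} {ts} {r} {r′} ρ π m) (r∼ ∷ hΔ) hN = letrec ρ π m
    (λ i → simplify-sound (lookup as i) (letrec bs v ts r′)
       (All.lookup (All.map⁻ (All.concat⁻ hN)) (VecMem.∈-toList⁺ (VecMem.∈-lookup i as))))
    (λ i → subst₂ _∼_ (sym (lookup-⟪⟫* τ ss i))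
       (trans (·-⟪⟫ π τ (lookup ts (ρ ⟨$⟩ʳ i))) (cong (π ·_) (sym (lookup-⟪⟫* τ ts (ρ ⟨$⟩ʳ i)))))
       (All.tabulate⁻ hΔ i))
    (subst (r ⟪ τ ⟫ ∼_) (·-⟪⟫ π τ r′) r∼)

  decompose?-sound : ∀ {τ q Δ N} → Decompose? q Δ N → All (τ ⊨_) Δ → All (τ ⊨ᶠ_) N → τ ⊨ q
  decompose?-sound (decomposed d)  hΔ       hN = decompose-sound d hΔ hN
  decompose?-sound (irreducible _) (h ∷ []) _  = h

  -- The permutations that fix `e` up to `∼` form a group, so it suffices that the generators are
  -- among them. This is the soundness of (ElimFP).
  stabilizer : ∀ {G π} e → All (λ ϖ → ϖ · e ∼ e) G → ⟨ G ⟩ π → π · e ∼ e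
  stabilizer e h (gen π∈G) = All.lookup h π∈G
  stabilizer e h ε = ∼-reflexive ([]-· e)
  stabilizer e h (mul {π} {π′} p p′) = ∼-trans (∼-reflexive (⊙-· π π′ e))
    (∼-trans (·-∼ π (stabilizer e h p′)) (stabilizer e h p))
  stabilizer e h (inv {π} p) = ∼-sym (∼-move π (stabilizer e h p))
  stabilizer e h (resp eq p) = ∼-trans (∼-sym (∼-reflexive (·-cong eq e))) (stabilizer e h p)

  ⊨-sym : ∀ {τ s t} → τ ⊨ (s ≐ t) → τ ⊨ (t ≐ s)
  ⊨-sym = ∼-sym

  ∋-All⁺ : ∀ {P : Eqn → Set} → (∀ {s t} → P (s ≐ t) → P (t ≐ s)) →
           ∀ {Γ s t Γ₀} → Γ ∋ s ≐ t ∣ Γ₀ → P (s ≐ t) → All P Γ₀ → All P Γ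
  ∋-All⁺ P-sym (inj₁ Γ↭) p ps = All-resp-↭ (↭-sym Γ↭) (p ∷ ps)
  ∋-All⁺ P-sym (inj₂ Γ↭) p ps = All-resp-↭ (↭-sym Γ↭) (P-sym p ∷ ps)

  ∋-All⁻ : ∀ {P : Eqn → Set} → (∀ {s t} → P (s ≐ t) → P (t ≐ s)) →
           ∀ {Γ s t Γ₀} → Γ ∋ s ≐ t ∣ Γ₀ → All P Γ → P (s ≐ t) × All P Γ₀
  ∋-All⁻ P-sym (inj₁ Γ↭) h with p ∷ ps ← All-resp-↭ Γ↭ h = p , ps
  ∋-All⁻ P-sym (inj₂ Γ↭) h with p ∷ ps ← All-resp-↭ Γ↭ h = P-sym p , ps

  ⊨-∋⁺ : ∀ {τ Γ s t Γ₀} → Γ ∋ s ≐ t ∣ Γ₀ → τ ⊨ (s ≐ t) → All (τ ⊨_) Γ₀ → All (τ ⊨_) Γ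
  ⊨-∋⁺ {τ} = ∋-All⁺ (λ {s} {t} → ⊨-sym {τ} {s} {t})

  ⊨-∋⁻ : ∀ {τ Γ s t Γ₀} → Γ ∋ s ≐ t ∣ Γ₀ → All (τ ⊨_) Γ → τ ⊨ (s ≐ t) × All (τ ⊨_) Γ₀
  ⊨-∋⁻ {τ} = ∋-All⁻ (λ {s} {t} → ⊨-sym {τ} {s} {t})

  susp-solved : ∀ {τ : GroundSubst} {π₁ π₂ X Y} → τ X ∼ susp (π₁ ⁻¹ ⊙ π₂) Y ⟪ τ ⟫ → π₁ · τ X ∼ π₂ · τ Y
  susp-solved {τ} {π₁} {π₂} {Y = Y} h =
    ∼-unmove π₁ (∼-trans h (∼-reflexive (⊙-· (π₁ ⁻¹) π₂ (τ Y))))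

  -- Each side of a fixpoint equation for X keeps its value when (FPS) rewrites it; used for (FPS)
  -- in both directions.
  ⊙⁻¹-∼ : ∀ (τ : GroundSubst) π {X} e → τ X ∼ (π ⁻¹ · e) ⟪ τ ⟫ → ∀ ϖ → ((ϖ ⊙ π ⁻¹) · e) ⟪ τ ⟫ ∼ ϖ · τ X
  ⊙⁻¹-∼ τ π e h ϖ = ∼-trans (∼-reflexive (trans (cong (_⟪ τ ⟫) (⊙-· ϖ (π ⁻¹) e)) (·-⟪⟫ ϖ τ (π ⁻¹ · e))))
    (·-∼ ϖ (∼-sym h))

  -- The equation deleted by (2) is recovered from the binding appended to θ, the reason for
  -- including bindings in `Sat`. The same happens for (FPS) below.
  step¹-sound : ∀ {τ S S′} → S ⟶¹ S′ → Sat τ S′ → Sat τ S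
  step¹-sound {τ} (delete del e≋e′) s = Sat-eqns (⊨-∋⁺ del (≋⇒∼ τ e≋e′) (Sat.eqns s)) s
  step¹-sound {τ} (replace {∇ = ∇} {θ} {π₁ = π₁} {π₂} {X} {Y} del X≢Y) s = record
    { eqns  = ⊨-∋⁺ del (susp-solved {τ} {π₁} {π₂} {X} {Y} X∼t) (replaceEqns-sound X∼t (Sat.eqns s))
    ; fresh = replaceFreshness-sound X∼t ∇ (Sat.fresh s)
    ; binds = All.++⁻ˡ θ (Sat.binds s) }
    where X∼t = All.head (All.++⁻ʳ θ (Sat.binds s))
  step¹-sound (decompose {Δ = Δ} {N} del d) s = record
    { eqns  = ⊨-∋⁺ del (decompose-sound d (All.++⁻ˡ Δ (Sat.eqns s)) (All.++⁻ˡ N (Sat.fresh s)))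
                       (All.++⁻ʳ Δ (Sat.eqns s))
    ; fresh = All.++⁻ʳ N (Sat.fresh s)
    ; binds = Sat.binds s }
  step¹-sound {τ} (elimFP {π = π} {π′} {X} ps Γ↭ ps∈ p) s =
    Sat-eqns (All-resp-↭ (↭-sym Γ↭) (πX∼π′X ∷ Sat.eqns s)) s
    where
    fixed : All (λ ϖ → ϖ · τ X ∼ τ X) (List.map (λ (πᵢ , πᵢ′) → πᵢ ⁻¹ ⊙ πᵢ′) ps)
    fixed = All.map⁺ (All.map (λ { {πᵢ , πᵢ′} q∈ → ∼-trans (∼-reflexive (⊙-· (πᵢ ⁻¹) πᵢ′ (τ X)))
      (∼-sym (∼-move πᵢ (All.lookup (Sat.eqns s) q∈))) }) ps∈)
    πX∼π′X : π · τ X ∼ π′ · τ X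
    πX∼π′X = susp-solved {τ} {π} {π′} {X} {X} (∼-sym (stabilizer (τ X) fixed p))

  step²-sound : ∀ {τ S S′} → S ⟶² S′ → Sat τ S′ → Sat τ S
  step²-sound {τ} (mms {π₁ = π₁} {π₂} {X} {e₁} {e₂} {Δ = Δ} {N} del₁ del₂ _ _ d) s with X∼e₁ ∷ h ← Sat.eqns s = record
    { eqns  = ⊨-∋⁺ del₁ X∼e₁ (⊨-∋⁺ del₂ X∼e₂ (All.++⁻ʳ Δ h))
    ; fresh = All.++⁻ʳ N (Sat.fresh s)
    ; binds = Sat.binds s }
    where
    e₁∼e₂ : (π₁ ⁻¹ · e₁) ⟪ τ ⟫ ∼ (π₂ ⁻¹ · e₂) ⟪ τ ⟫
    e₁∼e₂ = decompose?-sound d (All.++⁻ˡ Δ h) (All.++⁻ˡ N (Sat.fresh s))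
    X∼e₂ : π₂ · τ X ∼ e₂ ⟪ τ ⟫
    X∼e₂ = ∼-unmove π₂ (∼-trans (∼-move π₁ X∼e₁)
      (subst₂ _∼_ (·-⟪⟫ (π₁ ⁻¹) τ e₁) (·-⟪⟫ (π₂ ⁻¹) τ e₂) e₁∼e₂))
  step²-sound {τ} (fps {θ = θ} {π} {X} {e} ps del _ _ _ _) s = record
    { eqns  = ⊨-∋⁺ del (∼-unmove π (subst (τ X ∼_) (·-⟪⟫ (π ⁻¹) τ e) X∼)) (All.++⁺
                (All.map⁺ (All.map (λ { {ϖ , ϖ′} h → ∼-trans (∼-sym (⊙⁻¹-∼ τ π {X} e X∼ ϖ))
                                                       (∼-trans h (⊙⁻¹-∼ τ π {X} e X∼ ϖ′)) })
                            (All.map⁻ (All.++⁻ˡ _ (Sat.eqns s)))))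
                (All.++⁻ʳ (List.map (λ (ϖ , ϖ′) → (ϖ ⊙ π ⁻¹) · e ≐ (ϖ′ ⊙ π ⁻¹) · e) ps) (Sat.eqns s)))
    ; fresh = Sat.fresh s
    ; binds = All.++⁻ˡ θ (Sat.binds s) }
    where X∼ = All.head (All.++⁻ʳ θ (Sat.binds s))

  step-sound : ∀ {τ S S′} → S ⟶ S′ → Sat τ S′ → Sat τ S
  step-sound (high st)  s = step¹-sound st s
  step-sound (low _ st) s = step²-sound st s
  step-sound {τ} (merge {s = l} {t = r} Γ↭ del l≋ r≋) s = Sat-eqns
    (All-resp-↭ (↭-sym Γ↭)
      (∼-trans (≋⇒∼ τ l≋) (∼-trans (proj₁ (⊨-∋⁻ del (Sat.eqns s))) (∼-sym (≋⇒∼ τ r≋)))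
       ∷ Sat.eqns s)) s

  -- Variables of a run and soundness

  Var-·⁻ : ∀ π {X : V} (e : Expr V) → X ∈Var π · e → X ∈Var e
  Var-·⁻ {V} π {X} = elim _ (λ _ ())
    (λ { a e ih (lam p) → lam (ih p) })
    (λ { f es ih (fun i p) → fun i (ih i (subst (X ∈Var_) (lookup-·* π es i) p)) })
    (λ { as u es e ihs ih (rhs i p) → rhs i (ihs i (subst (X ∈Var_) (lookup-·* π es i) p))
       ; as u es e ihs ih (inExpr p) → inExpr (ih p) })
    (λ { π X susp → susp })

  Var-⟪⟫⁻ : ∀ {τ : V → Expr W} {X} (e : Expr V) → X ∈Var e ⟪ τ ⟫ →
            ∃ λ Y → Y ∈Var e × X ∈Var τ Y
  Var-⟪⟫⁻ {V} {W} {τ} {X} = elim _ (λ _ ())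
    (λ { a e ih (lam p) → wrap lam (ih p) })
    (λ { f es ih (fun i p) → wrap (fun i) (ih i (subst (X ∈Var_) (lookup-⟪⟫* τ es i) p)) })
    (λ { as u es e ihs ih (rhs i p) → wrap (rhs i) (ihs i (subst (X ∈Var_) (lookup-⟪⟫* τ es i) p))
       ; as u es e ihs ih (inExpr p) → wrap inExpr (ih p) })
    (λ π Y p → Y , susp , Var-·⁻ π (τ Y) p)
    where
    wrap : ∀ {e e′ : Expr V} → (∀ {Y} → Y ∈Var e → Y ∈Var e′) →
           (∃ λ Y → Y ∈Var e × X ∈Var τ Y) → ∃ λ Y → Y ∈Var e′ × X ∈Var τ Y
    wrap f (Y , p , q) = Y , f p , q

  -- The predicate is a parameter because one invariance proof serves three uses: variables outside
  -- the domain of θ, variables other than X, and variables from a finite list.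
  Vars : (Var → Set) → Term → Set
  Vars Q e = ∀ X → X ∈Var e → Q X

  VarsEqn : (Var → Set) → Eqn → Set
  VarsEqn Q (s ≐ t) = Vars Q s × Vars Q t

  module _ {Q : Var → Set} where

    Vars-· : ∀ π {e} → Vars Q e → Vars Q (π · e)
    Vars-· π {e} h X p = h X (Var-·⁻ π e p)

    Vars-↦ : ∀ {X t} → Vars Q t → ∀ {Y} → (Y ≢ X → Q Y) → Vars Q ((X ↦ t) Y)
    Vars-↦ {X} ht {Y} hY with Y ≟ⱽ X
    ... | yes _  = ht
    ... | no Y≢X = λ { _ susp → hY Y≢X }

    Vars-⟪↦⟫ : ∀ {X t} → Vars Q t → ∀ {e} → Vars (λ Y → Y ≢ X → Q Y) e → Vars Q (e ⟪ X ↦ t ⟫)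
    Vars-⟪↦⟫ ht {e} he Z p with Y , Y∈ , Z∈ ← Var-⟪⟫⁻ e p = Vars-↦ ht (he Y Y∈) Z Z∈

    -- Nothing is asked of X itself, which the replacement removes. With `_≢ X` for `Q` the
    -- assumption on Γ becomes trivial, and the conclusion says that X is gone.
    VarsEqns-replace : ∀ {X t} → Vars Q t → ∀ {Γ} → All (VarsEqn (λ Y → Y ≢ X → Q Y)) Γ →
                       All (VarsEqn Q) (replaceEqns X t Γ)
    VarsEqns-replace ht h = All.map⁺ (All.map
      (λ {(s ≐ t)} (hs , ht′) → Vars-⟪↦⟫ ht {s} hs , Vars-⟪↦⟫ ht {t} ht′) h)

    Decompose-vars : ∀ {q Δ N} → Decompose q Δ N → VarsEqn Q q → All (VarsEqn Q) Δ
    Decompose-vars fun (hs , ht) = All.tabulate⁺ λ i → (λ X → hs X ∘ fun i) , (λ X → ht X ∘ fun i)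
    Decompose-vars lam (hs , ht) = ((λ X → hs X ∘ lam) , (λ X → ht X ∘ lam)) ∷ []
    Decompose-vars (lam≠ {a} {b} {s} {t} _) (hs , ht) =
      ((λ X → hs X ∘ lam) , Vars-· [ a , b ] {t} (λ X → ht X ∘ lam)) ∷ []
    Decompose-vars (letrec {ts = ts} {r′ = r′} ρ π _) (hs , ht) =
      ((λ X → hs X ∘ inExpr) , Vars-· π {r′} (λ X → ht X ∘ inExpr)) ∷
      All.tabulate⁺ λ i → (λ X → hs X ∘ rhs i) ,
        Vars-· π {lookup ts (ρ ⟨$⟩ʳ i)} (λ X → ht X ∘ rhs (ρ ⟨$⟩ʳ i))

    VarsEqns-fps : ∀ π e → Vars Q e → (ps : List (Perm × Perm)) →
                   All (VarsEqn Q) (List.map (λ (ϖ , ϖ′) → (ϖ ⊙ π ⁻¹) · e ≐ (ϖ′ ⊙ π ⁻¹) · e) ps)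
    VarsEqns-fps π e he ps = All.map⁺ (All.universal
      (λ (ϖ , ϖ′) → Vars-· (ϖ ⊙ π ⁻¹) {e} he , Vars-· (ϖ′ ⊙ π ⁻¹) {e} he) ps)

    step¹-vars : ∀ {S S′} → S ⟶¹ S′ → All (VarsEqn Q) (State.Γ S) → All (VarsEqn Q) (State.Γ S′)
    step¹-vars (delete del _) h = proj₂ (∋-All⁻ Product.swap del h)
    step¹-vars (replace del _) h with (hX , hY) , h₀ ← ∋-All⁻ Product.swap del h =
      VarsEqns-replace (λ { Y susp → hY Y susp })
        (All.map (λ (hs , ht) → (λ X p _ → hs X p) , (λ X p _ → ht X p)) h₀)
    step¹-vars (decompose del d) h with hq , h₀ ← ∋-All⁻ Product.swap del h = All.++⁺ (Decompose-vars d hq) h₀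
    step¹-vars (elimFP ps Γ↭ _ _) h = All.tail (All-resp-↭ Γ↭ h)

    step²-vars : ∀ {S S′} → S ⟶² S′ → All (VarsEqn Q) (State.Γ S) → All (VarsEqn Q) (State.Γ S′)
    step²-vars (mms {π₁ = π₁} {π₂} {e₁ = e₁} {e₂} del₁ del₂ _ _ d) h
      with hq₁@(_ , he₁) , h₁ ← ∋-All⁻ Product.swap del₁ h
      with (_ , he₂) , h₀ ← ∋-All⁻ Product.swap del₂ h₁
      = hq₁ ∷ All.++⁺ (decomposed-vars d (Vars-· (π₁ ⁻¹) {e₁} he₁ , Vars-· (π₂ ⁻¹) {e₂} he₂)) h₀
      where
      decomposed-vars : ∀ {q Δ N} → Decompose? q Δ N → VarsEqn Q q → All (VarsEqn Q) Δ
      decomposed-vars (decomposed d)  hq = Decompose-vars d hq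
      decomposed-vars (irreducible _) hq = hq ∷ []
    step²-vars (fps {π = π} {e = e} ps del _ _ _ _) h with (_ , he) , h₀ ← ∋-All⁻ Product.swap del h =
      All.++⁺ (VarsEqns-fps π e he ps) (All.++⁻ʳ _ h₀)

    step-vars : ∀ {S S′} → S ⟶ S′ → All (VarsEqn Q) (State.Γ S) → All (VarsEqn Q) (State.Γ S′)
    step-vars (high st)       h = step¹-vars st h
    step-vars (low _ st)      h = step²-vars st h
    step-vars (merge Γ↭ _ _ _) h = All.tail (All-resp-↭ Γ↭ h)

  -- What (2) and (FPS) have in common. Quantifying `occurs` over `Q` expresses that X and the
  -- variables of t occur in Γ, in the form that both triangularity and termination consume.
  record Binds (S S′ : State) : Set₁ where
    field
      X        : Var
      t        : Term
      extended : State.θ S′ ≡ State.θ S ++ [ X , t ]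
      occurs   : ∀ {Q} → All (VarsEqn Q) (State.Γ S) → Q X × Vars Q t
      acyclic  : Vars (_≢ X) t
      vanishes : All (VarsEqn (_≢ X)) (State.Γ S′)

  ∉VarEqns : ∀ {X Γ} → ¬ X ∈VarEqns Γ → All (VarsEqn (_≢ X)) Γ
  ∉VarEqns X∉ = All.map
    (λ X∉q → (λ { Y p refl → X∉q (left p) }) , (λ { Y p refl → X∉q (right p) })) (All.¬Any⇒All¬ _ X∉)

  replace-binds : ∀ {Γ Γ₀ ∇ ∇′ θ π₁ π₂ X Y} → Γ ∋ susp π₁ X ≐ susp π₂ Y ∣ Γ₀ → X ≢ Y →
                  let t = susp (π₁ ⁻¹ ⊙ π₂) Y in
                  Binds ⟨ Γ , ∇ , θ ⟩ₛ ⟨ replaceEqns X t Γ₀ , ∇′ , θ ++ [ X , t ] ⟩ₛ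
  replace-binds {π₁ = π₁} {π₂} {X} {Y} del X≢Y = record
    { extended = refl
    ; occurs   = λ h → let (hX , hY) , _ = ∋-All⁻ Product.swap del h in hX X susp , λ { _ susp → hY Y susp }
    ; acyclic  = Y≢X
    ; vanishes = VarsEqns-replace Y≢X
        (All.universal (λ _ → (λ _ _ → id) , (λ _ _ → id)) _)
    }
    where
    Y≢X : Vars (_≢ X) (susp (π₁ ⁻¹ ⊙ π₂) Y)
    Y≢X _ susp = X≢Y ∘ sym

  fps-binds : ∀ {Γ Γ₀ ∇ θ π X e} (ps : List (Perm × Perm)) →
              Γ ∋ susp π X ≐ e ∣ (List.map (λ (ϖ , ϖ′) → susp ϖ X ≐ susp ϖ′ X) ps ++ Γ₀) →
              ¬ X ∈VarEqns Γ₀ → ¬ X ∈Var e →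
              Binds ⟨ Γ , ∇ , θ ⟩ₛ
                ⟨ List.map (λ (ϖ , ϖ′) → (ϖ ⊙ π ⁻¹) · e ≐ (ϖ′ ⊙ π ⁻¹) · e) ps ++ Γ₀
                , ∇ , θ ++ [ X , π ⁻¹ · e ] ⟩ₛ
  fps-binds {π = π} {X} {e} ps del X∉Γ₀ X∉e = record
    { extended = refl
    ; occurs   = λ h → let (hX , he) , _ = ∋-All⁻ Product.swap del h in hX X susp , Vars-· (π ⁻¹) {e} he
    ; acyclic  = Vars-· (π ⁻¹) {e} X∉
    ; vanishes = All.++⁺ (VarsEqns-fps π e X∉ ps) (∉VarEqns X∉Γ₀)
    }
    where
    X∉ : Vars (_≢ X) e
    X∉ _ p refl = X∉e p

  step-binds : ∀ {S S′} → S ⟶ S′ → State.θ S′ ≡ State.θ S ⊎ Binds S S′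
  step-binds (high (delete _ _))                 = inj₁ refl
  step-binds (high (replace del X≢Y))            = inj₂ (replace-binds del X≢Y)
  step-binds (high (decompose _ _))              = inj₁ refl
  step-binds (high (elimFP _ _ _ _))             = inj₁ refl
  step-binds (low _ (mms _ _ _ _ _))             = inj₁ refl
  step-binds (low _ (fps ps del X∉Γ₀ X∉e _ _))   = inj₂ (fps-binds ps del X∉Γ₀ X∉e)
  step-binds (merge _ _ _ _)                     = inj₁ refl

  -- Triangular substitutions

  infix 4 _∉dom_
  _∉dom_ : Var → Subst → Set
  X ∉dom σ = All (λ (Y , _) → Y ≢ X) σ

  data Triangular : Subst → Set where
    []  : Triangular []
    add : ∀ {X t σ} → Vars (_≢ X) t → All (λ (Y , s) → Y ≢ X × Vars (_≢ X) s) σ →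
          Triangular σ → Triangular ((X , t) ∷ σ)

  -- A run appends its bindings, whereas `Triangular` is built from the front, in the order of
  -- application; this bridges the two.
  Triangular-∷ʳ : ∀ {X t σ} → Triangular σ → X ∉dom σ → Vars (_∉dom σ) t → Vars (_≢ X) t →
                  Triangular (σ ++ [ X , t ])
  Triangular-∷ʳ [] _ _ X∉t = add X∉t [] []
  Triangular-∷ʳ (add Z∉s Z∉σ tri) (Z≢X ∷ X∉σ) t∉ X∉t =
    add Z∉s (All.++⁺ Z∉σ ((≢-sym Z≢X , (λ Y p → ≢-sym (All.head (t∉ Y p)))) ∷ []))
        (Triangular-∷ʳ tri X∉σ (λ Y p → All.tail (t∉ Y p)) X∉t)

  ˢ-⟪⟫ : ∀ σ ρ e → (e [ σ ]ˢ) ⟪ ρ ⟫ ≡ e ⟪ σ ⨾ ρ ⟫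
  ˢ-⟪⟫ []            ρ e = ⟪⟫-cong e λ X _ → sym ([]-· (ρ X))
  ˢ-⟪⟫ ((X , t) ∷ σ) ρ e = begin
    (e ⟪ X ↦ t ⟫ [ σ ]ˢ) ⟪ ρ ⟫             ≡⟨ ˢ-⟪⟫ σ ρ (e ⟪ X ↦ t ⟫) ⟩
    e ⟪ X ↦ t ⟫ ⟪ σ ⨾ ρ ⟫                  ≡⟨ ⟪⟫-⟪⟫ (X ↦ t) (σ ⨾ ρ) e ⟩
    e ⟪ (λ Y → (X ↦ t) Y ⟪ σ ⨾ ρ ⟫) ⟫      ≡⟨ ⟪⟫-cong e (λ Y _ → trans (sym (ˢ-⟪⟫ σ ρ ((X ↦ t) Y)))
                                                (cong (λ s → (s [ σ ]ˢ) ⟪ ρ ⟫) (sym ([]-· ((X ↦ t) Y))))) ⟩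
    e ⟪ ((X , t) ∷ σ) ⨾ ρ ⟫                ∎
    where open ≡-Reasoning

  ∷-⨾ : ∀ X t σ ρ Y → (((X , t) ∷ σ) ⨾ ρ) Y ≡ (X ↦ t) Y ⟪ σ ⨾ ρ ⟫
  ∷-⨾ X t σ ρ Y = trans (cong (λ s → (s [ σ ]ˢ) ⟪ ρ ⟫) ([]-· ((X ↦ t) Y))) (ˢ-⟪⟫ σ ρ ((X ↦ t) Y))

  ↦-≡ : ∀ X t → (X ↦ t) X ≡ t
  ↦-≡ X t with X ≟ⱽ X
  ... | yes _  = refl
  ... | no X≢X = contradiction refl X≢X

  ↦-≢ : ∀ {X t Y} → Y ≢ X → (X ↦ t) Y ≡ var Y
  ↦-≢ {X} {t} {Y} Y≢X with Y ≟ⱽ X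
  ... | yes Y≡X = contradiction Y≡X Y≢X
  ... | no _    = refl

  ∷-⨾-≢ : ∀ {X t Y} σ ρ → Y ≢ X → (((X , t) ∷ σ) ⨾ ρ) Y ≡ (σ ⨾ ρ) Y
  ∷-⨾-≢ {X} {t} {Y} σ ρ Y≢X = trans (∷-⨾ X t σ ρ Y)
    (trans (cong (_⟪ σ ⨾ ρ ⟫) (↦-≢ Y≢X)) ([]-· ((σ ⨾ ρ) Y)))

  ⨾-∉dom : ∀ σ ρ {Y} → Y ∉dom σ → (σ ⨾ ρ) Y ≡ ρ Y
  ⨾-∉dom []            ρ _           = []-· _
  ⨾-∉dom ((X , t) ∷ σ) ρ (X≢Y ∷ Y∉σ) = trans (∷-⨾-≢ σ ρ (≢-sym X≢Y)) (⨾-∉dom σ ρ Y∉σ)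

  -- The first key occurs in none of the right-hand sides, and on all other variables the whole
  -- substitution coincides with its tail.
  Triangular-solved : ∀ {σ} ρ → Triangular σ → All (λ (X , t) → (σ ⨾ ρ) X ≡ t ⟪ σ ⨾ ρ ⟫) σ
  Triangular-solved ρ [] = []
  Triangular-solved ρ (add {X} {t} {σ} X∉t X∉σ tri) =
    trans (∷-⨾ X t σ ρ X) (trans (cong (_⟪ σ ⨾ ρ ⟫) (↦-≡ X t)) (unchanged t X∉t)) ∷
    All.map (λ { {Y , s} ((Y≢X , X∉s) , eq) → trans (∷-⨾-≢ σ ρ Y≢X) (trans eq (unchanged s X∉s)) })
            (All.zip (X∉σ , Triangular-solved ρ tri))
    where
    unchanged : ∀ s → Vars (_≢ X) s → s ⟪ σ ⨾ ρ ⟫ ≡ s ⟪ ((X , t) ∷ σ) ⨾ ρ ⟫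
    unchanged s X∉s = ⟪⟫-cong s λ Y p → sym (∷-⨾-≢ σ ρ (X∉s Y p))

  -- New bindings take their variables from Γ, so θ stays triangular as long as Γ avoids the
  -- variables bound so far. At the end the first field says that fixpoint variables lie outside the
  -- domain of σ.
  record WellFormed (S : State) : Set where
    open State S
    field
      Γ∉dom      : All (VarsEqn (_∉dom θ)) Γ
      triangular : Triangular θ

  step-wf : ∀ {S S′} → S ⟶ S′ → WellFormed S → WellFormed S′
  step-wf {S} {S′} st wf with step-binds st
  ... | inj₁ eq = record
    { Γ∉dom      = subst (λ θ → All (VarsEqn (_∉dom θ)) (State.Γ S′)) (sym eq)
                     (step-vars st (WellFormed.Γ∉dom wf))
    ; triangular = subst Triangular (sym eq) (WellFormed.triangular wf) }
  ... | inj₂ b = record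
    { Γ∉dom      = subst (λ θ → All (VarsEqn (_∉dom θ)) (State.Γ S′)) (sym extended)
                     (All.map both (All.zip (step-vars st (WellFormed.Γ∉dom wf) , vanishes)))
    ; triangular = subst Triangular (sym extended)
                     (Triangular-∷ʳ (WellFormed.triangular wf) (proj₁ X,t∉) (proj₂ X,t∉) acyclic) }
    where
    open Binds b
    X,t∉ = occurs (WellFormed.Γ∉dom wf)
    both : ∀ {q} → VarsEqn (_∉dom State.θ S) q × VarsEqn (_≢ X) q →
           VarsEqn (_∉dom (State.θ S ++ [ X , t ])) q
    both ((l , r) , (l≢ , r≢)) = (λ Y p → All.++⁺ (l Y p) (≢-sym (l≢ Y p) ∷ [])) ,
                                 (λ Y p → All.++⁺ (r Y p) (≢-sym (r≢ Y p) ∷ []))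

  run-wf : ∀ {S S′} → Star _⟶_ S S′ → WellFormed S → WellFormed S′
  run-wf ε          wf = wf
  run-wf (st ◅ sts) wf = run-wf sts (step-wf st wf)

  run-sound : ∀ {τ S S′} → Star _⟶_ S S′ → Sat τ S′ → Sat τ S
  run-sound ε          s = s
  run-sound (st ◅ sts) s = step-sound st (run-sound sts s)

  -- Correctness of flattening and the soundness proof

  mutual
    -- The added equations force every new variable to denote the subexpression it replaces. As an
    -- equivalence, this serves completeness as well.
    ⇝-sound : ∀ {τ e e′ Δ} → e ⇝ e′ ∣ Δ → All (λ (X , t) → τ X ∼ t ⟪ τ ⟫) Δ → e′ ⟪ τ ⟫ ∼ e ⟪ τ ⟫
    ⇝-sound atom _ = ∼-refl
    ⇝-sound susp _ = ∼-refl
    ⇝-sound {τ} (lam {X = X} fl) (X∼ ∷ hΔ) =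
      lam (subst (_∼ _) (sym ([]-· (τ X))) (∼-trans X∼ (⇝-sound fl hΔ)))
    ⇝-sound {τ} (fun fls) hΔ = fun (⇝*-sound′ fls hΔ)
    ⇝-sound {τ} (letrec {X = X} (fl ∷ fls)) (X∼ ∷ hΔ) = letrec-∼ FinP.id (λ _ → refl)
      (⇝*-sound′ fls (All.++⁻ʳ _ hΔ))
      (subst (_∼ _) (sym ([]-· (τ X))) (∼-trans X∼ (⇝-sound fl (All.++⁻ˡ _ hΔ))))

    ⇝*-sound : ∀ {τ n Δ} {es : Vec Term n} {Xs} → es ⇝* Xs ∣ Δ →
               All (λ (X , t) → τ X ∼ t ⟪ τ ⟫) Δ → ∀ i → τ (lookup Xs i) ∼ lookup es i ⟪ τ ⟫
    ⇝*-sound (fl ∷ fls) (X∼ ∷ hΔ) zero    = ∼-trans X∼ (⇝-sound fl (All.++⁻ˡ _ hΔ))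
    ⇝*-sound (fl ∷ fls) (X∼ ∷ hΔ) (suc i) = ⇝*-sound fls (All.++⁻ʳ _ hΔ) i

    ⇝*-sound′ : ∀ {τ n Δ} {es : Vec Term n} {Xs} → es ⇝* Xs ∣ Δ →
                All (λ (X , t) → τ X ∼ t ⟪ τ ⟫) Δ →
                ∀ i → lookup (Vec.map var Xs ⟪ τ ⟫*) i ∼ lookup (es ⟪ τ ⟫*) i
    ⇝*-sound′ {τ} {es = es} {Xs} fls hΔ i = subst₂ _∼_
      (sym (trans (lookup-⟪⟫* τ (Vec.map var Xs) i)
        (trans (cong (_⟪ τ ⟫) (Vec.lookup-map i var Xs)) ([]-· _))))
      (sym (lookup-⟪⟫* τ es i)) (⇝*-sound fls hΔ i)

  FlatEqns-sound : ∀ {τ Γ Γ′ Δ} → FlatEqns Γ Γ′ Δ → All (λ (X , t) → τ X ∼ t ⟪ τ ⟫) Δ →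
                   All (τ ⊨_) Γ′ → All (τ ⊨_) Γ
  FlatEqns-sound [] _ _ = []
  FlatEqns-sound (_∷_ {Δ = Δ} {Δ′} (fs , ft) fΓ) hΔ (s∼t ∷ h) =
    ∼-trans (∼-sym (⇝-sound fs (All.++⁻ˡ Δ hΔ)))
      (∼-trans s∼t (⇝-sound ft (All.++⁻ˡ Δ′ (All.++⁻ʳ Δ hΔ))))
    ∷ FlatEqns-sound fΓ (All.++⁻ʳ Δ′ (All.++⁻ʳ Δ hΔ)) h

  initial : Problem → List Eqn → State
  initial P Γ₀ = ⟨ Γ₀ , List.map (uncurry _#ⱽ_) (Problem.∇ P) , [] ⟩ₛ

  initial-sound : ∀ {τ P Γ₀} → Flattening P Γ₀ → Sat τ (initial P Γ₀) → Solves τ P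
  initial-sound {τ} fl s = record
    { equations = All.lookup (FlatEqns-sound flattens
        (All.map (λ {(X , t)} → subst (_∼ t ⟪ τ ⟫) ([]-· (τ X))) (All.map⁻ (All.++⁻ʳ body eqns)))
        (All.++⁻ˡ body eqns))
    ; freshness = All.lookup (All.map⁻ (Sat.fresh s)) }
    where
    open Flattening fl
    eqns = subst (All (τ ⊨_)) result (Sat.eqns s)

  FA-⟪⟫-closed : ∀ {c : Ground} → (∀ a → a # c) → ∀ {a} (e : Expr V) → a ∈FA e ⟪ (λ _ → c) ⟫ → a ∈FA e
  FA-⟪⟫-closed {V} {c} closed {a} = elim _
    (λ { _ atom → atom })
    (λ { b e ih (lam a≢b p) → lam a≢b (ih p) })
    (λ { f es ih (fun i p) → fun i (ih i (subst (a ∈FA_) (lookup-⟪⟫* _ es i) p)) })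
    (λ { as u es e ihs ih (rhs a∉as i p) → rhs a∉as i (ihs i (subst (a ∈FA_) (lookup-⟪⟫* _ es i) p))
       ; as u es e ihs ih (inExpr a∉as p) → inExpr a∉as (ih p) })
    (λ π X p → contradiction (FA-·⁻ π p) (closed _))

  soundness : ∀ P U → P ⇓ U → IsUnifier P U
  soundness P U (Γ₀ , S , fl , run , out) with refl ← Outputs.Γ-fixpoints out
    | refl ← Outputs.∇-variables out | refl ← Outputs.θ-output out = record
    { fix∉dom     = λ q∈ X∈ → let Y , Y∈ , eq = ∈.∈-map⁻ proj₁ X∈ in
                      All.lookup (fix∉dom q∈) Y∈ (sym eq)
    -- All variables become the closed expression λa.a. Permutations do not affect it up to `∼`, and
    -- an atom free in an instance of Xσ is already free in Xσ, which `failFS` excludes for the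
    -- constraints of the output.
    ; satisfiable = (λ _ → closed) , record
        { freshness = λ {a} {X} c∈ p → Outputs.no-failure out
            (failFS (∈.∈-map⁺ (uncurry _#ⱽ_) c∈) (FA-⟪⟫-closed (λ _ → #closed) (var X [ σ ]ˢ) p))
        ; fixpoints = λ {π} {π′} _ → agree closed {π} {π′} λ c c∈ → contradiction c∈ #closed }
    ; solution    = λ ρ sol → initial-sound fl (run-sound run record
        { eqns  = All.map⁺ (All.tabulate λ { {fix π π′ X} q∈ →
                    -- The fixpoint equations are assumed for ρ but needed for σρ; both agree on X
                    -- because σ does not bind it.
                    subst (λ e → π · e ∼ π′ · e) (sym (⨾-∉dom σ ρ (fix∉dom q∈)))
                      (SolvesTriple.fixpoints sol q∈) })
        ; fresh = All.map⁺ (All.tabulate (SolvesTriple.freshness sol))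
        ; binds = All.map ∼-reflexive (Triangular-solved ρ (WellFormed.triangular wf)) }) }
    where
    open Triple U
    wf = run-wf run record { Γ∉dom = All.universal (λ _ → (λ _ _ → []) , (λ _ _ → [])) _ ; triangular = [] }
    fix∉dom : ∀ {π π′ X} → fix π π′ X ∈ FIX → X ∉dom σ
    fix∉dom {X = X} q∈ = proj₁ (All.lookup (WellFormed.Γ∉dom wf) (∈.∈-map⁺ fixEqn q∈)) X susp
    a = proj₁ (freshAtom [])
    closed : Ground
    closed = lam a (atom a)
    #closed : ∀ {c} → c # closed
    #closed (lam c≢a atom) = c≢a refl

  -- Termination measure

  data Suspension : Term → Set where
    susp : ∀ {π X} → Suspension (susp π X)

  -- Invariant of runs that keeps weights under control: decomposing flat terms yields only
  -- equations between suspensions, of weight 1 each. (FPS) respects it since X occurs elsewhere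
  -- only in its own fixpoint equations, where e is put at the top.
  data Flat : Term → Set where
    atom   : ∀ {a} → Flat (atom a)
    lam    : ∀ {a e} → Suspension e → Flat (lam a e)
    fun    : ∀ {f es} → (∀ i → Suspension (lookup es i)) → Flat (fun f es)
    letrec : ∀ {n} {as : Vec Atom n} .{u : Unique as} {es e} →
             (∀ i → Suspension (lookup es i)) → Suspension e → Flat (letrec as u es e)
    susp   : ∀ {π X} → Flat (susp π X)

  FlatEqn SuspensionEqn : Eqn → Set
  FlatEqn (s ≐ t)       = Flat s × Flat t
  SuspensionEqn (s ≐ t) = Suspension s × Suspension t

  Suspension-· : ∀ π {e} → Suspension e → Suspension (π · e)
  Suspension-· π susp = susp

  Suspension-⟪↦⟫ : ∀ {X π Y e} → Suspension e → Suspension (e ⟪ X ↦ susp π Y ⟫)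
  Suspension-⟪↦⟫ {X} (susp {X = Z}) with Z ≟ⱽ X
  ... | yes _ = susp
  ... | no  _ = susp

  Suspension⇒Flat : ∀ {e} → Suspension e → Flat e
  Suspension⇒Flat susp = susp

  Flat-· : ∀ π {e} → Flat e → Flat (π · e)
  Flat-· π atom = atom
  Flat-· π (lam s) = lam (Suspension-· π s)
  Flat-· π (fun {es = es} ss) =
    fun λ i → subst Suspension (sym (lookup-·* π es i)) (Suspension-· π (ss i))
  Flat-· π (letrec {es = es} ss s) =
    letrec (λ i → subst Suspension (sym (lookup-·* π es i)) (Suspension-· π (ss i))) (Suspension-· π s)
  Flat-· π susp = susp

  Flat-⟪↦⟫ : ∀ {X π Y e} → Flat e → Flat (e ⟪ X ↦ susp π Y ⟫)
  Flat-⟪↦⟫ atom = atom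
  Flat-⟪↦⟫ (lam s) = lam (Suspension-⟪↦⟫ s)
  Flat-⟪↦⟫ (fun {es = es} ss) =
    fun λ i → subst Suspension (sym (lookup-⟪⟫* _ es i)) (Suspension-⟪↦⟫ (ss i))
  Flat-⟪↦⟫ (letrec {es = es} ss s) =
    letrec (λ i → subst Suspension (sym (lookup-⟪⟫* _ es i)) (Suspension-⟪↦⟫ (ss i))) (Suspension-⟪↦⟫ s)
  Flat-⟪↦⟫ susp = Suspension⇒Flat (Suspension-⟪↦⟫ susp)

  Decompose-suspensions : ∀ {q Δ N} → Decompose q Δ N → FlatEqn q → All SuspensionEqn Δ
  Decompose-suspensions fun (fun hs , fun ht) = All.tabulate⁺ λ i → hs i , ht i
  Decompose-suspensions lam (lam hs , lam ht) = (hs , ht) ∷ []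
  Decompose-suspensions (lam≠ {a} {b} _) (lam hs , lam ht) = (hs , Suspension-· [ a , b ] ht) ∷ []
  Decompose-suspensions (letrec ρ π _) (letrec hss hs , letrec hts ht) =
    (hs , Suspension-· π ht) ∷ All.tabulate⁺ λ i → hss i , Suspension-· π (hts (ρ ⟨$⟩ʳ i))

  SuspensionEqn⇒FlatEqn : ∀ {q} → SuspensionEqn q → FlatEqn q
  SuspensionEqn⇒FlatEqn (s , t) = Suspension⇒Flat s , Suspension⇒Flat t

  Decompose-flat : ∀ {q Δ N} → Decompose q Δ N → FlatEqn q → All FlatEqn Δ
  Decompose-flat d h = All.map SuspensionEqn⇒FlatEqn (Decompose-suspensions d h)

  step-flat : ∀ {S S′} → S ⟶ S′ → All FlatEqn (State.Γ S) → All FlatEqn (State.Γ S′)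
  step-flat (high (delete del _)) h = proj₂ (∋-All⁻ Product.swap del h)
  step-flat (high (replace del _)) h = All.map⁺ (All.map
    (λ (s , t) → Flat-⟪↦⟫ s , Flat-⟪↦⟫ t) (proj₂ (∋-All⁻ Product.swap del h)))
  step-flat (high (decompose del d)) h with hq , h₀ ← ∋-All⁻ Product.swap del h =
    All.++⁺ (Decompose-flat d hq) h₀
  step-flat (high (elimFP _ Γ↭ _ _)) h = All.tail (All-resp-↭ Γ↭ h)
  step-flat (low _ (mms {π₁ = π₁} {π₂} del₁ del₂ _ _ d)) h
    with hq₁@(_ , he₁) , h₁ ← ∋-All⁻ Product.swap del₁ h
    with (_ , he₂) , h₀ ← ∋-All⁻ Product.swap del₂ h₁ =
    hq₁ ∷ All.++⁺ (decomposed-flat d (Flat-· (π₁ ⁻¹) he₁ , Flat-· (π₂ ⁻¹) he₂)) h₀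
    where
    decomposed-flat : ∀ {q Δ N} → Decompose? q Δ N → FlatEqn q → All FlatEqn Δ
    decomposed-flat (decomposed d)  hq = Decompose-flat d hq
    decomposed-flat (irreducible _) hq = hq ∷ []
  step-flat (low _ (fps {π = π} ps del _ _ _ _)) h with (_ , he) , h₀ ← ∋-All⁻ Product.swap del h =
    All.++⁺ (All.map⁺ (All.universal
      (λ (ϖ , ϖ′) → Flat-· (ϖ ⊙ π ⁻¹) he , Flat-· (ϖ′ ⊙ π ⁻¹) he) ps)) (All.++⁻ʳ _ h₀)
  step-flat (merge Γ↭ _ _ _) h = All.tail (All-resp-↭ Γ↭ h)

  -- Weights of equations

  width : Term → Maybe ℕ
  width (atom _)                 = just 0
  width (lam _ _)                = just 1
  width (fun f _)                = just (ar f)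
  width (letrec {n = n} _ _ _ _) = just (1 + n)
  width (susp _ _)               = nothing

  -- (MMS) may turn π·X ≐ e₂ into the equation e₁ ≐ e₂, or into as many
  -- equations between suspensions as e₂ has immediate subexpressions; both
  -- have to be lighter than π·X ≐ e₂.
  widthsWeight : Maybe ℕ → Maybe ℕ → ℕ
  widthsWeight nothing  nothing  = 1
  widthsWeight nothing  (just k) = 2 + k
  widthsWeight (just k) nothing  = 2 + k
  widthsWeight (just k) (just l) = 1 + (k ⊓ l)

  eqnWeight : Eqn → ℕ
  eqnWeight (s ≐ t) = widthsWeight (width s) (width t)

  weight : List Eqn → ℕ
  weight Γ = sum (List.map eqnWeight Γ)

  width-· : ∀ π e → width (π · e) ≡ width e
  width-· π (atom _)         = refl
  width-· π (lam _ _)        = refl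
  width-· π (fun _ _)        = refl
  width-· π (letrec _ _ _ _) = refl
  width-· π (susp _ _)       = refl

  NonSusp-width : ∀ {e} → NonSusp e → ∃ λ k → width e ≡ just k
  NonSusp-width {atom _}         _  = _ , refl
  NonSusp-width {lam _ _}        _  = _ , refl
  NonSusp-width {fun _ _}        _  = _ , refl
  NonSusp-width {letrec _ _ _ _} _  = _ , refl
  NonSusp-width {susp π X}       ns = contradiction refl (ns π X)

  eqnWeight-sym : ∀ s t → eqnWeight (s ≐ t) ≡ eqnWeight (t ≐ s)
  eqnWeight-sym s t with width s | width t
  ... | nothing | nothing = refl
  ... | nothing | just _  = refl
  ... | just _  | nothing = refl
  ... | just k  | just l  = cong (1 +_) (ℕ.⊓-comm k l)

  eqnWeight-positive : ∀ q → 1 ≤ eqnWeight q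
  eqnWeight-positive (s ≐ t) with width s | width t
  ... | nothing | nothing = s≤s z≤n
  ... | nothing | just _  = s≤s z≤n
  ... | just _  | nothing = s≤s z≤n
  ... | just _  | just _  = s≤s z≤n

  weight-↭ : ∀ {Γ Γ′} → Γ ↭ Γ′ → weight Γ ≡ weight Γ′
  weight-↭ Γ↭ = sum-↭ (↭.map⁺ eqnWeight Γ↭)

  weight-++ : ∀ Γ Γ′ → weight (Γ ++ Γ′) ≡ weight Γ + weight Γ′
  weight-++ Γ Γ′ = trans (cong sum (List.map-++ eqnWeight Γ Γ′)) (sum-++ (List.map eqnWeight Γ) _)

  weight-∋ : ∀ {Γ s t Γ₀} → Γ ∋ s ≐ t ∣ Γ₀ → weight Γ ≡ eqnWeight (s ≐ t) + weight Γ₀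
  weight-∋ (inj₁ Γ↭) = weight-↭ Γ↭
  weight-∋ {s = s} {t} {Γ₀} (inj₂ Γ↭) =
    trans (weight-↭ Γ↭) (cong (_+ weight Γ₀) (eqnWeight-sym t s))

  weight-suspensions : ∀ {Δ} → All SuspensionEqn Δ → weight Δ ≡ length Δ
  weight-suspensions []                  = refl
  weight-suspensions ((susp , susp) ∷ h) = cong (1 +_) (weight-suspensions h)

  Decompose-length : ∀ {s t Δ N} → Decompose (s ≐ t) Δ N →
                     width s ≡ just (length Δ) × width t ≡ just (length Δ)
  Decompose-length (fun {f} {ss} {ts}) = eq , eq
    where eq = cong just (sym (List.length-tabulate λ i → lookup ss i ≐ lookup ts i))
  Decompose-length lam      = refl , refl
  Decompose-length (lam≠ _) = refl , refl
  Decompose-length (letrec {ss = ss} {ts} ρ π _) = eq , eq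
    where eq = cong (λ k → just (1 + k)) (sym (List.length-tabulate λ i → lookup ss i ≐ π · lookup ts (ρ ⟨$⟩ʳ i)))

  weight-decreases-∋ : ∀ {Γ s t Γ₀ Δ} → Γ ∋ s ≐ t ∣ Γ₀ → weight Δ < eqnWeight (s ≐ t) →
                       weight (Δ ++ Γ₀) < weight Γ
  weight-decreases-∋ {Γ} {s} {t} {Γ₀} {Δ} del Δ< = begin-strict
    weight (Δ ++ Γ₀)                ≡⟨ weight-++ Δ Γ₀ ⟩
    weight Δ + weight Γ₀            <⟨ ℕ.+-monoˡ-< (weight Γ₀) Δ< ⟩
    eqnWeight (s ≐ t) + weight Γ₀   ≡⟨ weight-∋ del ⟨
    weight Γ                        ∎
    where open ℕ.≤-Reasoning

  eqnWeight-widths : ∀ {s t k l} → width s ≡ k → width t ≡ l → eqnWeight (s ≐ t) ≡ widthsWeight k l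
  eqnWeight-widths refl refl = refl

  Decompose-weight : ∀ {s t Δ N} → Decompose (s ≐ t) Δ N → FlatEqn (s ≐ t) →
                     weight Δ < eqnWeight (s ≐ t)
  Decompose-weight {s} {t} {Δ} d h with ws , wt ← Decompose-length d = begin-strict
    weight Δ                          ≡⟨ weight-suspensions (Decompose-suspensions d h) ⟩
    length Δ                          ≡⟨ ℕ.⊓-idem (length Δ) ⟨
    length Δ ⊓ length Δ               <⟨ ℕ.n<1+n _ ⟩
    1 + (length Δ ⊓ length Δ)         ≡⟨ eqnWeight-widths {s} {t} ws wt ⟨
    eqnWeight (s ≐ t)                 ∎
    where open ℕ.≤-Reasoning

  -- An irreducible pair may have sides of different width. The minimum in the weight of an equation
  -- between two compound terms bounds it by the width of e₂, the side whose equation is deleted.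
  mms-weight : ∀ {π₁ π₂ X e₁ e₂ Δ N} → Decompose? (π₁ ⁻¹ · e₁ ≐ π₂ ⁻¹ · e₂) Δ N →
               NonSusp e₁ → NonSusp e₂ → Flat e₁ → Flat e₂ → weight Δ < eqnWeight (susp π₂ X ≐ e₂)
  mms-weight {π₁} {π₂} {e₁ = e₁} {e₂} {Δ} d ns₁ ns₂ f₁ f₂
    with k₁ , w₁ ← NonSusp-width ns₁ | k₂ , w₂ ← NonSusp-width ns₂ = begin-strict
    weight Δ                                      ≤⟨ decomposed-weight d (Flat-· (π₁ ⁻¹) f₁ , Flat-· (π₂ ⁻¹) f₂) ⟩
    eqnWeight (π₁ ⁻¹ · e₁ ≐ π₂ ⁻¹ · e₂)           ≡⟨ eqnWeight-widths {π₁ ⁻¹ · e₁} {π₂ ⁻¹ · e₂}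
                                                       (trans (width-· (π₁ ⁻¹) e₁) w₁) (trans (width-· (π₂ ⁻¹) e₂) w₂) ⟩
    1 + (k₁ ⊓ k₂)                                 <⟨ s≤s (s≤s (ℕ.m⊓n≤n k₁ k₂)) ⟩
    2 + k₂                                        ≡⟨ cong (widthsWeight nothing) w₂ ⟨
    widthsWeight nothing (width e₂)               ∎
    where
    open ℕ.≤-Reasoning
    decomposed-weight : ∀ {q Δ N} → Decompose? q Δ N → FlatEqn q → weight Δ ≤ eqnWeight q
    decomposed-weight (decomposed d)      h = ℕ.<⇒≤ (Decompose-weight d h)
    decomposed-weight (irreducible {q} _) h = ℕ.≤-reflexive (ℕ.+-identityʳ (eqnWeight q))

  -- The weight is compared only for steps that bind no variable; a step that binds one may increase
  -- it and is counted by the variable that vanishes.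
  step-measure : ∀ {S S′} → S ⟶ S′ → All FlatEqn (State.Γ S) →
                 weight (State.Γ S′) < weight (State.Γ S) ⊎ Binds S S′
  step-measure (high (delete {e = e} {e′} del _)) h =
    inj₁ (weight-decreases-∋ {Δ = []} del (eqnWeight-positive (e ≐ e′)))
  step-measure (high (replace del X≢Y)) h = inj₂ (replace-binds del X≢Y)
  step-measure (high (decompose {Δ = Δ} del d)) h =
    inj₁ (weight-decreases-∋ {Δ = Δ} del (Decompose-weight d (proj₁ (∋-All⁻ Product.swap del h))))
  step-measure (high (elimFP {π = π} {π′} {X} ps Γ↭ _ _)) h =
    inj₁ (weight-decreases-∋ {Δ = []} (inj₁ Γ↭) (eqnWeight-positive (susp π X ≐ susp π′ X)))
  step-measure (low _ (mms {Γ} {Γ₁} {Γ₀} {π₁ = π₁} {π₂} {X} {e₁} {e₂} {Δ} del₁ del₂ ns₁ ns₂ d)) h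
    with (_ , f₁) , h₁ ← ∋-All⁻ Product.swap del₁ h
    with (_ , f₂) , _ ← ∋-All⁻ Product.swap del₂ h₁ = inj₁ (begin-strict
    eqnWeight (susp π₁ X ≐ e₁) + weight (Δ ++ Γ₀)  <⟨ ℕ.+-monoʳ-< (eqnWeight (susp π₁ X ≐ e₁))
      (weight-decreases-∋ {Δ = Δ} del₂ (mms-weight {π₁} {π₂} {X} d ns₁ ns₂ f₁ f₂)) ⟩
    eqnWeight (susp π₁ X ≐ e₁) + weight Γ₁          ≡⟨ weight-∋ del₁ ⟨
    weight Γ                                        ∎)
    where open ℕ.≤-Reasoning
  step-measure (low _ (fps ps del X∉Γ₀ X∉e _ _)) h = inj₂ (fps-binds ps del X∉Γ₀ X∉e)
  step-measure (merge {s = s} {t = t} Γ↭ _ _ _) h =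
    inj₁ (weight-decreases-∋ {Δ = []} (inj₁ Γ↭) (eqnWeight-positive (s ≐ t)))

  -- Membership in a generated permutation group

  open DecMembership _≟ᴬ_ using (_∈?_)

  support : Perm → List Atom
  support = concatMap λ (a , b) → a ∷ b ∷ []

  Supported : List Atom → Perm → Set
  Supported A π = ∀ c → c ∉ A → π $ c ≡ c

  support-supports : ∀ π → Supported (support π) π
  support-supports []            c c∉ = refl
  support-supports ((a , b) ∷ π) c c∉ =
    trans (cong (swap a b) (support-supports π c (c∉ ∘ there ∘ there)))
          (swap-minimal (c∉ ∘ here) (c∉ ∘ there ∘ here))

  Supported-⊆ : ∀ {A B π} → (∀ {c} → c ∈ A → c ∈ B) → Supported A π → Supported B π
  Supported-⊆ A⊆B h c c∉B = h c (c∉B ∘ A⊆B)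

  Supported-⊙ : ∀ {A π π′} → Supported A π → Supported A π′ → Supported A (π ⊙ π′)
  Supported-⊙ {π = π} {π′} h h′ c c∉ =
    trans (⊙-$ π π′ c) (trans (cong (π $_) (h′ c c∉)) (h c c∉))

  Supported-⁻¹ : ∀ {A π} → Supported A π → Supported A (π ⁻¹)
  Supported-⁻¹ {π = π} h c c∉ = sym ($-shift π (h c c∉))

  infix 4 _≈ₚ?_
  -- Permutations can differ only at atoms mentioned in one of their lists, a finite check.
  _≈ₚ?_ : ∀ π π′ → Dec (π ≈ₚ π′)
  π ≈ₚ? π′ with All.all? (λ c → (π $ c) ≟ᴬ (π′ $ c)) (support π ++ support π′)
  ... | no  differ = no λ eq → differ (All.universal eq _)
  ... | yes same   = yes λ c → agree-at c (c ∈? support π ++ support π′)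
    where
    agree-at : ∀ c → Dec (c ∈ support π ++ support π′) → π $ c ≡ π′ $ c
    agree-at c (yes c∈) = All.lookup same c∈
    agree-at c (no  c∉) = trans (support-supports π c (c∉ ∘ ∈.∈-++⁺ˡ))
      (sym (support-supports π′ c (c∉ ∘ ∈.∈-++⁺ʳ (support π))))

  permutationsOf : List Atom → List Perm
  permutationsOf []      = [ [] ]
  permutationsOf (a ∷ A) =
    concatMap (λ b → List.map ((a , b) ∷_) (permutationsOf A)) (a ∷ A)

  -- Composing π with the swapping of a and its image yields a permutation that fixes a, hence one
  -- supported by the rest of the list.
  permutationsOf-complete : ∀ A π → Supported A π → Any (π ≈ₚ_) (permutationsOf A)
  permutationsOf-complete [] π h = here λ c → h c λ ()
  permutationsOf-complete (a ∷ A) π h =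
    Any.concat⁺ (Any.map⁺ (Any.map (λ { refl → Any.map⁺ (Any.map (λ {ϖ} → prefixed ϖ) smaller) }) πa∈))
    where
    πa∈ : π $ a ∈ a ∷ A
    πa∈ with (π $ a) ∈? (a ∷ A)
    ... | yes πa∈ = πa∈
    ... | no  πa∉ = here ($-injective π (h (π $ a) πa∉))
    smaller : Any ((a , π $ a) ∷ π ≈ₚ_) (permutationsOf A)
    smaller = permutationsOf-complete A ((a , π $ a) ∷ π) fixes
      where
      fixes : Supported A ((a , π $ a) ∷ π)
      fixes c c∉ = by-cases (c ≟ᴬ a)
        where
        by-cases : Dec (c ≡ a) → swap a (π $ a) (π $ c) ≡ c
        by-cases (yes refl) = swapʳ a (π $ a)
        by-cases (no c≢a)   = trans (cong (swap a (π $ a)) πc≡c)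
          (swap-minimal c≢a λ c≡πa → c≢a ($-injective π (trans πc≡c c≡πa)))
          where
          πc≡c : π $ c ≡ c
          πc≡c = h c λ { (here c≡a) → c≢a c≡a ; (there c∈) → c∉ c∈ }
    prefixed : ∀ ϖ → (a , π $ a) ∷ π ≈ₚ ϖ → π ≈ₚ (a , π $ a) ∷ ϖ
    prefixed ϖ eq c = trans (sym (swap-involutive a (π $ a) (π $ c))) (cong (swap a (π $ a)) (eq c))

  ≈ₚ-sym : ∀ {π π′} → π ≈ₚ π′ → π′ ≈ₚ π
  ≈ₚ-sym eq c = sym (eq c)

  ≈ₚ-trans : ∀ {π π′ π″} → π ≈ₚ π′ → π′ ≈ₚ π″ → π ≈ₚ π″
  ≈ₚ-trans eq eq′ c = trans (eq c) (eq′ c)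

  ⟨⟩-mono : ∀ {G G′ π} → (∀ {ϖ} → ϖ ∈ G → ϖ ∈ G′) → ⟨ G ⟩ π → ⟨ G′ ⟩ π
  ⟨⟩-mono G⊆ (gen π∈)    = gen (G⊆ π∈)
  ⟨⟩-mono G⊆ ε           = ε
  ⟨⟩-mono G⊆ (mul p p′)  = mul (⟨⟩-mono G⊆ p) (⟨⟩-mono G⊆ p′)
  ⟨⟩-mono G⊆ (inv p)     = inv (⟨⟩-mono G⊆ p)
  ⟨⟩-mono G⊆ (resp eq p) = resp eq (⟨⟩-mono G⊆ p)

  module Generated (G : List Perm) where

    A : List Atom
    A = concatMap support G

    E : List Perm
    E = G ++ List.map _⁻¹ G

    infix 4 _∈≈_
    _∈≈_ : Perm → List Perm → Set
    π ∈≈ R = Any (π ≈ₚ_) R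

    -- Only left multiplication by generators and their inverses is tested; `⟨⟩-complete` extends it
    -- to the whole group.
    Closed : List Perm → Set
    Closed R = All (λ r → All (λ g → g ⊙ r ∈≈ R) E) R

    Element : Perm → Set
    Element π = ⟨ G ⟩ π × Supported A π

    E-elements : All Element E
    E-elements = All.++⁺ (All.tabulate λ g∈ → gen g∈ , supp g∈)
      (All.map⁺ (All.tabulate λ {g} g∈ → inv (gen g∈) , Supported-⁻¹ {π = g} (supp g∈)))
      where
      supp : ∀ {g} → g ∈ G → Supported A g
      supp {g} g∈ = Supported-⊆ {π = g} (λ c∈ → ∈.∈-concat⁺′ c∈ (∈.∈-map⁺ support g∈))
                      (support-supports g)

    -- U lists the permutations that R may still be missing.
    saturate : ∀ n R U → length U ≤ n → All Element R → [] ∈≈ R →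
               (∀ π → Supported A π → π ∈≈ R ⊎ π ∈≈ U) →
               ∃ λ R′ → All Element R′ × [] ∈≈ R′ × Closed R′
    saturate n R U |U|≤n elements ε∈ covers
      with All.all? (λ r → All.all? (λ g → Any.any? (g ⊙ r ≈ₚ?_) R) E) R
    ... | yes closed = R , elements , ε∈ , closed
    ... | no ¬closed
      with r , r∈ , ¬closed-r ← find (All.¬All⇒Any¬ (λ r → All.all? (λ g → Any.any? (g ⊙ r ≈ₚ?_) R) E) R ¬closed)
      with g , g∈ , x∉R ← find (All.¬All⇒Any¬ (λ g → Any.any? (g ⊙ r ≈ₚ?_) R) E ¬closed-r)
      = grow n |U|≤n
      where
      x = g ⊙ r
      Ex : Element x
      Ex with Gg , Sg ← All.lookup E-elements g∈ | Gr , Sr ← All.lookup elements r∈ =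
        mul Gg Gr , Supported-⊙ {π = g} {r} Sg Sr
      x∈U : x ∈≈ U
      x∈U with covers x (proj₂ Ex)
      ... | inj₁ x∈R = contradiction x∈R x∉R
      ... | inj₂ x∈U = x∈U
      other? = λ u → ¬? (x ≈ₚ? u)
      U′ = filter other? U
      -- The new element x is itself represented in U, so filtering drops at least one entry, and
      -- the bound n can decrease with U.
      U′<U : length U′ < length U
      U′<U = List.filter-notAll other? U (Any.map (λ x≈u x≉u → x≉u x≈u) x∈U)
      covers′ : ∀ π → Supported A π → π ∈≈ x ∷ R ⊎ π ∈≈ U′
      covers′ π Sπ with covers π Sπ
      ... | inj₁ π∈R = inj₁ (there π∈R)
      ... | inj₂ π∈U with u , u∈ , π≈u ← find π∈U with x ≈ₚ? u
      ...   | yes x≈u = inj₁ (here (≈ₚ-trans {π} {u} {x} π≈u (≈ₚ-sym {x} {u} x≈u)))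
      ...   | no  x≉u = inj₂ (lose (∈.∈-filter⁺ other? u∈ x≉u) π≈u)
      grow : ∀ n → length U ≤ n → ∃ λ R′ → All Element R′ × [] ∈≈ R′ × Closed R′
      grow ℕ.zero    |U|≤n = contradiction (ℕ.≤-trans U′<U |U|≤n) λ ()
      grow (ℕ.suc m) |U|≤n =
        saturate m (x ∷ R) U′ (s≤s⁻¹ (ℕ.≤-trans U′<U |U|≤n)) (Ex ∷ elements) (there ε∈) covers′

    elements : ∃ λ R → All Element R × [] ∈≈ R × Closed R
    elements = saturate _ [ [] ] (permutationsOf A) ℕ.≤-refl ((ε , λ _ _ → refl) ∷ []) (here λ _ → refl)
      λ π Sπ → inj₂ (permutationsOf-complete A π Sπ)

    R = proj₁ elements

    R-closed : ∀ {g x} → g ∈ E → x ∈≈ R → g ⊙ x ∈≈ R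
    R-closed {g} {x} g∈ x∈ with r , r∈ , x≈r ← find x∈ =
      Any.map (λ {y} gr≈y → ≈ₚ-trans {g ⊙ x} {g ⊙ r} {y} (≈ₚ-⊙ {g} {g} {x} {r} (λ _ → refl) x≈r) gr≈y)
        (All.lookup (All.lookup (proj₂ (proj₂ (proj₂ elements))) r∈) g∈)

    ∈≈-resp : ∀ π π′ → π ≈ₚ π′ → π ∈≈ R → π′ ∈≈ R
    ∈≈-resp π π′ eq = Any.map λ {r} π≈r → ≈ₚ-trans {π′} {π} {r} (≈ₚ-sym {π} {π′} eq) π≈r

    -- Acting on an arbitrary x of R lets products act one factor at a time, and treating π and its
    -- inverse together handles `inv`. Taking the identity for x shows that R exhausts the group.
    ⟨⟩-complete : ∀ {π} → ⟨ G ⟩ π → ∀ {x} → x ∈≈ R → π ⊙ x ∈≈ R × π ⁻¹ ⊙ x ∈≈ R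
    ⟨⟩-complete (gen π∈) x∈ =
      R-closed (∈.∈-++⁺ˡ π∈) x∈ , R-closed (∈.∈-++⁺ʳ G (∈.∈-map⁺ _⁻¹ π∈)) x∈
    ⟨⟩-complete ε x∈ = x∈ , x∈
    ⟨⟩-complete (mul {π} {π′} p p′) {x} x∈ =
      subst (_∈≈ R) (sym (List.++-assoc π π′ x)) (proj₁ (⟨⟩-complete p (proj₁ (⟨⟩-complete p′ x∈)))) ,
      subst (_∈≈ R) (sym (trans (cong (_++ x) (List.reverse-++ π π′)) (List.++-assoc (π′ ⁻¹) (π ⁻¹) x)))
        (proj₂ (⟨⟩-complete p′ (proj₂ (⟨⟩-complete p x∈))))
    ⟨⟩-complete (inv {π} p) {x} x∈ = proj₂ (⟨⟩-complete p x∈) ,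
      subst (λ ϖ → ϖ ⊙ x ∈≈ R) (sym (List.reverse-involutive π)) (proj₁ (⟨⟩-complete p x∈))
    ⟨⟩-complete (resp {π} {π′} eq p) {x} x∈ =
      ∈≈-resp (π ⊙ x) (π′ ⊙ x) (≈ₚ-⊙ {π} {π′} {x} {x} eq λ _ → refl) (proj₁ (⟨⟩-complete p x∈)) ,
      ∈≈-resp (π ⁻¹ ⊙ x) (π′ ⁻¹ ⊙ x) (≈ₚ-⊙ {π ⁻¹} {π′ ⁻¹} {x} {x} eq⁻¹ λ _ → refl) (proj₂ (⟨⟩-complete p x∈))
      where
      eq⁻¹ : π ⁻¹ ≈ₚ π′ ⁻¹
      eq⁻¹ c = $-shift π′ (trans (sym (eq (π ⁻¹ $ c))) ($-⁻¹ π c))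

    member? : ∀ π → Dec (⟨ G ⟩ π)
    member? π with Any.any? (π ≈ₚ?_) R
    ... | yes π∈ with r , r∈ , π≈r ← find π∈ =
      yes (resp (≈ₚ-sym {π} {r} π≈r) (proj₁ (All.lookup (proj₁ (proj₂ elements)) r∈)))
    ... | no π∉ = no λ p → π∉ (subst (_∈≈ R) (List.++-identityʳ π)
                              (proj₁ (⟨⟩-complete p (proj₁ (proj₂ (proj₂ elements))))))

  -- Progress

  -- The last rule of the ground derivation excludes a clash and, for letrec, supplies both the
  -- pairing ρ and the renaming. Two equal atoms remain as the one case without decomposition.
  decompose-complete : ∀ {τ} s t → NonSusp s → NonSusp t → τ ⊨ (s ≐ t) →
    (∃₂ λ Δ N → Decompose (s ≐ t) Δ N × All (τ ⊨_) Δ × All (τ ⊨ᶠ_) N) ⊎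
    (∃ λ a → s ≡ atom a × t ≡ atom a)
  decompose-complete (susp π X) t ns _ _ = contradiction refl (ns π X)
  decompose-complete s (susp π X) _ ns _ = contradiction refl (ns π X)
  decompose-complete (atom a) (atom .a) _ _ atom = inj₂ (a , refl , refl)
  decompose-complete {τ} (lam a s) (lam b t) _ _ h with a# , s∼ ← lam-elim h with a ≟ᴬ b
  ... | yes refl = inj₁ (_ , _ , lam , subst (s ⟪ τ ⟫ ∼_) ([aa]-· a (t ⟪ τ ⟫)) s∼ ∷ [] , [])
  ... | no  a≢b  = inj₁ (_ , _ , lam≠ a≢b ,
    subst (s ⟪ τ ⟫ ∼_) (sym (·-⟪⟫ [ a , b ] τ t)) s∼ ∷ [] , simplify-complete a t (a# ∘ lam a≢b))
  decompose-complete {τ} (fun f ss) (fun .f ts) _ _ (fun h) = inj₁ (_ , _ , fun , All.tabulate⁺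
    (λ i → subst₂ _∼_ (lookup-⟪⟫* τ ss i) (lookup-⟪⟫* τ ts i) (h i)) , [])
  decompose-complete {τ} (letrec as u ss r) (letrec bs v ts r′) _ _ (letrec ρ π m fresh ss∼ r∼) =
    inj₁ (_ , _ , letrec ρ π m ,
      subst (r ⟪ τ ⟫ ∼_) (sym (·-⟪⟫ π τ r′)) r∼ ∷
      All.tabulate⁺ (λ i → subst₂ _∼_ (lookup-⟪⟫* τ ss i)
        (trans (cong (π ·_) (lookup-⟪⟫* τ ts (ρ ⟨$⟩ʳ i))) (sym (·-⟪⟫ π τ (lookup ts (ρ ⟨$⟩ʳ i)))))
        (ss∼ i)) ,
      All.concat⁺ (All.map⁺ (All.tabulate fresh-binder)))
    where
    fresh-binder : ∀ {a} → a ∈ toList as → All (τ ⊨ᶠ_) (simplify a (letrec bs v ts r′))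
    fresh-binder a∈ with i , refl ← ∈-index (VecMem.∈-toList⁻ a∈) =
      simplify-complete (lookup as i) (letrec bs v ts r′) (fresh i)

  decompose?-complete : ∀ {τ} s t → NonSusp s → NonSusp t → τ ⊨ (s ≐ t) →
    ∃₂ λ Δ N → Decompose? (s ≐ t) Δ N × All (τ ⊨_) Δ × All (τ ⊨ᶠ_) N
  decompose?-complete s t ns nt h with decompose-complete s t ns nt h
  ... | inj₁ (Δ , N , d , hΔ , hN) = Δ , N , decomposed d , hΔ , hN
  ... | inj₂ (a , refl , refl)     = _ , _ , irreducible (λ ()) , h ∷ [] , []

  NonSusp-· : ∀ π {e} → NonSusp e → NonSusp (π · e)
  NonSusp-· π {susp ϖ X} ns _ _ _ = ns ϖ X refl
  NonSusp-· π {atom _}         ns _ _ ()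
  NonSusp-· π {lam _ _}        ns _ _ ()
  NonSusp-· π {fun _ _}        ns _ _ ()
  NonSusp-· π {letrec _ _ _ _} ns _ _ ()

  data View : Term → Set where
    susp  : ∀ π X → View (susp π X)
    compound : ∀ {e} → NonSusp e → View e

  view : ∀ e → View e
  view (atom a)           = compound λ _ _ ()
  view (lam a e)          = compound λ _ _ ()
  view (fun f es)         = compound λ _ _ ()
  view (letrec as u es e) = compound λ _ _ ()
  view (susp π X)         = susp π X

  -- The equations to which none of (1)-(6) applies. Membership in Γ is oriented, so a binding needs
  -- both orientations.
  data Normal : Eqn → Set where
    fixpoint : ∀ {π π′ X} → ¬ π ≈ₚ π′ → Normal (susp π X ≐ susp π′ X)
    bindˡ    : ∀ {π X e} → NonSusp e → Normal (susp π X ≐ e)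
    bindʳ    : ∀ {π X e} → NonSusp e → Normal (e ≐ susp π X)

  Normal-sym : ∀ {s t} → Normal (s ≐ t) → Normal (t ≐ s)
  Normal-sym (fixpoint {π} {π′} π≉π′) = fixpoint (π≉π′ ∘ ≈ₚ-sym {π′} {π})
  Normal-sym (bindˡ ns)      = bindʳ ns
  Normal-sym (bindʳ ns)      = bindˡ ns

  ∈⇒↭ : ∀ {A : Set} {x : A} {xs} → x ∈ xs → ∃ λ ys → xs ↭ x ∷ ys
  ∈⇒↭ x∈ with ys , zs , refl ← ∈.∈-∃++ x∈ = ys ++ zs , ↭.shift _ ys zs

  -- With steps for `A`, this turns local progress into a global alternative: some step exists, or
  -- every equation has the property that rules out such steps.
  search : ∀ {A : Set} {P : Eqn → Set} Γ → (∀ {q} → q ∈ Γ → A ⊎ P q) → A ⊎ All P Γ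
  search []      f = inj₂ []
  search (q ∷ Γ) f with f (here refl) | search Γ (f ∘ there)
  ... | inj₁ a | _       = inj₁ a
  ... | inj₂ _ | inj₁ a  = inj₁ a
  ... | inj₂ p | inj₂ ps = inj₂ (p ∷ ps)

  Step : GroundSubst → State → Set
  Step τ S = ∃ λ S′ → S ⟶ S′ × Sat τ S′

  module _ {τ Γ ∇ θ} (sat : Sat τ ⟨ Γ , ∇ , θ ⟩ₛ) where

    normalize : ∀ {q} → q ∈ Γ → Step τ ⟨ Γ , ∇ , θ ⟩ₛ ⊎ Normal q
    normalize {s ≐ t} q∈ with Γ₀ , Γ↭ ← ∈⇒↭ q∈
      with s∼t ∷ h₀ ← All-resp-↭ Γ↭ (Sat.eqns sat) with view s | view t
    ... | susp π X  | compound ns  = inj₂ (bindˡ ns)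
    ... | compound ns  | susp π X  = inj₂ (bindʳ ns)
    ... | compound ns  | compound nt  with decompose-complete s t ns nt s∼t
    ...   | inj₁ (Δ , N , d , hΔ , hN) = inj₁ (_ , high (decompose (inj₁ Γ↭) d) , record
            { eqns = All.++⁺ hΔ h₀ ; fresh = All.++⁺ hN (Sat.fresh sat) ; binds = Sat.binds sat })
    ...   | inj₂ (a , refl , refl)     = inj₁ (_ , high (delete (inj₁ Γ↭) atom) , Sat-eqns h₀ sat)
    normalize q∈ | susp π X | susp π′ Y with X ≟ⱽ Y
    ...   | no X≢Y = inj₁ (_ , high (replace (inj₁ Γ↭) X≢Y) , record
            { eqns  = replaceEqns-complete X∼ h₀
            ; fresh = replaceFreshness-complete X∼ (Sat.fresh sat)
            ; binds = All.++⁺ (Sat.binds sat) (X∼ ∷ []) })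
            where
            X∼ : τ X ∼ (π ⁻¹ ⊙ π′) · τ Y
            X∼ = ∼-trans (∼-move π s∼t) (∼-reflexive (sym (⊙-· (π ⁻¹) π′ (τ Y))))
    ...   | yes refl with π ≈ₚ? π′
    ...     | yes π≈π′ = inj₁ (_ , high (delete (inj₁ Γ↭) (susp π≈π′)) , Sat-eqns h₀ sat)
    ...     | no  π≉π′ = inj₂ (fixpoint π≉π′)

  fixpoints : Var → List (Perm × Perm) → List Eqn
  fixpoints X = List.map λ (π , π′) → susp π X ≐ susp π′ X

  quotients : List (Perm × Perm) → List Perm
  quotients = List.map λ (π , π′) → π ⁻¹ ⊙ π′

  -- All fixpoint equations of X at once: the largest choice of generators for (ElimFP), and exactly
  -- the group that (FPS) has to rewrite.
  FixpointSplit : Var → List Eqn → Set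
  FixpointSplit X Γ = ∃₂ λ ps Γ₀ →
    Γ ↭ fixpoints X ps ++ Γ₀ × All (λ q → ∀ π π′ → q ≢ (susp π X ≐ susp π′ X)) Γ₀

  split-fixpoints : ∀ X {Γ} → All Normal Γ → FixpointSplit X Γ
  split-fixpoints X [] = [] , [] , ↭-refl , []
  split-fixpoints X (_∷_ {q} {Γ} n ns) with ps , Γ₀ , Γ↭ , others ← split-fixpoints X ns = classify n
    where
    skip : (∀ π π′ → q ≢ (susp π X ≐ susp π′ X)) → FixpointSplit X (q ∷ Γ)
    skip q≢ = ps , q ∷ Γ₀ , ↭-trans (↭.++⁺ˡ [ q ] Γ↭) (↭-sym (↭.shift q (fixpoints X ps) Γ₀)) , q≢ ∷ others
    classify : Normal q → FixpointSplit X (q ∷ Γ)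
    classify (bindˡ ns) = skip λ { _ π′ refl → ns π′ X refl }
    classify (bindʳ ns) = skip λ { π _ refl → ns π X refl }
    classify (fixpoint {π} {π′} {Y} _) with Y ≟ⱽ X
    ... | yes refl = (π , π′) ∷ ps , Γ₀ , ↭.++⁺ˡ [ q ] Γ↭ , others
    ... | no  Y≢X  = skip λ { _ _ refl → Y≢X refl }

  -- Quantifies over every remainder and every list of generators because (ElimFP) is free to choose
  -- both.
  Irredundant : List Eqn → Eqn → Set
  Irredundant Γ q = ∀ {π π′ X Γ₀} ps → q ≡ (susp π X ≐ susp π′ X) → Γ ↭ q ∷ Γ₀ →
    All (_∈ Γ₀) (fixpoints X ps) → ¬ ⟨ quotients ps ⟩ (π ⁻¹ ⊙ π′)

  module _ {τ Γ ∇ θ} (sat : Sat τ ⟨ Γ , ∇ , θ ⟩ₛ) (normal : All Normal Γ) where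

    eliminate : ∀ {q} → q ∈ Γ → Step τ ⟨ Γ , ∇ , θ ⟩ₛ ⊎ Irredundant Γ q
    eliminate q∈ with All.lookup normal q∈ | ∈⇒↭ q∈
    ... | bindˡ ns | _ = inj₂ λ { {π′ = π′} {X} _ refl → contradiction refl (ns π′ X) }
    ... | bindʳ ns | _ = inj₂ λ { {π} {X = X} _ refl → contradiction refl (ns π X) }
    ... | fixpoint {π} {π′} {X} _ | Γ₀ , Γ↭
      with ps , Γ₁ , Γ₀↭ , others ← split-fixpoints X (All.tail (All-resp-↭ Γ↭ normal))
      with Generated.member? (quotients ps) (π ⁻¹ ⊙ π′)
    ... | yes p = inj₁ (_ , high (elimFP ps Γ↭ ps∈ p) , Sat-eqns (All.tail (All-resp-↭ Γ↭ (Sat.eqns sat))) sat)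
      where
      ps∈ : All (λ (ϖ , ϖ′) → (susp ϖ X ≐ susp ϖ′ X) ∈ Γ₀) ps
      ps∈ = All.tabulate λ p∈ →
        ∈-resp-↭ (↭-sym Γ₀↭) (∈.∈-++⁺ˡ (∈.∈-map⁺ (λ (ϖ , ϖ′) → susp ϖ X ≐ susp ϖ′ X) p∈))
    -- The test was made with all other fixpoint equations of X, so a negative answer covers every
    -- smaller choice by monotonicity of the generated group.
    ... | no ¬p = inj₂ irredundant
      where
      irredundant : Irredundant Γ (susp π X ≐ susp π′ X)
      irredundant {Γ₀ = Γ₀′} ps′ refl Γ↭′ ps′∈ p = ¬p (⟨⟩-mono quotients⊆ p)
        where
        Γ₀′↭ : Γ₀′ ↭ fixpoints X ps ++ Γ₁
        Γ₀′↭ = ↭-trans (drop-∷ (↭-trans (↭-sym Γ↭′) Γ↭)) Γ₀↭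
        pairs⊆ : ∀ {ϖ ϖ′} → (ϖ , ϖ′) ∈ ps′ → (ϖ , ϖ′) ∈ ps
        pairs⊆ {ϖ} {ϖ′} p∈ with ∈.∈-++⁻ (fixpoints X ps) (∈-resp-↭ Γ₀′↭ (All.lookup (All.map⁻ ps′∈) p∈))
        ... | inj₁ q∈ with _ , p∈ps , refl ← ∈.∈-map⁻ (λ (ϖ , ϖ′) → susp ϖ X ≐ susp ϖ′ X) q∈ = p∈ps
        ... | inj₂ q∈ = contradiction refl (All.lookup others q∈ ϖ ϖ′)
        quotients⊆ : ∀ {ϖ} → ϖ ∈ quotients ps′ → ϖ ∈ quotients ps
        quotients⊆ ϖ∈ with p′ , p∈ , refl ← ∈.∈-map⁻ (λ (ϖ , ϖ′) → ϖ ⁻¹ ⊙ ϖ′) ϖ∈ =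
          ∈.∈-map⁺ (λ (ϖ , ϖ′) → ϖ ⁻¹ ⊙ ϖ′) (pairs⊆ p∈)

  no-high-step : ∀ {Γ ∇ θ} → All Normal Γ → All (Irredundant Γ) Γ →
                 ¬ (∃ λ S → ⟨ Γ , ∇ , θ ⟩ₛ ⟶¹ S)
  no-high-step normal irr (_ , delete del e≋e′) with proj₁ (∋-All⁻ Normal-sym del normal) | e≋e′
  ... | fixpoint π≉π′ | susp π≈π′ = π≉π′ π≈π′
  ... | bindˡ ns      | susp _    = ns _ _ refl
  ... | bindʳ ns      | susp _    = ns _ _ refl
  no-high-step normal irr (_ , replace del X≢Y) with proj₁ (∋-All⁻ Normal-sym del normal)
  ... | fixpoint _ = X≢Y refl
  ... | bindˡ ns   = ns _ _ refl
  ... | bindʳ ns   = ns _ _ refl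
  no-high-step normal irr (_ , decompose del d) with proj₁ (∋-All⁻ Normal-sym del normal)
  no-high-step normal irr (_ , decompose del ()) | fixpoint _
  no-high-step normal irr (_ , decompose del ()) | bindˡ _
  no-high-step normal irr (_ , decompose del ()) | bindʳ _
  no-high-step normal irr (_ , elimFP ps Γ↭ ps∈ p) =
    All.lookup irr (∈-resp-↭ (↭-sym Γ↭) (here refl)) ps refl Γ↭ (All.map⁺ ps∈) p

  -- Depth of ground expressions and absence of cycles

  mutual
    depth : Ground → ℕ
    depth (atom a)           = 0
    depth (lam a e)          = 1 + depth e
    depth (fun f es)         = 1 + depth* es
    depth (letrec as u es e) = 1 + (depth* es ⊔ depth e)

    depth* : ∀ {n} → Vec Ground n → ℕ
    depth* []       = 0
    depth* (e ∷ es) = depth e ⊔ depth* es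

  depth-lookup : ∀ {n} (es : Vec Ground n) i → depth (lookup es i) ≤ depth* es
  depth-lookup (e ∷ es) zero    = ℕ.m≤m⊔n _ _
  depth-lookup (e ∷ es) (suc i) = ℕ.≤-trans (depth-lookup es i) (ℕ.m≤n⊔m (depth e) _)

  depth*-least : ∀ {n} (es : Vec Ground n) {k} → (∀ i → depth (lookup es i) ≤ k) → depth* es ≤ k
  depth*-least []       h = z≤n
  depth*-least (e ∷ es) h = ℕ.⊔-lub (h zero) (depth*-least es (h ∘ suc))

  depth-·-≤ : ∀ π e → depth (π · e) ≤ depth e
  depth-·-≤ π = elim _ (λ _ → z≤n) (λ _ _ → s≤s) (λ f es ih → s≤s (each es ih))
    (λ as u es e ihs ih → s≤s (ℕ.⊔-mono-≤ (each es ihs) ih)) (λ _ ())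
    where
    each : ∀ {n} (es : Vec Ground n) → (∀ i → depth (π · lookup es i) ≤ depth (lookup es i)) →
           depth* (π ·* es) ≤ depth* es
    each es ih = depth*-least (π ·* es) λ i →
      subst (λ e → depth e ≤ depth* es) (sym (lookup-·* π es i)) (ℕ.≤-trans (ih i) (depth-lookup es i))

  depth-· : ∀ π e → depth (π · e) ≡ depth e
  depth-· π e = ℕ.≤-antisym (depth-·-≤ π e)
    (subst (λ e′ → depth e′ ≤ depth (π · e)) (⁻¹-· π e) (depth-·-≤ (π ⁻¹) (π · e)))

  -- For a maximum over children it suffices that each left child has some right counterpart, so the
  -- reordering of bindings needs no bookkeeping. Symmetry gives the converse.
  depth-∼-≤ : ∀ {e e′} → e ∼ e′ → depth e ≤ depth e′
  depth-∼-≤ atom = z≤n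
  depth-∼-≤ (fun {es = es} {es′} h) =
    s≤s (depth*-least es λ i → ℕ.≤-trans (depth-∼-≤ (h i)) (depth-lookup es′ i))
  depth-∼-≤ (lam e∼e′) = s≤s (depth-∼-≤ e∼e′)
  depth-∼-≤ (lam≠ {a} {b} {e′ = e′} _ e∼) = s≤s (ℕ.≤-trans (depth-∼-≤ e∼) (depth-·-≤ [ a , b ] e′))
  depth-∼-≤ (letrec {ss = ss} {ts} {r′ = r′} ρ π _ _ ss∼ r∼) = s≤s (ℕ.⊔-mono-≤
    (depth*-least ss λ i → ℕ.≤-trans (depth-∼-≤ (ss∼ i))
      (ℕ.≤-trans (depth-·-≤ π (lookup ts (ρ ⟨$⟩ʳ i))) (depth-lookup ts (ρ ⟨$⟩ʳ i))))
    (ℕ.≤-trans (depth-∼-≤ r∼) (depth-·-≤ π r′)))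

  depth-∼ : ∀ {e e′} → e ∼ e′ → depth e ≡ depth e′
  depth-∼ e∼e′ = ℕ.≤-antisym (depth-∼-≤ e∼e′) (depth-∼-≤ (∼-sym e∼e′))

  Var-depth : ∀ {τ : GroundSubst} {X} e → X ∈Var e → depth (τ X) ≤ depth (e ⟪ τ ⟫)
  Var-depth {τ} {X} = elim _ (λ _ ())
    (λ { a e ih (lam p) → ℕ.m≤n⇒m≤1+n (ih p) })
    (λ { f es ih (fun i p) → ℕ.m≤n⇒m≤1+n (each es ih i p) })
    (λ { as u es e ihs ih (rhs i p)  → ℕ.m≤n⇒m≤1+n (ℕ.≤-trans (each es ihs i p) (ℕ.m≤m⊔n _ _))
       ; as u es e ihs ih (inExpr p) → ℕ.m≤n⇒m≤1+n (ℕ.≤-trans (ih p) (ℕ.m≤n⊔m (depth* (es ⟪ τ ⟫*)) _)) })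
    (λ { π X susp → ℕ.≤-reflexive (sym (depth-· π (τ X))) })
    where
    each : ∀ {n} (es : Vec Term n) →
           (∀ i → X ∈Var lookup es i → depth (τ X) ≤ depth (lookup es i ⟪ τ ⟫)) →
           ∀ i → X ∈Var lookup es i → depth (τ X) ≤ depth* (es ⟪ τ ⟫*)
    each es ih i p = ℕ.≤-trans (ih i p)
      (subst (λ e → depth e ≤ depth* (es ⟪ τ ⟫*)) (lookup-⟪⟫* τ es i) (depth-lookup (es ⟪ τ ⟫*) i))

  Var-depth-< : ∀ {τ : GroundSubst} {X e} → NonSusp e → X ∈Var e → depth (τ X) < depth (e ⟪ τ ⟫)
  Var-depth-< ns (lam p) = s≤s (Var-depth _ p)
  Var-depth-< {τ} ns (fun {es = es} i p) = s≤s (ℕ.≤-trans (Var-depth _ p)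
    (subst (λ e → depth e ≤ depth* (es ⟪ τ ⟫*)) (lookup-⟪⟫* τ es i) (depth-lookup (es ⟪ τ ⟫*) i)))
  Var-depth-< {τ} ns (rhs {es = es} i p) = s≤s (ℕ.≤-trans (Var-depth _ p) (ℕ.≤-trans
    (subst (λ e → depth e ≤ depth* (es ⟪ τ ⟫*)) (lookup-⟪⟫* τ es i) (depth-lookup (es ⟪ τ ⟫*) i))
    (ℕ.m≤m⊔n _ _)))
  Var-depth-< {τ} ns (inExpr {es = es} p) =
    s≤s (ℕ.≤-trans (Var-depth _ p) (ℕ.m≤n⊔m (depth* (es ⟪ τ ⟫*)) _))
  Var-depth-< ns (susp {π}) = contradiction refl (ns π _)

  Var-depth-bind : ∀ {τ : GroundSubst} {π X e Y} → π · τ X ∼ e ⟪ τ ⟫ → NonSusp e → Y ∈Var e →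
                   depth (τ Y) < depth (τ X)
  Var-depth-bind {τ} {π} {X} X∼e ns Y∈ =
    subst (_ <_) (trans (sym (depth-∼ X∼e)) (depth-· π (τ X))) (Var-depth-< ns Y∈)

  -- Along `_⊢_⊳_` the depth of the value under τ strictly decreases.
  acyclic : ∀ {τ Γ} → All (τ ⊨_) Γ → ¬ Cycle Γ
  acyclic {τ} {Γ} sat (X , X⊳⁺X) = ℕ.<-irrefl refl (descends X⊳⁺X)
    where
    descend : ∀ {X Y} → Γ ⊢ X ⊳ Y → depth (τ Y) < depth (τ X)
    descend {X} (π , s , inj₁ q∈ , ns , Y∈) = Var-depth-bind {τ} {π} {X} (All.lookup sat q∈) ns Y∈
    descend {X} (π , s , inj₂ q∈ , ns , Y∈) = Var-depth-bind {τ} {π} {X} (∼-sym (All.lookup sat q∈)) ns Y∈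
    descends : ∀ {X Y} → TransClosure (Γ ⊢_⊳_) X Y → depth (τ Y) < depth (τ X)
    descends [ X⊳Y ]⁺       = descend X⊳Y
    descends (X⊳Y ∷ Y⊳⁺Z) = ℕ.<-trans (descends Y⊳⁺Z) (descend X⊳Y)

  data Fixpoint : Eqn → Set where
    fixpoint : ∀ {π π′ X} → Fixpoint (susp π X ≐ susp π′ X)

  -- An equation of Γ, in the orientation π·X ≐ e with e not a suspension.
  record Binding (Γ : List Eqn) (q : Eqn) : Set where
    field
      {π}   : Perm
      {X}   : Var
      {e}   : Term
      ns    : NonSusp e
      other : List Eqn
      split : Γ ∋ susp π X ≐ e ∣ other
      keeps : Γ ↭ q ∷ other
      side  : q ≡ (susp π X ≐ e) ⊎ q ≡ (e ≐ susp π X)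

  binding : ∀ {Γ q} → q ∈ Γ → Normal q → Fixpoint q ⊎ Binding Γ q
  binding q∈ (fixpoint _) = inj₁ fixpoint
  binding q∈ (bindˡ ns) with Γ₀ , Γ↭ ← ∈⇒↭ q∈ = inj₂ record
    { ns = ns ; other = Γ₀ ; split = inj₁ Γ↭ ; keeps = Γ↭ ; side = inj₁ refl }
  binding q∈ (bindʳ ns) with Γ₀ , Γ↭ ← ∈⇒↭ q∈ = inj₂ record
    { ns = ns ; other = Γ₀ ; split = inj₂ Γ↭ ; keeps = Γ↭ ; side = inj₂ refl }

  maximum : ∀ {P Q : Eqn → Set} (f : Eqn → ℕ) Γ → (∀ {q} → q ∈ Γ → P q ⊎ Q q) →
            All P Γ ⊎ ∃ λ q → Q q × All (λ q′ → P q′ ⊎ f q′ ≤ f q) Γ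
  maximum f [] h = inj₁ []
  maximum f (q ∷ Γ) h with h (here refl) | maximum f Γ (h ∘ there)
  ... | inj₁ p | inj₁ ps              = inj₁ (p ∷ ps)
  ... | inj₁ p | inj₂ (q′ , qq , max) = inj₂ (q′ , qq , inj₁ p ∷ max)
  ... | inj₂ r | inj₁ ps              = inj₂ (q , r , inj₂ ℕ.≤-refl ∷ All.map inj₁ ps)
  ... | inj₂ r | inj₂ (q′ , qq , max) with ℕ.≤-total (f q) (f q′)
  ...   | inj₁ q≤q′ = inj₂ (q′ , qq , inj₂ q≤q′ ∷ max)
  ...   | inj₂ q′≤q = inj₂ (q , r , inj₂ ℕ.≤-refl ∷ All.map
            (λ { (inj₁ p) → inj₁ p ; (inj₂ ≤q′) → inj₂ (ℕ.≤-trans ≤q′ q′≤q) }) max)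

  -- The binding of a variable X with τ X of maximal depth is eliminated by
  -- (FPS), unless (MMS) applies to it: the variables of all the right-hand
  -- sides have values of smaller depth.
  progress : ∀ {τ Γ ∇ θ} → Sat τ ⟨ Γ , ∇ , θ ⟩ₛ →
             Step τ ⟨ Γ , ∇ , θ ⟩ₛ ⊎
             (All Fixpoint Γ × ¬ (∃ λ S → ⟨ Γ , ∇ , θ ⟩ₛ ⟶¹ S))
  progress {τ} {Γ} {∇} {θ} sat with search Γ (normalize sat)
  ... | inj₁ step = inj₁ step
  ... | inj₂ normal with search Γ (eliminate sat normal)
  ...   | inj₁ step = inj₁ step
  ...   | inj₂ irr with maximum eqnDepth Γ (λ q∈ → binding q∈ (All.lookup normal q∈))
    where
    -- Reading off the left side is harmless: τ satisfies the equation, so both sides have the same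
    -- depth, and either orientation yields that of the bound variable's value.
    eqnDepth : Eqn → ℕ
    eqnDepth (s ≐ t) = depth (s ⟪ τ ⟫)
  ...     | inj₁ all-fixpoints = inj₂ (all-fixpoints , no-high-step normal irr)
  ...     | inj₂ (q , b , max) = inj₁ (eliminate-binding (search other mms-or-rest))
    where
    open Binding b
    nohigh = no-high-step {∇ = ∇} {θ} normal irr
    π·X∼e = proj₁ (⊨-∋⁻ split (Sat.eqns sat))
    sat₀ = proj₂ (⊨-∋⁻ split (Sat.eqns sat))
    normal₀ = proj₂ (∋-All⁻ Normal-sym split normal)
    eqnDepth : Eqn → ℕ
    eqnDepth (s ≐ t) = depth (s ⟪ τ ⟫)
    depth-q : eqnDepth q ≡ depth (τ X)
    depth-q with side
    ... | inj₁ refl = depth-· π (τ X)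
    ... | inj₂ refl = trans (sym (depth-∼ π·X∼e)) (depth-· π (τ X))
    max₀ : All (λ q′ → Fixpoint q′ ⊎ eqnDepth q′ ≤ depth (τ X)) other
    max₀ = All.tail (All-resp-↭ keeps
      (subst (λ d → All (λ q′ → Fixpoint q′ ⊎ eqnDepth q′ ≤ d) Γ) depth-q max))

    Rest : Eqn → Set
    Rest q′ = Fixpoint q′ ⊎ ¬ X ∈VarEqn q′

    mms-step : ∀ {π₂ e₂ Γ₀} → other ∋ susp π₂ X ≐ e₂ ∣ Γ₀ → NonSusp e₂ → Step τ ⟨ Γ , ∇ , θ ⟩ₛ
    mms-step {π₂} {e₂} split₂ ns₂ with X∼e₂ , h₀ ← ⊨-∋⁻ split₂ sat₀
      with Δ , N , d , hΔ , hN ← decompose?-complete {τ} (π ⁻¹ · e) (π₂ ⁻¹ · e₂)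
        (NonSusp-· (π ⁻¹) ns) (NonSusp-· (π₂ ⁻¹) ns₂)
        (subst₂ _∼_ (sym (·-⟪⟫ (π ⁻¹) τ e)) (sym (·-⟪⟫ (π₂ ⁻¹) τ e₂))
          (∼-trans (∼-sym (∼-move π π·X∼e)) (∼-move π₂ X∼e₂)))
      = _ , low nohigh (mms split split₂ ns ns₂ d) , record
        { eqns = π·X∼e ∷ All.++⁺ hΔ h₀ ; fresh = All.++⁺ hN (Sat.fresh sat) ; binds = Sat.binds sat }

    X∉ : ∀ {e′} → NonSusp e′ → depth (e′ ⟪ τ ⟫) ≤ depth (τ X) → ¬ X ∈Var e′
    X∉ ns′ e′≤X X∈ = ℕ.<-irrefl refl (ℕ.<-≤-trans (Var-depth-< {τ} ns′ X∈) e′≤X)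

    mms-or-rest : ∀ {q′} → q′ ∈ other → Step τ ⟨ Γ , ∇ , θ ⟩ₛ ⊎ Rest q′
    mms-or-rest q′∈ with binding q′∈ (All.lookup normal₀ q′∈) | All.lookup max₀ q′∈
    ... | inj₁ fp | _        = inj₂ (inj₁ fp)
    ... | inj₂ _  | inj₁ fp  = inj₂ (inj₁ fp)
    ... | inj₂ b′  | inj₂ ≤X with Binding.X b′ ≟ⱽ X
    -- A second binding of X triggers (MMS). A binding of another variable cannot contain X: its
    -- right-hand side has a value at most as deep as that of X, while X would have to lie strictly
    -- deeper inside.
    ...   | yes refl = inj₁ (mms-step (Binding.split b′) (Binding.ns b′))
    ...   | no Y≢X with Binding.side b′ | proj₁ (⊨-∋⁻ (Binding.split b′) sat₀)
    ...     | inj₁ refl | Y∼e′ = inj₂ (inj₂ λ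
              { (left susp) → Y≢X refl
              ; (right X∈)  → X∉ (Binding.ns b′) (subst (_≤ _) (depth-∼ Y∼e′) ≤X) X∈ })
    ...     | inj₂ refl | _    = inj₂ (inj₂ λ
              { (left X∈)    → X∉ (Binding.ns b′) ≤X X∈
              ; (right susp) → Y≢X refl })

    eliminate-binding : Step τ ⟨ Γ , ∇ , θ ⟩ₛ ⊎ All Rest other → Step τ ⟨ Γ , ∇ , θ ⟩ₛ
    eliminate-binding (inj₁ step) = step
    eliminate-binding (inj₂ rest) with ps , Γ₀ , other↭ , others ← split-fixpoints X normal₀ =
      _ , low nohigh (fps ps (∋-resp split) X∉Γ₀ X∉e ns (acyclic {τ} (Sat.eqns sat))) , record
        { eqns  = All.++⁺ (All.map⁺ (All.map (λ { {ϖ , ϖ′} h →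
                    ∼-trans (⊙⁻¹-∼ τ π {X} e X∼ ϖ) (∼-trans h (∼-sym (⊙⁻¹-∼ τ π {X} e X∼ ϖ′))) })
                    (All.map⁻ (All.++⁻ˡ (fixpoints X ps) sat₁))))
                  (All.++⁻ʳ (fixpoints X ps) sat₁)
        ; fresh = Sat.fresh sat
        ; binds = All.++⁺ (Sat.binds sat) (X∼ ∷ []) }
      where
      sat₁ = All-resp-↭ other↭ sat₀
      X∼ : τ X ∼ (π ⁻¹ · e) ⟪ τ ⟫
      X∼ = subst (τ X ∼_) (sym (·-⟪⟫ (π ⁻¹) τ e)) (∼-move π π·X∼e)
      X∉e : ¬ X ∈Var e
      X∉e = X∉ ns (ℕ.≤-reflexive (trans (sym (depth-∼ π·X∼e)) (depth-· π (τ X))))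
      ∋-resp : Γ ∋ susp π X ≐ e ∣ other → Γ ∋ susp π X ≐ e ∣ (fixpoints X ps ++ Γ₀)
      ∋-resp (inj₁ Γ↭) = inj₁ (↭-trans Γ↭ (↭.++⁺ˡ [ _ ] other↭))
      ∋-resp (inj₂ Γ↭) = inj₂ (↭-trans Γ↭ (↭.++⁺ˡ [ _ ] other↭))
      outside : ∀ {q′} → Rest q′ × (∀ ϖ ϖ′ → q′ ≢ (susp ϖ X ≐ susp ϖ′ X)) → ¬ X ∈VarEqn q′
      outside (inj₂ X∉q′ , _) = X∉q′
      outside (inj₁ fixpoint , q′≢) (left susp)  = q′≢ _ _ refl
      outside (inj₁ fixpoint , q′≢) (right susp) = q′≢ _ _ refl
      X∉Γ₀ : ¬ X ∈VarEqns Γ₀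
      X∉Γ₀ = All.All¬⇒¬Any (All.map outside
        (All.zip (All.++⁻ʳ (fixpoints X ps) (All-resp-↭ other↭ rest) , others)))

  -- Flattening and completeness

  mutual
    vars : Term → List Var
    vars (atom a)           = []
    vars (lam a e)          = vars e
    vars (fun f es)         = vars* es
    vars (letrec as u es e) = vars* es ++ vars e
    vars (susp π X)         = [ X ]

    vars* : ∀ {n} → Vec Term n → List Var
    vars* []       = []
    vars* (e ∷ es) = vars e ++ vars* es

  ∈-vars : ∀ e → Vars (_∈ vars e) e
  ∈-vars = elim _ (λ _ _ ()) (λ { a e ih X (lam p) → ih X p })
    (λ { f es ih X (fun i p) → each es ih i p })
    (λ { as u es e ihs ih X (rhs i p)  → ∈.∈-++⁺ˡ (each es ihs i p)
       ; as u es e ihs ih X (inExpr p) → ∈.∈-++⁺ʳ (vars* es) (ih X p) })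
    (λ { π X _ susp → here refl })
    where
    each : ∀ {n} (es : Vec Term n) → (∀ i → Vars (_∈ vars (lookup es i)) (lookup es i)) →
           ∀ {X} i → X ∈Var lookup es i → X ∈ vars* es
    each (e ∷ es) ih zero    p = ∈.∈-++⁺ˡ (ih zero _ p)
    each (e ∷ es) ih (suc i) p = ∈.∈-++⁺ʳ (vars e) (each es (ih ∘ suc) i p)

  eqnsVars : List Eqn → List Var
  eqnsVars = concatMap λ (s ≐ t) → vars s ++ vars t

  ∈-eqnsVars : ∀ Γ → All (VarsEqn (_∈ eqnsVars Γ)) Γ
  ∈-eqnsVars Γ = All.tabulate λ { {s ≐ t} q∈ →
    (λ X p → weaken q∈ (∈.∈-++⁺ˡ (∈-vars s X p))) ,
    (λ X p → weaken q∈ (∈.∈-++⁺ʳ (vars s) (∈-vars t X p))) }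
    where
    weaken : ∀ {X s t} → (s ≐ t) ∈ Γ → X ∈ vars s ++ vars t → X ∈ eqnsVars Γ
    weaken q∈ X∈ = ∈.∈-concat⁺′ X∈ (∈.∈-map⁺ (λ (s ≐ t) → vars s ++ vars t) q∈)

  keys : Subst → List Var
  keys = List.map proj₁

  -- Freshness against the earlier keys, and not only against `Xs`, yields pairwise distinct names
  -- and, together with `Scoped`, triangularity.
  data FreshKeys (Xs : List Var) : Subst → Set where
    []  : FreshKeys Xs []
    add : ∀ {X t Δ} → X ∉ Xs → FreshKeys (X ∷ Xs) Δ → FreshKeys Xs ((X , t) ∷ Δ)

  FreshKeys-⊆ : ∀ {Xs Ys Δ} → (∀ {X} → X ∈ Xs → X ∈ Ys) → FreshKeys Ys Δ → FreshKeys Xs Δ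
  FreshKeys-⊆ Xs⊆Ys []           = []
  FreshKeys-⊆ Xs⊆Ys (add X∉ fr) = add (X∉ ∘ Xs⊆Ys)
    (FreshKeys-⊆ (λ { (here eq) → here eq ; (there p) → there (Xs⊆Ys p) }) fr)

  FreshKeys-++ : ∀ {Xs Δ Δ′} → FreshKeys Xs Δ → FreshKeys (keys Δ ++ Xs) Δ′ → FreshKeys Xs (Δ ++ Δ′)
  FreshKeys-++ []                        fr′ = fr′
  FreshKeys-++ {Δ = (X , _) ∷ Δ} (add X∉ fr) fr′ = add X∉ (FreshKeys-++ fr (FreshKeys-⊆ move fr′))
    where
    move : ∀ {Y Xs} → Y ∈ keys Δ ++ X ∷ Xs → Y ∈ X ∷ keys Δ ++ Xs
    move = ∈-resp-↭ (↭.shift X (keys Δ) _)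

  FreshKeys-∉ : ∀ {Xs Δ} → FreshKeys Xs Δ → All (λ (X , _) → X ∉ Xs) Δ
  FreshKeys-∉ []          = []
  FreshKeys-∉ (add X∉ fr) = X∉ ∷ All.map (λ Y∉ → Y∉ ∘ there) (FreshKeys-∉ fr)

  FreshKeys-unique : ∀ {Xs Δ} → FreshKeys Xs Δ → ListUnique.Unique (keys Δ)
  FreshKeys-unique []         = []
  FreshKeys-unique (add _ fr) =
    All.map⁺ (All.map (λ Y∉ X≡Y → Y∉ (here (sym X≡Y))) (FreshKeys-∉ fr)) ∷ FreshKeys-unique fr

  Flattens : Term → Set
  Flattens e = ∀ Xs → ∃₂ λ e′ Δ → e ⇝ e′ ∣ Δ × FreshKeys Xs Δ

  flatten* : ∀ {n} (es : Vec Term n) → (∀ i → Flattens (lookup es i)) →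
             ∀ Xs → ∃₂ λ Ys Δ → es ⇝* Ys ∣ Δ × FreshKeys Xs Δ
  flatten* []       ih Xs = [] , [] , [] , []
  flatten* (e ∷ es) ih Xs
    with X , X∉ ← freshVar Xs
    with e′ , Δ , fl , fr ← ih zero (X ∷ Xs)
    with Ys , Δ′ , fls , fr′ ← flatten* es (ih ∘ suc) (keys Δ ++ X ∷ Xs) =
    X ∷ Ys , _ , fl ∷ fls , add X∉ (FreshKeys-++ fr fr′)

  flatten : ∀ e → Flattens e
  flatten = elim _ (λ a Xs → _ , _ , atom , []) flatten-lam
    (λ f es ih Xs → let Ys , Δ , fls , fr = flatten* es ih Xs in _ , _ , fun fls , fr)
    flatten-letrec
    (λ π X Xs → _ , _ , susp , [])
    where
    flatten-lam : ∀ a e → Flattens e → Flattens (lam a e)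
    flatten-lam a e ih Xs with X , X∉ ← freshVar Xs with e′ , Δ , fl , fr ← ih (X ∷ Xs) =
      _ , _ , lam fl , add X∉ fr
    flatten-letrec : ∀ {n} as .(u : Unique as) (es : Vec Term n) e →
                     (∀ i → Flattens (lookup es i)) → Flattens e → Flattens (letrec as u es e)
    flatten-letrec as u es e ihs ih Xs
      with X ∷ Ys , Δ , fls , fr ← flatten* (e ∷ es) (λ { zero → ih ; (suc i) → ihs i }) Xs =
      _ , _ , letrec fls , fr

  flattenEqns : ∀ Γ Xs → ∃₂ λ Γ′ Δ → FlatEqns Γ Γ′ Δ × FreshKeys Xs Δ
  flattenEqns []            Xs = [] , [] , [] , []
  flattenEqns ((s ≐ t) ∷ Γ) Xs
    with s′ , Δ , fs , fr ← flatten s Xs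
    with t′ , Δ′ , ft , fr′ ← flatten t (keys Δ ++ Xs)
    with Γ′ , Δ″ , fΓ , fr″ ← flattenEqns Γ (keys Δ′ ++ keys Δ ++ Xs) =
    _ , _ , (fs , ft) ∷ fΓ , FreshKeys-++ fr (FreshKeys-++ fr′ fr″)

  infix 4 _∈_∪keys_
  _∈_∪keys_ : Var → List Var → Subst → Set
  X ∈ Xs ∪keys Δ = X ∈ Xs ⊎ X ∈ keys Δ

  -- Looks in the direction opposite to `FreshKeys`: flattening introduces a variable before those
  -- of its right-hand side, so these are later keys or variables of the problem.
  data Scoped (Xs : List Var) : Subst → Set where
    []  : Scoped Xs []
    add : ∀ {X t Δ} → Vars (_∈ Xs ∪keys Δ) t → Scoped Xs Δ → Scoped Xs ((X , t) ∷ Δ)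

  Scoped-++ : ∀ {Xs Δ Δ′} → Scoped Xs Δ → Scoped Xs Δ′ → Scoped Xs (Δ ++ Δ′)
  Scoped-++ [] cl′ = cl′
  Scoped-++ {Xs} {_ ∷ Δ} {Δ′} (add t∈ cl) cl′ = add (λ Y p → weaken (t∈ Y p)) (Scoped-++ cl cl′)
    where
    weaken : ∀ {Y} → Y ∈ Xs ∪keys Δ → Y ∈ Xs ∪keys (Δ ++ Δ′)
    weaken (inj₁ Y∈) = inj₁ Y∈
    weaken (inj₂ Y∈) = inj₂ (subst (_ ∈_) (sym (List.map-++ proj₁ Δ Δ′)) (∈.∈-++⁺ˡ Y∈))

  Scoped-vars : ∀ {Xs Δ} → Scoped Xs Δ → All (λ (_ , t) → Vars (_∈ Xs ∪keys Δ) t) Δ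
  Scoped-vars [] = []
  Scoped-vars {Xs} (add {X} {t} {Δ} t∈ cl) = (λ Y p → weaken (t∈ Y p)) ∷
    All.map (λ s∈ Y p → weaken (s∈ Y p)) (Scoped-vars cl)
    where
    weaken : ∀ {Y} → Y ∈ Xs ∪keys Δ → Y ∈ Xs ∪keys ((X , t) ∷ Δ)
    weaken (inj₁ Y∈) = inj₁ Y∈
    weaken (inj₂ Y∈) = inj₂ (there Y∈)

  -- From a key onwards, right-hand sides contain only variables of `Xs` and later keys, all
  -- distinct from it. Hence the added equations can be solved as a substitution.
  Scoped-triangular : ∀ {Xs Δ} → FreshKeys Xs Δ → Scoped Xs Δ → Triangular Δ
  Scoped-triangular [] [] = []
  Scoped-triangular {Xs} {(X , t) ∷ Δ} (add X∉ fr) (add t∈ cl) = add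
    (λ Y p → avoid (t∈ Y p))
    (All.zip (All.map (λ Y∉ Y≡X → Y∉ (here Y≡X)) (FreshKeys-∉ fr) ,
              All.map (λ s∈ Y p → avoid (s∈ Y p)) (Scoped-vars cl)))
    (Scoped-triangular (FreshKeys-⊆ there fr) cl)
    where
    avoid : ∀ {Y} → Y ∈ Xs ∪keys Δ → Y ≢ X
    avoid (inj₁ Y∈) refl = X∉ Y∈
    avoid (inj₂ Y∈) refl with (Z , s) , p∈ , refl ← ∈.∈-map⁻ proj₁ Y∈ =
      All.lookup (FreshKeys-∉ fr) p∈ (here refl)

  mutual
    ⇝-scoped : ∀ {Xs e e′ Δ} → e ⇝ e′ ∣ Δ → Vars (_∈ Xs) e → Vars (_∈ Xs ∪keys Δ) e′ × Scoped Xs Δ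
    ⇝-scoped atom _ = (λ _ ()) , []
    ⇝-scoped susp h = (λ X p → inj₁ (h X p)) , []
    ⇝-scoped (lam fl) h with e′∈ , cl ← ⇝-scoped fl (λ X p → h X (lam p)) =
      (λ { X (lam susp) → inj₂ (here refl) }) , add e′∈ cl
    ⇝-scoped (fun {Xs = Ys} fls) h with Ys∈ , cl ← ⇝*-scoped fls (λ i X p → h X (fun i p)) =
      (λ { X (fun i p) → inj₂ (var∈ Ys Ys∈ i p) }) , cl
    ⇝-scoped {Xs} (letrec {Xs = Ys} fls) h
      with Ys∈ , cl ← ⇝*-scoped {Xs} fls (λ { zero X p → h X (inExpr p) ; (suc i) X p → h X (rhs i p) }) =
      (λ { X (rhs i p)     → inj₂ (var∈ Ys (Ys∈ ∘ suc) i p)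
         ; X (inExpr susp) → inj₂ (Ys∈ zero) }) , cl

    ⇝*-scoped : ∀ {Xs n Δ} {es : Vec Term n} {Ys} → es ⇝* Ys ∣ Δ →
                (∀ i → Vars (_∈ Xs) (lookup es i)) → (∀ i → lookup Ys i ∈ keys Δ) × Scoped Xs Δ
    ⇝*-scoped [] h = (λ ()) , []
    ⇝*-scoped (_∷_ {X = X} {Δ} {Δ′} fl fls) h
      with e′∈ , cl ← ⇝-scoped fl (h zero) | Ys∈ , cl′ ← ⇝*-scoped fls (h ∘ suc)
      with add t∈ cl″ ← Scoped-++ (add {X = X} e′∈ cl) cl′ =
      (λ { zero → here refl
         ; (suc i) → there (subst (_ ∈_) (sym (List.map-++ proj₁ Δ Δ′)) (∈.∈-++⁺ʳ (keys Δ) (Ys∈ i))) }) ,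
      add t∈ cl″

    var∈ : ∀ {n Zs} (Ys : Vec Var n) → (∀ i → lookup Ys i ∈ Zs) →
           ∀ i {X} → X ∈Var lookup (Vec.map var Ys) i → X ∈ Zs
    var∈ Ys Ys∈ i p with susp ← subst (_ ∈Var_) (Vec.lookup-map i var Ys) p = Ys∈ i

  FlatEqns-scoped : ∀ {Xs Γ Γ′ Δ} → FlatEqns Γ Γ′ Δ → All (VarsEqn (_∈ Xs)) Γ → Scoped Xs Δ
  FlatEqns-scoped [] [] = []
  FlatEqns-scoped ((fs , ft) ∷ fΓ) ((hs , ht) ∷ h) = Scoped-++ (proj₂ (⇝-scoped fs hs))
    (Scoped-++ (proj₂ (⇝-scoped ft ht)) (FlatEqns-scoped fΓ h))

  mutual
    ⇝-flat : ∀ {e e′ Δ} → e ⇝ e′ ∣ Δ → Flat e′ × All (Flat ∘ proj₂) Δ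
    ⇝-flat atom      = atom , []
    ⇝-flat susp      = susp , []
    ⇝-flat (lam fl) with fe , fΔ ← ⇝-flat fl = lam susp , fe ∷ fΔ
    ⇝-flat (fun {Xs = Ys} fls) = fun (vars-suspensions Ys) , ⇝*-flat fls
    ⇝-flat (letrec {Xs = Ys} fls) = letrec (vars-suspensions Ys) susp , ⇝*-flat fls

    ⇝*-flat : ∀ {n Δ} {es : Vec Term n} {Ys} → es ⇝* Ys ∣ Δ → All (Flat ∘ proj₂) Δ
    ⇝*-flat []         = []
    ⇝*-flat (fl ∷ fls) with fe , fΔ ← ⇝-flat fl = fe ∷ All.++⁺ fΔ (⇝*-flat fls)

    vars-suspensions : ∀ {n} (Ys : Vec Var n) i → Suspension (lookup (Vec.map var Ys) i)
    vars-suspensions Ys i = subst Suspension (sym (Vec.lookup-map i var Ys)) susp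

  FlatEqns-flat : ∀ {Γ Γ′ Δ} → FlatEqns Γ Γ′ Δ → All FlatEqn Γ′ × All (Flat ∘ proj₂) Δ
  FlatEqns-flat [] = [] , []
  FlatEqns-flat ((fs , ft) ∷ fΓ)
    with s , hΔ ← ⇝-flat fs | t , hΔ′ ← ⇝-flat ft | hΓ , hΔ″ ← FlatEqns-flat fΓ =
    (s , t) ∷ hΓ , All.++⁺ hΔ (All.++⁺ hΔ′ hΔ″)

  FlatEqns-complete : ∀ {τ Γ Γ′ Δ} → FlatEqns Γ Γ′ Δ → All (λ (X , t) → τ X ∼ t ⟪ τ ⟫) Δ →
                      All (τ ⊨_) Γ → All (τ ⊨_) Γ′
  FlatEqns-complete [] _ _ = []
  FlatEqns-complete (_∷_ {Δ = Δ} {Δ′} (fs , ft) fΓ) hΔ (s∼t ∷ h) =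
    ∼-trans (⇝-sound fs (All.++⁻ˡ Δ hΔ))
      (∼-trans s∼t (∼-sym (⇝-sound ft (All.++⁻ˡ Δ′ (All.++⁻ʳ Δ hΔ)))))
    ∷ FlatEqns-complete fΓ (All.++⁻ʳ Δ′ (All.++⁻ʳ Δ hΔ)) h

  remove : Var → List Var → List Var
  remove X = filter λ Y → ¬? (Y ≟ⱽ X)

  remove-shorter : ∀ {X Xs} → X ∈ Xs → length (remove X Xs) < length Xs
  remove-shorter {X} {Xs} X∈ =
    List.filter-notAll (λ Y → ¬? (Y ≟ⱽ X)) Xs (Any.map (λ X≡Y Y≢X → Y≢X (sym X≡Y)) X∈)

  VarsEqns-remove : ∀ {X Xs Γ} → All (VarsEqn (_∈ Xs)) Γ → All (VarsEqn (_≢ X)) Γ →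
                    All (VarsEqn (_∈ remove X Xs)) Γ
  VarsEqns-remove {X} h h≢ = All.map
    (λ ((l , r) , (l≢ , r≢)) → (λ Y p → ∈.∈-filter⁺ (λ Y → ¬? (Y ≟ⱽ X)) (l Y p) (l≢ Y p)) ,
                               (λ Y p → ∈.∈-filter⁺ (λ Y → ¬? (Y ≟ⱽ X)) (r Y p) (r≢ Y p)))
    (All.zip (h , h≢))

  -- Runs guided by a ground solution

  Completed : GroundSubst → State → Set
  Completed τ S = ∃ λ S′ → Star _⟶_ S S′ × Sat τ S′ ×
                  All Fixpoint (State.Γ S′) × ¬ (∃ λ S″ → S′ ⟶¹ S″)

  -- Lexicographic recursion: `Xs` contains the variables of Γ and loses one whenever a variable is
  -- bound, after which the weight may start afresh.
  run : ∀ Xs → Acc _<_ (length Xs) → ∀ {τ S} → Acc _<_ (weight (State.Γ S)) →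
        All (VarsEqn (_∈ Xs)) (State.Γ S) → All FlatEqn (State.Γ S) → Sat τ S → Completed τ S
  run Xs (acc rs) = go
    where
    go : ∀ {τ S} → Acc _<_ (weight (State.Γ S)) →
         All (VarsEqn (_∈ Xs)) (State.Γ S) → All FlatEqn (State.Γ S) → Sat τ S → Completed τ S
    go (acc ws) Γ⊆Xs flat sat with progress sat
    ... | inj₂ (fixpoints , nohigh) = _ , ε , sat , fixpoints , nohigh
    ... | inj₁ (S , st , sat′) with step-measure st flat
    ...   | inj₁ lighter
      with S′ , sts , out ← go (ws lighter) (step-vars st Γ⊆Xs) (step-flat st flat) sat′ =
      S′ , st ◅ sts , out
    ...   | inj₂ b
      with S′ , sts , out ← run (remove (Binds.X b) Xs) (rs (remove-shorter (proj₁ (Binds.occurs b Γ⊆Xs))))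
             (<-wellFounded _) (VarsEqns-remove (step-vars st Γ⊆Xs) (Binds.vanishes b))
             (step-flat st flat) sat′ =
      S′ , st ◅ sts , out

  Fixpoint-sym : ∀ {s t} → Fixpoint (s ≐ t) → Fixpoint (t ≐ s)
  Fixpoint-sym fixpoint = fixpoint

  no-low-step : ∀ {Γ ∇ θ} → All Fixpoint Γ → ¬ (∃ λ S → ⟨ Γ , ∇ , θ ⟩ₛ ⟶² S)
  no-low-step fixpoints (_ , mms del _ ns _ _) with fixpoint ← proj₁ (∋-All⁻ Fixpoint-sym del fixpoints) =
    ns _ _ refl
  no-low-step fixpoints (_ , fps _ del _ _ ns _) with fixpoint ← proj₁ (∋-All⁻ Fixpoint-sym del fixpoints) =
    ns _ _ refl

  Fixpoints⇒FixEqns : ∀ {Γ} → All Fixpoint Γ → ∃ λ FIX → Γ ≡ List.map fixEqn FIX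
  Fixpoints⇒FixEqns [] = [] , refl
  Fixpoints⇒FixEqns (fixpoint {π} {π′} {X} ∷ h) with FIX , refl ← Fixpoints⇒FixEqns h =
    fix π π′ X ∷ FIX , refl

  satisfied-variables : ∀ {τ ∇} → All (τ ⊨ᶠ_) ∇ → ∃ λ ∇′ → ∇ ≡ List.map (uncurry _#ⱽ_) ∇′
  satisfied-variables [] = [] , refl
  satisfied-variables {∇ = (a #ⱽ X) ∷ ∇} (_ ∷ h) with ∇′ , refl ← satisfied-variables h =
    (a , X) ∷ ∇′ , refl

  -- A τ satisfying the bindings absorbs them. This excludes (FailFS) and makes τ an instance of the
  -- computed substitution.
  solved-ˢ : ∀ {τ σ} e → All (λ (X , t) → τ X ∼ t ⟪ τ ⟫) σ → (e [ σ ]ˢ) ⟪ τ ⟫ ∼ e ⟪ τ ⟫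
  solved-ˢ e [] = ∼-refl
  solved-ˢ {σ = (X , t) ∷ σ} e (X∼t ∷ h) = ∼-trans (solved-ˢ (e ⟪ X ↦ t ⟫) h) (⟪↦⟫-∼ X∼t e)

  -- A suspension has no free atoms, so instantiation can only add some.
  FA-⟪⟫ : ∀ {τ : V → Ground} {a e} → a ∈FA e → a ∈FA e ⟪ τ ⟫
  FA-⟪⟫ atom          = atom
  FA-⟪⟫ (lam a≢b a∈e) = lam a≢b (FA-⟪⟫ a∈e)
  FA-⟪⟫ (fun {es = es} i a∈e) = fun i (subst (_ ∈FA_) (sym (lookup-⟪⟫* _ es i)) (FA-⟪⟫ a∈e))
  FA-⟪⟫ (rhs {es = es} a∉as i a∈e) =
    rhs a∉as i (subst (_ ∈FA_) (sym (lookup-⟪⟫* _ es i)) (FA-⟪⟫ a∈e))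
  FA-⟪⟫ (inExpr a∉as a∈e) = inExpr a∉as (FA-⟪⟫ a∈e)

  no-failure : ∀ {τ S} → Sat τ S → All Fixpoint (State.Γ S) → ¬ Fails S
  no-failure sat fixpoints (clash q∈ eq _ _) with fixpoint ← All.lookup fixpoints q∈ with () ← eq
  no-failure {τ} sat fixpoints (cycle X⊳⁺X) = acyclic {τ} (Sat.eqns sat) X⊳⁺X
  no-failure sat fixpoints (failF a∈) = All.lookup (Sat.fresh sat) a∈
  no-failure {τ} sat fixpoints (failFS {θ = θ} {X = X} c∈ a∈) =
    All.lookup (Sat.fresh sat) c∈ (subst (_ ∈FA_) ([]-· (τ X))
      (FA-resp (solved-ˢ {σ = θ} (var X) (Sat.binds sat)) (FA-⟪⟫ a∈)))

  completeness : ∀ P μ → Solves μ P →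
    ∃ λ U → P ⇓ U × (∃ λ ρ → ∀ X → X ∈VarProblem P → μ X ∼ (Triple.σ U ⨾ ρ) X)
  completeness P μ sol = U , (Γ₀ , S , flattening , sts , outputs) , τ , instantiates
    where
    open Problem P
    Xs = eqnsVars Γ ++ List.map proj₂ ∇
    flattened = flattenEqns Γ Xs
    body = proj₁ flattened
    Δ = proj₁ (proj₂ flattened)
    flattens = proj₁ (proj₂ (proj₂ flattened))
    freshKeys = proj₂ (proj₂ (proj₂ flattened))
    Γ₀ = body ++ List.map (λ (X , t) → var X ≐ t) Δ

    Γ⊆Xs : All (VarsEqn (_∈ Xs)) Γ
    Γ⊆Xs = All.map (λ (l , r) → (λ X p → ∈.∈-++⁺ˡ (l X p)) , (λ X p → ∈.∈-++⁺ˡ (r X p))) (∈-eqnsVars Γ)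

    VarProblem⊆Xs : ∀ {X} → X ∈VarProblem P → X ∈ Xs
    VarProblem⊆Xs {X} (inj₁ X∈) with find X∈
    ... | _ , q∈ , left p  = proj₁ (All.lookup Γ⊆Xs q∈) X p
    ... | _ , q∈ , right p = proj₂ (All.lookup Γ⊆Xs q∈) X p
    VarProblem⊆Xs (inj₂ X∈) = ∈.∈-++⁺ʳ (eqnsVars Γ) X∈

    flattening : Flattening P Γ₀
    flattening = record
      { flattens   = flattens
      ; pairwise≢  = FreshKeys-unique freshKeys
      ; freshNames = λ X∈Δ X∈P → let _ , p∈ , eq = ∈.∈-map⁻ proj₁ X∈Δ in
          All.lookup (FreshKeys-∉ freshKeys) p∈ (subst (_∈ Xs) eq (VarProblem⊆Xs X∈P))
      ; result     = refl }

    -- The equations added by flattening, applied as a substitution before μ, give each new variable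
    -- its intended value; their keys being new, τ and μ agree on the problem.
    τ = Δ ⨾ μ

    τ≡μ : ∀ {X} → X ∈ Xs → τ X ≡ μ X
    τ≡μ X∈ = ⨾-∉dom Δ μ (All.map (λ { Y∉ refl → Y∉ X∈ }) (FreshKeys-∉ freshKeys))

    τ⊨Δ : All (λ (X , t) → τ X ∼ t ⟪ τ ⟫) Δ
    τ⊨Δ = All.map ∼-reflexive
      (Triangular-solved μ (Scoped-triangular freshKeys (FlatEqns-scoped flattens Γ⊆Xs)))

    τ⊨Γ : All (τ ⊨_) Γ
    τ⊨Γ = All.tabulate λ { {s ≐ t} q∈ → let l , r = All.lookup Γ⊆Xs q∈ in subst₂ _∼_
      (⟪⟫-cong s λ X p → sym (τ≡μ (l X p))) (⟪⟫-cong t λ X p → sym (τ≡μ (r X p)))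
      (Solves.equations sol q∈) }

    sat₀ : Sat τ (initial P Γ₀)
    sat₀ = record
      { eqns  = All.++⁺ (FlatEqns-complete flattens τ⊨Δ τ⊨Γ)
                  (All.map⁺ (All.map (λ {(X , t)} → subst (_∼ t ⟪ τ ⟫) (sym ([]-· (τ X)))) τ⊨Δ))
      ; fresh = All.map⁺ (All.tabulate λ { {a , X} c∈ → subst (a #_)
                  (sym (τ≡μ (∈.∈-++⁺ʳ (eqnsVars Γ) (∈.∈-map⁺ proj₂ c∈)))) (Solves.freshness sol c∈) })
      ; binds = [] }

    flat : All FlatEqn Γ₀
    flat = All.++⁺ (proj₁ (FlatEqns-flat flattens)) (All.map⁺ (All.map (susp ,_) (proj₂ (FlatEqns-flat flattens))))

    final = run (eqnsVars Γ₀) (<-wellFounded _) (<-wellFounded _) (∈-eqnsVars Γ₀) flat sat₀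
    S = proj₁ final
    sts = proj₁ (proj₂ final)
    sat = proj₁ (proj₂ (proj₂ final))
    all-fixpoints = proj₁ (proj₂ (proj₂ (proj₂ final)))
    FIX = Fixpoints⇒FixEqns all-fixpoints
    ∇′ = satisfied-variables (Sat.fresh sat)

    U : Triple
    U = record { σ = State.θ S ; ∇′ = proj₁ ∇′ ; FIX = proj₁ FIX }

    outputs : Outputs S U
    outputs = record
      { Γ-fixpoints = proj₂ FIX
      ; ∇-variables = proj₂ ∇′
      ; θ-output    = refl
      ; no-failure  = no-failure sat all-fixpoints
      ; no-high     = proj₂ (proj₂ (proj₂ (proj₂ final)))
      ; no-low      = no-low-step all-fixpoints }

    -- The ground substitution required is τ itself: the final state is satisfied by τ, which
    -- therefore absorbs θ.
    instantiates : ∀ X → X ∈VarProblem P → μ X ∼ (State.θ S ⨾ τ) X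
    instantiates X X∈ = subst (_∼ (State.θ S ⨾ τ) X) (τ≡μ (VarProblem⊆Xs X∈))
      (∼-sym (subst ((State.θ S ⨾ τ) X ∼_) ([]-· (τ X)) (solved-ˢ {σ = State.θ S} (var X) (Sat.binds sat))))

theorem5p3 : (L : Language) → let open LRLX L in
    (P : Problem) →
    (∀ U → P ⇓ U → IsUnifier P U)
    ×
    (∀ μ → Solves μ P →
    ∃ λ U → (P ⇓ U) ×
    (∃ λ ρ → ∀ X → X ∈VarProblem P → μ X ∼ (Triple.σ U ⨾ ρ) X))
theorem5p3 L P = soundness L P , completeness L P
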